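{- Let $n,r\ge 1$, let $\mathbf{y}=(y^{(1)},\dots,y^{(r)})$, and let $\boldsymbol{\lambda}=(\lambda^{(1)},\dots,\lambda^{(r)})$ be a sequence of elements of $\mathcal{P}_n$. Write $$s_{\lambda^{(1)}}(x\,|\,y^{(1)})\cdots s_{\lambda^{(r)}}(x\,|\,y^{(r)})=\sum_{\mu\in\mathcal{P}_n}c_{\boldsymbol{\lambda}}^{\mu}(\mathbf{y})\,s_\mu(x),\qquad c_{\boldsymbol{\lambda}}^{\mu}(\mathbf{y})\in\mathbb{Z}[\mathbf{y}].$$ Then for every $\mu\in\mathcal{P}_n$, $$c_{\boldsymbol{\lambda}}^{\mu}(\mathbf{y})=\sum_{T\in\mathcal{LR}_{\boldsymbol{\lambda}}^{\mu}}c_T(\mathbf{y})=\sum_{T\in\mathcal{LR}_{\boldsymbol{\lambda}}^{\mu}}\ \prod_{a\in T,\ a\text{ barred}}y^{(i(a))}_{a+c(a)-r(a)}.$$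
   Context: $\mathcal{P}_n=\{\lambda=(\lambda_1,\dots,\lambda_n)\in\mathbb{N}^n:\lambda_1\ge\dots\ge\lambda_n\}$, identified with Young diagrams (English convention). For $\lambda\in\mathcal{P}_n$, $\mathcal{T}_\lambda$ is the set of semistandard Young tableaux of shape $\lambda$ with entries in $\{1,\dots,n\}$ (rows weakly increasing left to right, columns strictly increasing top to bottom). Let $x=(x_1,\dots,x_n)$ and for $i=1,\dots,r$ let $y^{(i)}=(y^{(i)}_1,y^{(i)}_2,\dots)$ be infinite sets of independent variables. The Schur function is $s_\lambda(x)=\sum_{T\in\mathcal{T}_\lambda}\prod_{a\in T}x_a$, and the factorial Schur function is $s_\lambda(x\,|\,y)=\sum_{T\in\mathcal{T}_\lambda}\prod_{a\in T}(x_a+y_{a+c(a)-r(a)})$, where for an entry $a$ (an integer), $c(a)$ and $r(a)$ are its column and row numbers. The Schur functions $s_\mu(x)$, $\mu\in\mathcal{P}_n$, form a $\mathbb{Z}[\mathbf{y}]$-basis of the ring of polynomials in $x,\mathbf{y}$ symmetric in $x$, so the coefficients $c_{\boldsymbol{\lambda}}^\mu(\mathbf{y})$ are uniquely determined. The skew diagram $\boldsymbol{\lambda}$ is formed by placing the Young diagrams $\lambda^{(1)},\dots,\lambda^{(r)}$ so that each one lies strictly below and strictly to the left of the preceding one (the upper-right corner of $\lambda^{(i+1)}$ touching the lower-left corner of $\lambda^{(i)}$); distinct diagrams thus occupy disjoint rows and disjoint columns. A barred skew tableau of shape $\boldsymbol{\lambda}$ is a filling of the boxes of this skew diagram with elements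 of $\{1,\dots,n\}\cup\{\bar 1,\dots,\bar n\}$ such that, ignoring bars, entries weakly increase along rows from left to right and strictly increase down columns. For an entry $a=j$ or $a=\bar j$, $j$ is its value; in $c_T$ below, "$a$" means its value. $i(a)$ is the index of the Young diagram $\lambda^{(i(a))}$ containing $a$, and $c(a),r(a)$ are the column and row numbers of $a$ within that Young diagram. Define $c_T(\mathbf{y})=\prod_{a\in T\text{ barred}}y^{(i(a))}_{a+c(a)-r(a)}$. The unbarred content of $T$ is $\omega(T)=(\xi_1,\dots,\xi_n)$ with $\xi_k$ the number of unbarred entries equal to $k$. The unbarred column word of $T$ is obtained by reading the unbarred entries of each column from top to bottom, starting with the rightmost column and proceeding leftward (barred entries skipped). A word is Yamanouchi if every initial segment contains at least as many $1$'s as $2$'s, at least as many $2$'s as $3$'s, etc. $\mathcal{LR}_{\boldsymbol{\lambda}}^\mu$ is the set of barred skew tableaux of shape $\boldsymbol{\lambda}$ with unbarred content $\mu$ whose unbarred column word is Yamanouchi. -}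

module Defs where

open import Level using (0ℓ)
open import Data.Bool using (Bool; true; false; _∧_; T; not; if_then_else_)
open import Data.Nat using (ℕ; zero; suc; _+_; _∸_; _≤ᵇ_; _<ᵇ_; _≡ᵇ_; _≥_; _≥?_)
open import Data.Product using (_×_; _,_; proj₁; proj₂)
open import Data.List as L using (List; []; _∷_; _++_; map; concatMap; foldr; length; reverse; upTo; replicate; filterᵇ; inits)
open import Data.Nat.ListAction using (sum)
open import Data.Bool.ListAction using (all)
open import Data.List.Relation.Unary.Linked using (Linked; linked?)
open import Data.Vec as V using (Vec)
open import Relation.Nullary.Decidable using (isYes)
open import Algebra.Bundles using (CommutativeRing)

-- Polynomials with integer coefficients in a set V of variables.
-- Poly V is the set of ring expressions; two expressions are equal in
-- ℤ[V] iff they evaluate equally in every commutative ring under every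
-- assignment of the variables (ℤ[V] is the free commutative ring on V).

data Poly (V : Set) : Set where
  var : V → Poly V
  𝟘 𝟙 : Poly V
  _⊕_ _⊗_ : Poly V → Poly V → Poly V
  ⊖_ : Poly V → Poly V

infixl 6 _⊕_
infixl 7 _⊗_

module _ (R : CommutativeRing 0ℓ 0ℓ) where
  open CommutativeRing R renaming (_+_ to _+R_; _*_ to _*R_; -_ to -R_)
  ⟦_⟧ : ∀ {V : Set} → Poly V → (V → Carrier) → Carrier
  ⟦ var v ⟧ ρ = ρ v
  ⟦ 𝟘 ⟧ ρ = 0#
  ⟦ 𝟙 ⟧ ρ = 1#
  ⟦ p ⊕ q ⟧ ρ = ⟦ p ⟧ ρ +R ⟦ q ⟧ ρ
  ⟦ p ⊗ q ⟧ ρ = ⟦ p ⟧ ρ *R ⟦ q ⟧ ρ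
  ⟦ ⊖ p ⟧ ρ = -R ⟦ p ⟧ ρ

infix 4 _≈P_
_≈P_ : ∀ {V : Set} → Poly V → Poly V → Set₁
_≈P_ {V} p q = (R : CommutativeRing 0ℓ 0ℓ) (ρ : V → CommutativeRing.Carrier R) →
  CommutativeRing._≈_ R (⟦ R ⟧ p ρ) (⟦ R ⟧ q ρ)

mapPoly : ∀ {V W : Set} → (V → W) → Poly V → Poly W
mapPoly f (var v) = var (f v)
mapPoly f 𝟘 = 𝟘
mapPoly f 𝟙 = 𝟙
mapPoly f (p ⊕ q) = mapPoly f p ⊕ mapPoly f q
mapPoly f (p ⊗ q) = mapPoly f p ⊗ mapPoly f q
mapPoly f (⊖ p) = ⊖ mapPoly f p

ΣP ΠP : ∀ {V : Set} → List (Poly V) → Poly V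
ΣP = foldr _⊕_ 𝟘
ΠP = foldr _⊗_ 𝟙

-- Variables.  yv i j  is  y^{(i)}_j  (i, j ≥ 1);  xv a  is  x_a  (1 ≤ a ≤ n).

YVar : Set
YVar = ℕ × ℕ

data Var : Set where
  xv : ℕ → Var
  yv : ℕ → ℕ → Var

embedY : Poly YVar → Poly Var
embedY = mapPoly (λ ij → yv (proj₁ ij) (proj₂ ij))

IsPartition : ∀ {n} → Vec ℕ n → Set
IsPartition μ = Linked _≥_ (V.toList μ)

size : ∀ {n} → Vec ℕ n → ℕ
size μ = sum (V.toList μ)

sequenceL : ∀ {A : Set} → List (List A) → List (List A)
sequenceL [] = [] ∷ []
sequenceL (xs ∷ xss) = concatMap (λ x → map (x ∷_) (sequenceL xss)) xs

allVecs : (n : ℕ) → List ℕ → List (Vec ℕ n)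
allVecs zero xs = V.[] ∷ []
allVecs (suc n) xs = concatMap (λ x → map (x V.∷_) (allVecs n xs)) xs

partitionsUpTo : (n N : ℕ) → List (Vec ℕ n)
partitionsUpTo n N =
  filterᵇ (λ μ → isYes (linked? _≥?_ (V.toList μ)) ∧ (size μ ≤ᵇ N))
          (allVecs n (upTo (suc N)))

-- Fillings of a Young diagram: a filling is the list of its rows
-- (top to bottom), each row a list of entries (left to right).

range1 : ℕ → List ℕ
range1 n = map suc (upTo n)

fillings : ∀ {A : Set} → List ℕ → List A → List (List (List A))
fillings shape xs = sequenceL (map (λ k → sequenceL (replicate k xs)) shape)

weakRow : List ℕ → Bool
weakRow (a ∷ b ∷ w) = (a ≤ᵇ b) ∧ weakRow (b ∷ w)
weakRow _ = true

strictBelow : List ℕ → List ℕ → Bool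
strictBelow (a ∷ u) (b ∷ l) = (a <ᵇ b) ∧ strictBelow u l
strictBelow _ _ = true

-- rows weakly increasing, columns strictly increasing
-- (for fillings of a Young diagram, i.e. row lengths weakly decreasing)
isSemistandard : List (List ℕ) → Bool
isSemistandard [] = true
isSemistandard (u ∷ []) = weakRow u
isSemistandard (u ∷ l ∷ rs) = weakRow u ∧ strictBelow u l ∧ isSemistandard (l ∷ rs)

SSYT : ∀ {n} → Vec ℕ n → List (List (List ℕ))
SSYT {n} λ' = filterᵇ isSemistandard (fillings (V.toList λ') (range1 n))

prodRow : ∀ {A V : Set} → (ℕ → ℕ → A → Poly V) → ℕ → ℕ → List A → Poly V
prodRow f r c [] = 𝟙
prodRow f r c (a ∷ w) = f r c a ⊗ prodRow f r (suc c) w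

prodBoxes' : ∀ {A V : Set} → (ℕ → ℕ → A → Poly V) → ℕ → List (List A) → Poly V
prodBoxes' f r [] = 𝟙
prodBoxes' f r (w ∷ ws) = prodRow f r 1 w ⊗ prodBoxes' f (suc r) ws

prodBoxes : ∀ {A V : Set} → (ℕ → ℕ → A → Poly V) → List (List A) → Poly V
prodBoxes f = prodBoxes' f 1

schur : ∀ {n} → Vec ℕ n → Poly Var
schur λ' = ΣP (map (prodBoxes (λ r c a → var (xv a))) (SSYT λ'))

factorialSchur : ∀ {n} → ℕ → Vec ℕ n → Poly Var
factorialSchur i λ' =
  ΣP (map (prodBoxes (λ r c a → var (xv a) ⊕ var (yv i ((a + c) ∸ r)))) (SSYT λ'))

indexed1 : ∀ {A : Set} → List A → List (ℕ × A)
indexed1 xs = L.zip (range1 (length xs)) xs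

prodFactorialSchur : ∀ {n r} → Vec (Vec ℕ n) r → Poly Var
prodFactorialSchur λs =
  ΠP (map (λ iλ → factorialSchur (proj₁ iλ) (proj₂ iλ)) (indexed1 (V.toList λs)))

-- Barred skew tableaux.  An entry is (b , j): value j, barred iff b = true.
-- Since the diagrams λ^{(1)},…,λ^{(r)} occupy disjoint rows and columns,
-- a filling of the skew diagram is the list (i = 1..r) of fillings of the
-- individual diagrams, and the tableau conditions are per diagram.

Entry : Set
Entry = Bool × ℕ

barredEntries : ℕ → List Entry
barredEntries n = concatMap (λ j → (false , j) ∷ (true , j) ∷ []) (range1 n)

values : List (List Entry) → List (List ℕ)
values = map (map proj₂)

barredSkewTableaux : ∀ {n r} → Vec (Vec ℕ n) r → List (List (List (List Entry)))
barredSkewTableaux {n} λs =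
  filterᵇ (λ T → all (λ t → isSemistandard (values t)) T)
          (sequenceL (map (λ λ' → fillings (V.toList λ') (barredEntries n)) (V.toList λs)))

count : ℕ → List ℕ → ℕ
count k w = length (filterᵇ (λ a → a ≡ᵇ k) w)

unbarredValues : List Entry → List ℕ
unbarredValues w = map proj₂ (filterᵇ (λ e → not (proj₁ e)) w)

eqListℕ : List ℕ → List ℕ → Bool
eqListℕ [] [] = true
eqListℕ (a ∷ u) (b ∷ v) = (a ≡ᵇ b) ∧ eqListℕ u v
eqListℕ _ _ = false

hasUnbarredContent : ∀ {n} → List (List (List Entry)) → Vec ℕ n → Bool
hasUnbarredContent {n} T μ =
  eqListℕ (map (λ k → count k (unbarredValues (L.concat (L.concat T)))) (range1 n))
          (V.toList μ)

column : ∀ {A : Set} → ℕ → List (List A) → List A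
column c rows = concatMap (λ w → L.take 1 (L.drop c w)) rows

width : ∀ {A : Set} → List (List A) → ℕ
width [] = 0
width (w ∷ _) = length w

columnWord : List (List Entry) → List Entry
columnWord t = concatMap (λ c → column c t) (reverse (upTo (width t)))

-- unbarred column word of the skew tableau: λ^{(1)} is rightmost,
-- so its columns are read first, then those of λ^{(2)}, etc.
unbarredColumnWord : List (List (List Entry)) → List ℕ
unbarredColumnWord T = unbarredValues (concatMap columnWord T)

isYamanouchi : ℕ → List ℕ → Bool
isYamanouchi n w =
  all (λ p → all (λ k → count (suc k) p ≤ᵇ count k p) (range1 n)) (inits w)

LR : ∀ {n r} → Vec (Vec ℕ n) r → Vec ℕ n → List (List (List (List Entry)))
LR {n} λs μ =
  filterᵇ (λ T → hasUnbarredContent T μ ∧ isYamanouchi n (unbarredColumnWord T))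
          (barredSkewTableaux λs)

cT : List (List (List Entry)) → Poly YVar
cT T = ΠP (map (λ it → prodBoxes (λ r c e →
              if proj₁ e then var (proj₁ it , (proj₂ e + c) ∸ r) else 𝟙) (proj₂ it))
           (indexed1 T))

{-# OPTIONS --safe #-}
module Submission where

-- Let φ be the linear form on R[x₁, …, xₙ] which takes the coefficient of x^(μ+ρ) in the
-- antisymmetrization of a polynomial.  It is alternating in the exponents, takes the value δ_{μν} on
-- x^(ν+ρ), and φ(x^ρ s_ν) = δ_{μν}; hence φ(x^ρ p) is the coefficient of s_μ in a symmetric p.
-- Instantiating the given identity in the ring of operators on linear forms generated by R and the
-- multiplications by x_a extracts c_μ from its right-hand side without any polynomial arithmetic.
-- The left-hand side is expanded column by column from the right, splitting x_a + y into an unbarred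
-- and a barred entry.  When a column breaks the Yamanouchi condition, some unbarred k + 1 makes two
-- adjacent exponents equal, and the columns further to the left contribute 0: their sum is symmetric in x_k
-- and x_{k+1} whenever the bounding column contains k + 1, so it maps φ to a linear form which
-- is still alternating in these two exponents.

open import Defs
open import Level using (0ℓ)
open import Algebra.Bundles using (CommutativeRing)
import Algebra.Properties.AbelianGroup
import Algebra.Properties.CommutativeSemigroup
import Algebra.Properties.Ring
open import Data.Bool using (Bool; true; false; _∧_; T; T?; not; if_then_else_)
open import Data.Bool.ListAction using (all; and)
open import Data.Bool.Properties using (∧-assoc; ∧-comm; ∧-identityʳ; ∧-zeroʳ; T-≡)
open import Data.Bool.Solver using (module ∨-∧-Solver)
open import Data.Empty using (⊥; ⊥-elim)
open import Data.List using (List; []; _∷_; [_]; _++_; _ʳ++_; applyDownFrom; applyUpTo; concat; concatMap; downFrom; drop; filterᵇ; foldr; inits; length; map; replicate; reverse; take; upTo; zip)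
open import Data.List.Membership.Propositional using (_∈_; find)
open import Data.List.Membership.Propositional.Properties using (∈-concatMap⁻; ∈-map⁻)
open import Data.List.Properties using (++-identityʳ; concat-++; concatMap-++; concatMap-cong; downFrom-∷ʳ; length-map; length-replicate; map-downFrom; map-replicate; map-∘; reverse-involutive; reverse-map; reverse-upTo; unfold-reverse; ∷-injective)
open import Data.List.Relation.Binary.Permutation.Propositional as ↭ using (_↭_; ↭-refl; ↭-trans; module PermutationReasoning)
import Data.List.Relation.Binary.Permutation.Propositional.Properties as ↭
open import Data.List.Relation.Binary.Pointwise using (Pointwise; []; _∷_)
open import Data.List.Relation.Unary.All as All using (All; []; _∷_)
import Data.List.Relation.Unary.All.Properties as All
open import Data.List.Relation.Unary.Any using (here; there)
open import Data.List.Relation.Unary.Linked as Linked using (Linked; []; [-]; _∷_; linked?)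
import Data.List.Relation.Unary.Linked.Properties as Linked
open import Data.Nat using (ℕ; zero; suc; pred; _+_; _∸_; _≤_; _<_; _≥_; _≤?_; _≥?_; _≤ᵇ_; _<ᵇ_; _≡ᵇ_; z≤n; s≤s; s≤s⁻¹)
import Data.Nat.Properties as ℕ
open import Data.Product using (Σ; _×_; _,_; proj₁; proj₂)
open import Data.Sum using (_⊎_; inj₁; inj₂)
open import Data.Vec using (Vec; []; _∷_; toList; zipWith)
import Data.Vec as Vec
import Data.Vec.Properties as Vec
open import Function using (_∘_; id; Equivalence)
open import Relation.Binary using (tri<; tri≈; tri>)
open import Relation.Binary.PropositionalEquality as ≡ using (_≡_; _≢_)
import Relation.Binary.Reasoning.Setoid
open import Relation.Nullary using (yes; no)
open import Relation.Nullary.Decidable using (isYes; fromWitness; toWitness)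

-- The symmetry of the sums over the columns further to the left is not evident, because the y-index
-- `(a + c) ∸ r` depends on the box. It holds because this index stays the same when an entry is
-- raised by 1 while one moves one box down or one box to the left. Two weights of k and k + 1 in
-- such positions multiply to `(x k + y) (x (k + 1) + y)` with a single y, which is symmetric. A
-- bounding column with k but without k + 1 destroys the symmetry, since it forbids k + 1 on its
-- left but not k. Such columns do occur inside the recursion, so symmetry alone is too weak an
-- induction hypothesis. It is accompanied by a formula for the change of the sum when that k in the
-- bound is raised to k + 1: the change is a symmetric element times the weight of one box. Symmetry
-- itself is phrased as membership in any predicate closed under the ring operations and containing
-- the symmetric generators. This makes it applicable directly to the property of preserving
-- alternating forms, over every commutative ring and without dividing by 2.

module RingSums (R : CommutativeRing 0ℓ 0ℓ) where
  open CommutativeRing R renaming (_+_ to _+R_; _*_ to _*R_)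
  open Relation.Binary.Reasoning.Setoid setoid
  open Algebra.Properties.CommutativeSemigroup +-commutativeSemigroup
    using (interchange)

  infixr 5 _▹_

  -- Opaque, so that unification recovers the condition b from b ▹ x.
  opaque
    _▹_ : Bool → Carrier → Carrier
    true ▹ x = x
    false ▹ x = 0#

    ▹-true : ∀ {b x} → b ≡ true → (b ▹ x) ≈ x
    ▹-true ≡.refl = refl

    ▹-false : ∀ {b x} → b ≡ false → (b ▹ x) ≈ 0#
    ▹-false ≡.refl = refl

  ▹-cong : ∀ b {x y} → (b ≡ true → x ≈ y) → (b ▹ x) ≈ (b ▹ y)
  ▹-cong true e = trans (▹-true ≡.refl) (trans (e ≡.refl) (sym (▹-true ≡.refl)))
  ▹-cong false e = trans (▹-false ≡.refl) (sym (▹-false ≡.refl))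

  ▹-congˡ : ∀ {b c x} → b ≡ c → (b ▹ x) ≈ (c ▹ x)
  ▹-congˡ ≡.refl = refl

  ▹-∧ : ∀ b c {x} → ((b ∧ c) ▹ x) ≈ (b ▹ c ▹ x)
  ▹-∧ true c = sym (▹-true ≡.refl)
  ▹-∧ false c = trans (▹-false ≡.refl) (sym (▹-false ≡.refl))

  ▹-*ʳ : ∀ b x {y} → (x *R (b ▹ y)) ≈ (b ▹ x *R y)
  ▹-*ʳ true x = trans (*-congˡ (▹-true ≡.refl)) (sym (▹-true ≡.refl))
  ▹-*ʳ false x = trans (*-congˡ (▹-false ≡.refl)) (trans (zeroʳ x) (sym (▹-false ≡.refl)))

  ▹-+ : ∀ b {x y} → (b ▹ x +R y) ≈ ((b ▹ x) +R (b ▹ y))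
  ▹-+ true = trans (▹-true ≡.refl) (sym (+-cong (▹-true ≡.refl) (▹-true ≡.refl)))
  ▹-+ false = trans (▹-false ≡.refl)
    (sym (trans (+-cong (▹-false ≡.refl) (▹-false ≡.refl)) (+-identityʳ 0#)))

  ▹-0 : ∀ b {x} → (b ≡ true → x ≈ 0#) → (b ▹ x) ≈ 0#
  ▹-0 true e = trans (▹-true ≡.refl) (e ≡.refl)
  ▹-0 false e = ▹-false ≡.refl

  ∑ : {A : Set} → List A → (A → Carrier) → Carrier
  ∑ [] f = 0#
  ∑ (x ∷ xs) f = f x +R ∑ xs f

  ∑-cong : {A : Set} (xs : List A) {f g : A → Carrier} →
    (∀ x → f x ≈ g x) → ∑ xs f ≈ ∑ xs g
  ∑-cong [] e = refl
  ∑-cong (x ∷ xs) e = +-cong (e x) (∑-cong xs e)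

  ∑-cong∈ : {A : Set} (xs : List A) {f g : A → Carrier} →
    (∀ x → x ∈ xs → f x ≈ g x) → ∑ xs f ≈ ∑ xs g
  ∑-cong∈ [] e = refl
  ∑-cong∈ (x ∷ xs) e =
    +-cong (e x (here ≡.refl)) (∑-cong∈ xs (λ y y∈ → e y (there y∈)))

  ∑-0 : {A : Set} (xs : List A) {f : A → Carrier} → (∀ x → f x ≈ 0#) → ∑ xs f ≈ 0#
  ∑-0 [] e = refl
  ∑-0 (x ∷ xs) e = trans (+-cong (e x) (∑-0 xs e)) (+-identityʳ 0#)

  ∑-++ : {A : Set} (xs ys : List A) (f : A → Carrier) →
    ∑ (xs ++ ys) f ≈ ∑ xs f +R ∑ ys f
  ∑-++ [] ys f = sym (+-identityˡ _)
  ∑-++ (x ∷ xs) ys f = trans (+-congˡ (∑-++ xs ys f)) (sym (+-assoc _ _ _))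

  ∑-map : {A B : Set} (h : A → B) (xs : List A) (f : B → Carrier) →
    ∑ (map h xs) f ≈ ∑ xs (λ x → f (h x))
  ∑-map h [] f = refl
  ∑-map h (x ∷ xs) f = +-congˡ (∑-map h xs f)

  ∑-concatMap : {A B : Set} (h : A → List B) (xs : List A) (f : B → Carrier) →
    ∑ (concatMap h xs) f ≈ ∑ xs (λ x → ∑ (h x) f)
  ∑-concatMap h [] f = refl
  ∑-concatMap h (x ∷ xs) f =
    trans (∑-++ (h x) (concatMap h xs) f) (+-congˡ (∑-concatMap h xs f))

  ∑-filter : {A : Set} (p : A → Bool) (xs : List A) (f : A → Carrier) →
    ∑ (filterᵇ p xs) f ≈ ∑ xs (λ x → p x ▹ f x)
  ∑-filter p [] f = refl
  ∑-filter p (x ∷ xs) f with p x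
  ... | true = +-cong (sym (▹-true ≡.refl)) (∑-filter p xs f)
  ... | false = trans (∑-filter p xs f)
    (sym (trans (+-congʳ (▹-false ≡.refl)) (+-identityˡ _)))

  ∑-+ : {A : Set} (xs : List A) (f g : A → Carrier) →
    ∑ xs (λ x → f x +R g x) ≈ ∑ xs f +R ∑ xs g
  ∑-+ [] f g = sym (+-identityʳ 0#)
  ∑-+ (x ∷ xs) f g = trans (+-congˡ (∑-+ xs f g)) (interchange _ _ _ _)

  ∑-*ˡ : {A : Set} (xs : List A) (a : Carrier) (f : A → Carrier) →
    a *R ∑ xs f ≈ ∑ xs (λ x → a *R f x)
  ∑-*ˡ [] a f = zeroʳ a
  ∑-*ˡ (x ∷ xs) a f = trans (distribˡ a _ _) (+-congˡ (∑-*ˡ xs a f))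

  ∑-▹ : {A : Set} (xs : List A) (b : Bool) (f : A → Carrier) →
    (b ▹ ∑ xs f) ≈ ∑ xs (λ x → b ▹ f x)
  ∑-▹ [] b f = ▹-0 b (λ _ → refl)
  ∑-▹ (x ∷ xs) b f = trans (▹-+ b) (+-congˡ (∑-▹ xs b f))

  ∑-swap : {A B : Set} (xs : List A) (ys : List B) (f : A → B → Carrier) →
    ∑ xs (λ x → ∑ ys (f x)) ≈ ∑ ys (λ y → ∑ xs (λ x → f x y))
  ∑-swap [] ys f = sym (∑-0 ys (λ _ → refl))
  ∑-swap (x ∷ xs) ys f = trans (+-congˡ (∑-swap xs ys f)) (sym (∑-+ ys _ _))

  ∑-sequenceL : {A : Set} (xs : List A) (xss : List (List A)) (f : List A → Carrier) →
    ∑ (sequenceL (xs ∷ xss)) f ≈ ∑ xs (λ x → ∑ (sequenceL xss) (λ s → f (x ∷ s)))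
  ∑-sequenceL xs xss f =
    trans (∑-concatMap _ xs f) (∑-cong xs (λ x → ∑-map (x ∷_) (sequenceL xss) f))

  ∑-sequenceL-ʳ++ : {A : Set} (xss yss : List (List A)) (f : List A → Carrier) →
    ∑ (sequenceL (xss ʳ++ yss)) f ≈
    ∑ (sequenceL xss) (λ s → ∑ (sequenceL yss) (λ t → f (s ʳ++ t)))
  ∑-sequenceL-ʳ++ [] yss f = sym (+-identityʳ _)
  ∑-sequenceL-ʳ++ (xs ∷ xss) yss f = begin
    ∑ (sequenceL (xss ʳ++ (xs ∷ yss))) f
      ≈⟨ ∑-sequenceL-ʳ++ xss (xs ∷ yss) f ⟩
    ∑ (sequenceL xss) (λ s → ∑ (sequenceL (xs ∷ yss)) (λ t → f (s ʳ++ t)))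
      ≈⟨ ∑-cong (sequenceL xss) (λ s → ∑-sequenceL xs yss _) ⟩
    ∑ (sequenceL xss) (λ s → ∑ xs (λ x → ∑ (sequenceL yss) (λ t → f (s ʳ++ (x ∷ t)))))
      ≈⟨ ∑-swap (sequenceL xss) xs _ ⟩
    ∑ xs (λ x → ∑ (sequenceL xss) (λ s → ∑ (sequenceL yss) (λ t → f (s ʳ++ (x ∷ t)))))
      ≈⟨ ∑-sequenceL xs xss _ ⟨
    ∑ (sequenceL (xs ∷ xss)) (λ s → ∑ (sequenceL yss) (λ t → f (s ʳ++ t))) ∎

  -- Columns are listed from right to left, so the one followed by W is column suc (length W).
  columnProd : {A : Set} → (ℕ → ℕ → A → Carrier) → ℕ → ℕ → List A → Carrier
  columnProd g r c [] = 1#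
  columnProd g r c (a ∷ col) = g r c a *R columnProd g (suc r) c col

  readingProd : {A : Set} → (ℕ → ℕ → A → Carrier) → List (List A) → Carrier
  readingProd g [] = 1#
  readingProd g (col ∷ W) = columnProd g 1 (suc (length W)) col *R readingProd g W

≡true⇒T : ∀ {b} → b ≡ true → T b
≡true⇒T = Equivalence.from T-≡

T⇒≡true : ∀ {b} → T b → b ≡ true
T⇒≡true = Equivalence.to T-≡

Bool-ext : ∀ {b c} → (T b → T c) → (T c → T b) → b ≡ c
Bool-ext {true} {true} f g = ≡.refl
Bool-ext {true} {false} f g = ⊥-elim (f _)
Bool-ext {false} {true} f g = ⊥-elim (g _)
Bool-ext {false} {false} f g = ≡.refl

∧-true : ∀ {b c} → b ∧ c ≡ true → b ≡ true × c ≡ true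
∧-true {true} {true} _ = ≡.refl , ≡.refl

≤⇒≤ᵇ≡true : ∀ {m n} → m ≤ n → (m ≤ᵇ n) ≡ true
≤⇒≤ᵇ≡true m≤n = T⇒≡true (ℕ.≤⇒≤ᵇ m≤n)

≤ᵇ≡true⇒≤ : ∀ m {n} → (m ≤ᵇ n) ≡ true → m ≤ n
≤ᵇ≡true⇒≤ m e = ℕ.≤ᵇ⇒≤ m _ (≡true⇒T e)

>⇒≤ᵇ≡false : ∀ {m n} → n < m → (m ≤ᵇ n) ≡ false
>⇒≤ᵇ≡false {m} {n} n<m with m ≤ᵇ n in eq
... | true = ⊥-elim (ℕ.<⇒≱ n<m (≤ᵇ≡true⇒≤ m eq))
... | false = ≡.refl

-- A column bounds the next one on its left; an absent entry bounds nothing.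
leHead : ℕ → List ℕ → Bool
leHead a [] = true
leHead a (b ∷ _) = a ≤ᵇ b

-- Both letters occur exactly once and side by side, so a sum over the list is one two-term block,
-- where symmetry is at stake, plus terms that can be treated separately.
data ConsecutiveIn (k : ℕ) : List ℕ → Set where
  here : ∀ {xs} → All (λ a → a ≢ k × a ≢ suc k) xs → ConsecutiveIn k (k ∷ suc k ∷ xs)
  there : ∀ {a xs} → a ≢ k → a ≢ suc k → ConsecutiveIn k xs → ConsecutiveIn k (a ∷ xs)

-- Tableau sums built column by column

module ColumnSums (Q : CommutativeRing 0ℓ 0ℓ) (xs : List ℕ)
    (x Y : ℕ → CommutativeRing.Carrier Q) where
  open CommutativeRing Q renaming (_+_ to _+q_; _*_ to _*q_; -_ to -q_)
  open RingSums Q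

  weight : ℕ → ℕ → ℕ → Carrier
  weight r c a = x a +q Y ((a + c) ∸ r)

  -- Entries are ≥ lo and bounded entrywise by b; the column occupies column c from row r on.
  columnSum : ℕ → ℕ → ℕ → ℕ → List ℕ → (List ℕ → Carrier) → Carrier
  columnSum c zero r lo b g = g []
  columnSum c (suc h) r lo b g = ∑ xs (λ a → ((lo ≤ᵇ a) ∧ leHead a b) ▹
    weight r c a *q columnSum c h (suc r) (suc a) (drop 1 b) (λ v → g (a ∷ v)))

  -- hs lists the column heights from right to left.
  tableauSum : List ℕ → List ℕ → Carrier
  tableauSum [] b = 1#
  tableauSum (h ∷ hs) b = columnSum (suc (length hs)) h 1 0 b (tableauSum hs)

-- Read from right to left, the column heights of a Young diagram increase weakly; the index is the
-- height of the bounding column, each of whose boxes therefore has a left neighbour.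
data Heights : ℕ → List ℕ → Set where
  [] : ∀ {b} → Heights b []
  _∷_ : ∀ {b h hs} → b ≤ h → Heights h hs → Heights b (h ∷ hs)

-- Symmetry of sums over tableaux

-- Columns which are not distinguished by exchanging k and suc k: those
-- containing suc k whenever they contain k.
data Balanced (k : ℕ) : List ℕ → Set where
  high : ∀ {v} → All (suc k <_) v → Balanced k v
  upper : ∀ {v} → All (suc k <_) v → Balanced k (suc k ∷ v)
  both : ∀ {v} → All (suc k <_) v → Balanced k (k ∷ suc k ∷ v)
  low : ∀ {a v} → a < k → Balanced k v → Balanced k (a ∷ v)

-- The first column has k but not `suc k`, which is the kind that `Balanced` leaves out; raising its
-- k in row `r₀` makes it balanced.
data Raised (k r₀ : ℕ) : ℕ → List ℕ → List ℕ → Set where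
  here : ∀ {v} → All (suc k <_) v → Raised k r₀ r₀ (k ∷ v) (suc k ∷ v)
  there : ∀ {r a u v} → a < k → Raised k r₀ (suc r) u v → Raised k r₀ r (a ∷ u) (a ∷ v)

module Symmetry (Q : CommutativeRing 0ℓ 0ℓ) (xs : List ℕ)
    (x Y : ℕ → CommutativeRing.Carrier Q)
    (k : ℕ) (consecutive : ConsecutiveIn k xs) (P : CommutativeRing.Carrier Q → Set) where
  open CommutativeRing Q renaming (_+_ to _+q_; _*_ to _*q_; -_ to -q_)
  open RingSums Q
  open ColumnSums Q xs x Y
  open Relation.Binary.Reasoning.Setoid setoid
  module +P = Algebra.Properties.CommutativeSemigroup +-commutativeSemigroup
  module *P = Algebra.Properties.CommutativeSemigroup *-commutativeSemigroup

  l : ℕ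
  l = suc k

  -- These are the closure properties of the subring generated by the Y, the other variables and the
  -- two elementary symmetric polynomials in `x k` and `x l`. An abstract predicate replaces an
  -- automorphism exchanging the two variables.
  record SymmetricPredicate : Set where
    field
      resp : ∀ {p q} → p ≈ q → P p → P q
      P-0 : P 0#
      P-1 : P 1#
      P-+ : ∀ {p q} → P p → P q → P (p +q q)
      P-* : ∀ {p q} → P p → P q → P (p *q q)
      P-neg : ∀ {p} → P p → P (-q p)
      P-x : ∀ {a} → a ≢ k → a ≢ l → P (x a)
      P-Y : ∀ j → P (Y j)
      P-x+x : P (x k +q x l)
      P-x*x : P (x k *q x l)

  module _ (symmetric : SymmetricPredicate) where
    open SymmetricPredicate symmetric

    P-▹ : ∀ b {q} → (b ≡ true → P q) → P (b ▹ q)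
    P-▹ true p = resp (sym (▹-true ≡.refl)) (p ≡.refl)
    P-▹ false p = resp (sym (▹-false ≡.refl)) P-0

    P-∑-all : ∀ {ys} {f : ℕ → Carrier} → All (λ a → a ≢ k × a ≢ l) ys →
      (∀ a → a ≢ k → a ≢ l → P (f a)) → P (∑ ys f)
    P-∑-all [] p = P-0
    P-∑-all (( a≢k , a≢l) ∷ as) p = P-+ (p _ a≢k a≢l) (P-∑-all as p)

    P-∑-pair : ∀ {ys} {f : ℕ → Carrier} → ConsecutiveIn k ys →
      (∀ a → a ≢ k → a ≢ l → P (f a)) → P (f k +q f l) → P (∑ ys f)
    P-∑-pair (here as) p pair = resp (+-assoc _ _ _) (P-+ pair (P-∑-all as p))
    P-∑-pair (there a≢k a≢l c) p pair = P-+ (p _ a≢k a≢l) (P-∑-pair c p pair)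

    ∑-cong-all : ∀ {ys} {f g : ℕ → Carrier} → All (λ a → a ≢ k × a ≢ l) ys →
      (∀ a → a ≢ l → f a ≈ g a) → ∑ ys f ≈ ∑ ys g
    ∑-cong-all [] e = refl
    ∑-cong-all ((_ , a≢l) ∷ as) e = +-cong (e _ a≢l) (∑-cong-all as e)

    -- Made for two changes of the summation range: relaxing `a ≤ k` to `a ≤ l`, or `l < a` to
    -- `l ≤ a`, adds just the term at l.
    ∑-extra : ∀ {ys} {f g : ℕ → Carrier} → ConsecutiveIn k ys →
      (∀ a → a ≢ l → f a ≈ g a) → g l ≈ 0# → ∑ ys f ≈ f l +q ∑ ys g
    ∑-extra {_} {f} {g} (here {ys} as) e z = begin
      f k +q (f l +q ∑ ys f) ≈⟨ +P.x∙yz≈y∙xz _ _ _ ⟩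
      f l +q (f k +q ∑ ys f)
        ≈⟨ +-congˡ (+-cong (e k (ℕ.<⇒≢ (ℕ.n<1+n k))) (∑-cong-all as e)) ⟩
      f l +q (g k +q ∑ ys g) ≈⟨ +-congˡ (+-congˡ (+-identityˡ _)) ⟨
      f l +q (g k +q (0# +q ∑ ys g)) ≈⟨ +-congˡ (+-congˡ (+-congʳ z)) ⟨
      f l +q (g k +q (g l +q ∑ ys g)) ∎
    ∑-extra {_} {f} {g} (there {a} {ys} a≢k a≢l c) e z = begin
      f a +q ∑ ys f ≈⟨ +-cong (e a a≢l) (∑-extra c e z) ⟩
      g a +q (f l +q ∑ ys g) ≈⟨ +P.x∙yz≈y∙xz _ _ _ ⟩
      f l +q (g a +q ∑ ys g) ∎

    columnSum-cong : ∀ c h r lo b {f g : List ℕ → Carrier} → (∀ v → f v ≈ g v) →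
      columnSum c h r lo b f ≈ columnSum c h r lo b g
    columnSum-cong c zero r lo b e = e []
    columnSum-cong c (suc h) r lo b e = ∑-cong xs (λ a → ▹-cong _ λ _ →
      *-congˡ (columnSum-cong c h (suc r) (suc a) (drop 1 b) (λ v → e (a ∷ v))))

    columnSum-+ : ∀ c h r lo b (f g : List ℕ → Carrier) →
      columnSum c h r lo b (λ v → f v +q g v) ≈
      columnSum c h r lo b f +q columnSum c h r lo b g
    columnSum-+ c zero r lo b f g = refl
    columnSum-+ c (suc h) r lo b f g = trans
      (∑-cong xs (λ a → trans
        (▹-cong _ λ _ → (trans (*-congˡ (columnSum-+ c h (suc r) (suc a) (drop 1 b) _ _)) (distribˡ _ _ _)))
        (▹-+ _)))
      (∑-+ xs _ _)

    columnSum-* : ∀ c h r lo b p (f : List ℕ → Carrier) →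
      columnSum c h r lo b (λ v → p *q f v) ≈ p *q columnSum c h r lo b f
    columnSum-* c zero r lo b p f = refl
    columnSum-* c (suc h) r lo b p f = trans
      (∑-cong xs (λ a → trans
        (▹-cong _ λ _ → (trans (*-congˡ (columnSum-* c h (suc r) (suc a) (drop 1 b) p _)) (*P.x∙yz≈y∙xz _ _ _)))
        (sym (▹-*ʳ _ _))))
      (sym (∑-*ˡ xs p _))

    P-weight : ∀ r c {a} → a ≢ k → a ≢ l → P (weight r c a)
    P-weight r c a≢k a≢l = P-+ (P-x a≢k a≢l) (P-Y _)

    -- No weight in this part of the column involves `x k` or `x l`, so only the continuation g has
    -- to be examined.
    P-columnSum-high : ∀ c h r lo b {g : List ℕ → Carrier} → l < lo →
      (∀ v → length v ≡ h → All (l <_) v → P (g v)) → P (columnSum c h r lo b g)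
    P-columnSum-high c zero r lo b l<lo p = p [] ≡.refl []
    P-columnSum-high c (suc h) r lo b {g} l<lo p =
      P-∑-pair consecutive (λ a _ _ → term a) (P-+ (term k) (term l))
      where
      term : ∀ a → P (((lo ≤ᵇ a) ∧ leHead a b) ▹
        weight r c a *q columnSum c h (suc r) (suc a) (drop 1 b) (λ v → g (a ∷ v)))
      term a = P-▹ _ λ t →
        let l<a = ℕ.≤-trans l<lo (≤ᵇ≡true⇒≤ lo (proj₁ (∧-true t))) in
        P-* (P-weight r c (ℕ.>⇒≢ (ℕ.<-trans (ℕ.n<1+n k) l<a)) (ℕ.>⇒≢ l<a))
          (P-columnSum-high c h (suc r) (suc a) (drop 1 b) (ℕ.<-trans l<a (ℕ.n<1+n a))
            (λ v e hi → p (a ∷ v) (≡.cong suc e) (l<a ∷ hi)))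

    -- A box in row r₀ of column c filled with k and its left neighbour filled with suc k carry
    -- the same Y.
    root : ℕ → ℕ → Carrier
    root c r₀ = Y ((k + c) ∸ r₀)

    -- Here p and q play the sums bounded by a column with k in row `r₀` and by its raised version.
    -- The raised bound admits additional tableaux only, namely those with l to the left of that
    -- box, and `x l + root c r₀` is the weight of this l.
    record Lowers (c r₀ : ℕ) (p q : Carrier) : Set where
      constructor lowers
      field
        s : Carrier
        P-s : P s
        lower : q ≈ p +q (x l +q root c r₀) *q s

    Lowers-resp : ∀ {c r₀ p q p′ q′} → p ≈ p′ → q ≈ q′ → Lowers c r₀ p q → Lowers c r₀ p′ q′
    Lowers-resp e e′ (lowers s ps d) = lowers s ps (trans (sym e′) (trans d (+-congʳ e)))

    Lowers-refl : ∀ {c r₀ p} → Lowers c r₀ p p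
    Lowers-refl = lowers 0# P-0 (sym (trans (+-congˡ (zeroʳ _)) (+-identityʳ _)))

    Lowers-+ : ∀ {c r₀ p q p′ q′} → Lowers c r₀ p q → Lowers c r₀ p′ q′ →
      Lowers c r₀ (p +q p′) (q +q q′)
    Lowers-+ (lowers s ps e) (lowers s′ ps′ e′) = lowers (s +q s′) (P-+ ps ps′)
      (trans (+-cong e e′) (trans (+P.interchange _ _ _ _) (+-congˡ (sym (distribˡ _ _ _)))))

    Lowers-* : ∀ {c r₀ p q w} → P w → Lowers c r₀ p q → Lowers c r₀ (w *q p) (w *q q)
    Lowers-* {w = w} pw (lowers s ps e) = lowers (w *q s) (P-* pw ps)
      (trans (*-congˡ e) (trans (distribˡ _ _ _) (+-congˡ (*P.x∙yz≈y∙xz _ _ _))))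

    Lowers-▹ : ∀ {c r₀ p q} b → (b ≡ true → Lowers c r₀ p q) → Lowers c r₀ (b ▹ p) (b ▹ q)
    Lowers-▹ true d = Lowers-resp (sym (▹-true ≡.refl)) (sym (▹-true ≡.refl)) (d ≡.refl)
    Lowers-▹ false d = Lowers-resp (sym (▹-false ≡.refl)) (sym (▹-false ≡.refl)) Lowers-refl

    Lowers-∑ : ∀ {c r₀} ys {f g : ℕ → Carrier} → (∀ a → Lowers c r₀ (f a) (g a)) →
      Lowers c r₀ (∑ ys f) (∑ ys g)
    Lowers-∑ [] d = Lowers-refl
    Lowers-∑ (y ∷ ys) d = Lowers-+ (d y) (Lowers-∑ ys d)

    -- The induction hypothesis on a continuation g of the columns of height h from row r on.
    -- Symmetry at balanced columns does not propagate alone: when a box may hold k or l, the choice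
    -- of k can leave an unbalanced column, which is then compared with its raised version.
    record Good (c h r : ℕ) (g : List ℕ → Carrier) : Set where
      field
        balanced : ∀ v → length v ≡ h → Balanced k v → P (g v)
        raised : ∀ {r₀ u v} → length u ≡ h → Raised k r₀ r u v → Lowers c r₀ (g u) (g v)
    open Good

    Good-∷ : ∀ {c h r g a} → a < k → Good c (suc h) r g → Good c h (suc r) (λ v → g (a ∷ v))
    Good-∷ a<k G .balanced v e ok = G .balanced _ (≡.cong suc e) (low a<k ok)
    Good-∷ a<k G .raised e d = G .raised (≡.cong suc e) (there a<k d)

    lo-step : ∀ c h r b {f : List ℕ → Carrier} →
      columnSum c (suc h) r l b f ≈
      (leHead l b ▹ weight r c l *q columnSum c h (suc r) (suc l) (drop 1 b) (λ v → f (l ∷ v)))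
        +q columnSum c (suc h) r (suc l) b f
    lo-step c h r b {f} = trans
      (∑-extra consecutive
        (λ a a≢l → ▹-congˡ (≡.cong (_∧ leHead a b) (Bool-ext
          (λ t → ℕ.≤⇒≤ᵇ (ℕ.≤∧≢⇒< (ℕ.≤ᵇ⇒≤ l a t) (λ e → a≢l (≡.sym e))))
          (λ t → ℕ.≤⇒≤ᵇ (ℕ.<⇒≤ (ℕ.≤ᵇ⇒≤ (suc l) a t))))))
        (▹-false (≡.cong (_∧ leHead l b) (>⇒≤ᵇ≡false (ℕ.n<1+n l)))))
      (+-congʳ (▹-congˡ (≡.cong (_∧ leHead l b) (≤⇒≤ᵇ≡true (ℕ.≤-refl {l})))))

    P-weight*weight : ∀ j → P ((x k +q Y j) *q (x l +q Y j))
    P-weight*weight j = resp (sym eq) (P-+ P-x*x (P-* (P-+ P-x+x (P-Y j)) (P-Y j)))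
      where
      z = Y j
      eq : (x k +q z) *q (x l +q z) ≈ x k *q x l +q ((x k +q x l) +q z) *q z
      eq = begin
        (x k +q z) *q (x l +q z) ≈⟨ distribʳ _ _ _ ⟩
        x k *q (x l +q z) +q z *q (x l +q z) ≈⟨ +-cong (distribˡ _ _ _) (*-comm _ _) ⟩
        (x k *q x l +q x k *q z) +q (x l +q z) *q z ≈⟨ +-assoc _ _ _ ⟩
        x k *q x l +q (x k *q z +q (x l +q z) *q z) ≈⟨ +-congˡ (distribʳ _ _ _) ⟨
        x k *q x l +q (x k +q (x l +q z)) *q z ≈⟨ +-congˡ (*-congʳ (+-assoc _ _ _)) ⟨
        x k *q x l +q ((x k +q x l) +q z) *q z ∎

    -- Substituting `q = p + wl s` gives `wk p + (x l + z) q = (wk + x l + z) q - wk wl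
    -- s`. The first coefficient involves only `x k + x l`, and the factors `wk` and `wl` share
    -- their Y.
    P-lowered : ∀ c r₀ z {p q} → P z → P q → Lowers c r₀ p q →
      P ((x k +q root c r₀) *q p +q (x l +q z) *q q)
    P-lowered c r₀ z {p} {q} Pz Pq (lowers s Ps e) = resp (sym eq)
      (P-+ (P-* (P-+ P-x+x (P-+ (P-Y _) Pz)) Pq) (P-neg (P-* (P-weight*weight _) Ps)))
      where
      wk = x k +q root c r₀
      wl = x l +q root c r₀
      M = (wk *q wl) *q s
      sum : (wk *q p +q (x l +q z) *q q) +q M ≈ ((x k +q x l) +q (root c r₀ +q z)) *q q
      sum = begin
        (wk *q p +q (x l +q z) *q q) +q M ≈⟨ +P.xy∙z≈xz∙y _ _ _ ⟩
        (wk *q p +q M) +q (x l +q z) *q q ≈⟨ +-congʳ (+-congˡ (*-assoc _ _ _)) ⟩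
        (wk *q p +q wk *q (wl *q s)) +q (x l +q z) *q q ≈⟨ +-congʳ (distribˡ _ _ _) ⟨
        wk *q (p +q wl *q s) +q (x l +q z) *q q ≈⟨ +-congʳ (*-congˡ e) ⟨
        wk *q q +q (x l +q z) *q q ≈⟨ distribʳ _ _ _ ⟨
        (wk +q (x l +q z)) *q q ≈⟨ *-congʳ (+P.interchange _ _ _ _) ⟩
        ((x k +q x l) +q (root c r₀ +q z)) *q q ∎
      eq : wk *q p +q (x l +q z) *q q ≈ ((x k +q x l) +q (root c r₀ +q z)) *q q +q -q M
      eq = begin
        wk *q p +q (x l +q z) *q q ≈⟨ +-identityʳ _ ⟨
        (wk *q p +q (x l +q z) *q q) +q 0# ≈⟨ +-congˡ (-‿inverseʳ M) ⟨
        (wk *q p +q (x l +q z) *q q) +q (M +q -q M) ≈⟨ +-assoc _ _ _ ⟨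
        ((wk *q p +q (x l +q z) *q q) +q M) +q -q M ≈⟨ +-congʳ sum ⟩
        ((x k +q x l) +q (root c r₀ +q z)) *q q +q -q M ∎

    -- After k the next box may hold l. These columns contain both letters and are balanced; in all
    -- others the entries below exceed l, and the choices k and l are matched over the same
    -- remaining entries by `P-lowered`.
    P-pair-high : ∀ c h r b {g : List ℕ → Carrier} → All (l <_) b → Good c (suc h) r g →
      P (weight r c k *q columnSum c h (suc r) l b (λ v → g (k ∷ v)) +q
         weight r c l *q columnSum c h (suc r) (suc l) b (λ v → g (l ∷ v)))
    P-pair-high c h r b {g} hi G = go h ≡.refl
      where
      P-high : P (columnSum c h (suc r) (suc l) b
        (λ v → weight r c k *q g (k ∷ v) +q weight r c l *q g (l ∷ v)))
      P-high = P-columnSum-high c h (suc r) (suc l) b (ℕ.n<1+n l) λ v e hi′ →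
        P-lowered c r _ (P-Y _) (G .balanced (l ∷ v) (≡.cong suc e) (upper hi′))
          (G .raised (≡.cong suc e) (here hi′))
      gather : columnSum c h (suc r) (suc l) b
          (λ v → weight r c k *q g (k ∷ v) +q weight r c l *q g (l ∷ v)) ≈
        weight r c k *q columnSum c h (suc r) (suc l) b (λ v → g (k ∷ v)) +q
        weight r c l *q columnSum c h (suc r) (suc l) b (λ v → g (l ∷ v))
      gather = trans (columnSum-+ c h (suc r) (suc l) b _ _)
        (+-cong (columnSum-* c h (suc r) (suc l) b _ _) (columnSum-* c h (suc r) (suc l) b _ _))
      go : ∀ h′ → h ≡ h′ →
        P (weight r c k *q columnSum c h (suc r) l b (λ v → g (k ∷ v)) +q
           weight r c l *q columnSum c h (suc r) (suc l) b (λ v → g (l ∷ v)))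
      go zero ≡.refl = resp gather P-high
      go (suc h′) ≡.refl = resp (sym split) (P-+ P-both (resp gather P-high))
        where
        Sk = columnSum c h (suc r) (suc l) b (λ v → g (k ∷ v))
        Sl = columnSum c h (suc r) (suc l) b (λ v → g (l ∷ v))
        Skl = columnSum c h′ (suc (suc r)) (suc l) (drop 1 b) (λ v → g (k ∷ l ∷ v))
        B = leHead l b ▹ weight (suc r) c l *q Skl
        P-both : P (weight r c k *q B)
        -- For l directly below k the two Y agree by computation, as `(suc k + c) ∸ suc r` reduces
        -- to `(k + c) ∸ r`.
        P-both = resp (sym (▹-*ʳ _ _)) (P-▹ _ λ _ → resp (*-assoc _ _ _)
          (P-* (P-weight*weight _)
            (P-columnSum-high c h′ (suc (suc r)) (suc l) (drop 1 b) (ℕ.n<1+n l)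
              λ v e hi′ → G .balanced (k ∷ l ∷ v) (≡.cong (suc ∘ suc) e) (both hi′))))
        split : weight r c k *q columnSum c h (suc r) l b (λ v → g (k ∷ v)) +q weight r c l *q Sl
          ≈ weight r c k *q B +q (weight r c k *q Sk +q weight r c l *q Sl)
        split = begin
          weight r c k *q columnSum c h (suc r) l b (λ v → g (k ∷ v)) +q weight r c l *q Sl
            ≈⟨ +-congʳ (*-congˡ (lo-step c h′ (suc r) b {λ v → g (k ∷ v)})) ⟩
          weight r c k *q (B +q Sk) +q weight r c l *q Sl ≈⟨ +-congʳ (distribˡ _ _ _) ⟩
          (weight r c k *q B +q weight r c k *q Sk) +q weight r c l *q Sl ≈⟨ +-assoc _ _ _ ⟩
          weight r c k *q B +q (weight r c k *q Sk +q weight r c l *q Sl) ∎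

    columnSum-vanish : ∀ c h r lo b {g : List ℕ → Carrier} a → a < lo →
      columnSum c (suc h) r lo (a ∷ b) g ≈ 0#
    columnSum-vanish c h r lo b a a<lo = ∑-0 xs λ a′ → ▹-false (Bool-ext
      (λ t → ⊥-elim (let (p , q) = ∧-true (T⇒≡true t) in
        ℕ.<⇒≱ a<lo (ℕ.≤-trans (≤ᵇ≡true⇒≤ lo p) (≤ᵇ≡true⇒≤ a′ q)))) λ ())

    -- Only the terms for k and l have to be paired; any other letter has an invariant weight and
    -- leaves a problem of the same kind below it, or one where all letters exceed l. The condition
    -- on `length b` provides a box below for the case of a bound with both k and l.
    P-columnSum : ∀ c h r lo {b} {g : List ℕ → Carrier} → lo ≤ k → Balanced k b →
      length b ≤ h → Good c h r g → P (columnSum c h r lo b g)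
    P-columnSum c zero r lo lo≤k ok len G = G .balanced [] ≡.refl (high [])
    P-columnSum c (suc h) r lo {b} {g} lo≤k ok len G =
      P-∑-pair consecutive other (pair ok len)
      where
      term : ℕ → Carrier
      term a = ((lo ≤ᵇ a) ∧ leHead a b) ▹
        weight r c a *q columnSum c h (suc r) (suc a) (drop 1 b) (λ v → g (a ∷ v))
      tail-ok : Balanced k b → Balanced k (drop 1 b)
      tail-ok (high []) = high []
      tail-ok (high (_ ∷ hi)) = high hi
      tail-ok (upper hi) = high hi
      tail-ok (both hi) = upper hi
      tail-ok (low _ ok′) = ok′
      tail-len : ∀ b → length b ≤ suc h → length (drop 1 b) ≤ h
      tail-len [] _ = z≤n
      tail-len (_ ∷ b) (s≤s p) = p
      other : ∀ a → a ≢ k → a ≢ l → P (term a)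
      other a a≢k a≢l = P-▹ _ λ _ → P-* (P-weight r c a≢k a≢l) rest
        where
        rest : P (columnSum c h (suc r) (suc a) (drop 1 b) (λ v → g (a ∷ v)))
        rest with ℕ.<-cmp a k
        ... | tri< a<k _ _ = P-columnSum c h (suc r) (suc a) a<k (tail-ok ok)
              (tail-len b len) (Good-∷ a<k G)
        ... | tri≈ _ a≡k _ = ⊥-elim (a≢k a≡k)
        ... | tri> _ _ k<a = P-columnSum-high c h (suc r) (suc a) (drop 1 b)
              (ℕ.<-trans l<a (ℕ.n<1+n a))
              (λ v e hi → G .balanced (a ∷ v) (≡.cong suc e) (high (l<a ∷ hi)))
          where l<a = ℕ.≤∧≢⇒< k<a (λ e → a≢l (≡.sym e))
      allowed : (lo ≤ᵇ k) ≡ true × (lo ≤ᵇ l) ≡ true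
      allowed = ≤⇒≤ᵇ≡true lo≤k , ≤⇒≤ᵇ≡true (ℕ.≤-trans lo≤k (ℕ.n≤1+n k))
      free : All (l <_) (drop 1 b) → leHead k b ≡ true → leHead l b ≡ true → P (term k +q term l)
      free hi ek el = resp
        (+-cong (sym (▹-true (≡.cong₂ _∧_ (proj₁ allowed) ek)))
                (sym (▹-true (≡.cong₂ _∧_ (proj₂ allowed) el))))
        (P-pair-high c h r (drop 1 b) hi G)
      pair : Balanced k b → length b ≤ suc h → P (term k +q term l)
      pair (high []) _ = free [] ≡.refl ≡.refl
      pair (high (l<a ∷ hi)) _ = free hi (≤⇒≤ᵇ≡true (ℕ.<⇒≤ (ℕ.<-trans (ℕ.n<1+n k) l<a)))
        (≤⇒≤ᵇ≡true (ℕ.<⇒≤ l<a))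
      pair (upper hi) _ = free hi (≤⇒≤ᵇ≡true (ℕ.n≤1+n k)) (≤⇒≤ᵇ≡true (ℕ.≤-refl {l}))
      pair (low {a} a<k _) _ = resp (sym (trans (+-cong (vanish k a<k) (vanish l (ℕ.m<n⇒m<1+n a<k)))
          (+-identityʳ 0#))) P-0
        where
        vanish : ∀ a′ → a < a′ → term a′ ≈ 0#
        vanish a′ a<a′ = ▹-false (≡.trans (≡.cong ((lo ≤ᵇ a′) ∧_) (>⇒≤ᵇ≡false a<a′)) (∧-zeroʳ _))
      -- Between k and l, the bound k admits only k here; the bound l then forces l in the next box,
      -- because the column is strict.
      pair (both {v} hi) (s≤s (s≤s {n = h′} _)) = resp (sym eq) (P-*
          (P-weight*weight _)
          (P-columnSum-high c h′ (suc (suc r)) (suc l) v (ℕ.n<1+n l)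
            λ v e hi′ → G .balanced (k ∷ l ∷ v) (≡.cong (suc ∘ suc) e) (both hi′)))
        where
        Skl = columnSum c h′ (suc (suc r)) (suc l) v (λ v → g (k ∷ l ∷ v))
        eq : term k +q term l ≈ (weight r c k *q weight (suc r) c l) *q Skl
        eq = begin
          term k +q term l
            ≈⟨ +-cong
                 (▹-true (≡.cong₂ _∧_ (proj₁ allowed) (≤⇒≤ᵇ≡true (ℕ.≤-refl {k}))))
                 (▹-false (≡.trans (≡.cong ((lo ≤ᵇ l) ∧_) (>⇒≤ᵇ≡false (ℕ.n<1+n k))) (∧-zeroʳ _))) ⟩
          weight r c k *q columnSum c (suc h′) (suc r) l (l ∷ v) (λ v → g (k ∷ v)) +q 0#
            ≈⟨ +-identityʳ _ ⟩
          weight r c k *q columnSum c (suc h′) (suc r) l (l ∷ v) (λ v → g (k ∷ v))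
            ≈⟨ *-congˡ (lo-step c h′ (suc r) (l ∷ v) {λ v → g (k ∷ v)}) ⟩
          weight r c k *q (((l ≤ᵇ l) ▹ weight (suc r) c l *q Skl) +q
            columnSum c (suc h′) (suc r) (suc l) (l ∷ v) (λ v → g (k ∷ v)))
            ≈⟨ *-congˡ (+-cong (▹-true (≤⇒≤ᵇ≡true (ℕ.≤-refl {l})))
                 (columnSum-vanish c h′ (suc r) (suc l) v {λ v → g (k ∷ v)} l (ℕ.n<1+n l))) ⟩
          weight r c k *q (weight (suc r) c l *q Skl +q 0#) ≈⟨ *-congˡ (+-identityʳ _) ⟩
          weight r c k *q (weight (suc r) c l *q Skl) ≈⟨ *-assoc _ _ _ ⟨
          (weight r c k *q weight (suc r) c l) *q Skl ∎

    -- Above the raised row both bounds agree and keep all letters below k. In that row the bound l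
    -- instead of k admits the one new letter l, and its weight in column c is
    -- `x l + root (suc c) r₀` because `suc k + c` equals `k + suc c`. The cofactor is the sum over
    -- what follows this l, which is symmetric since a column with l is balanced.
    columnSum-raised : ∀ c h {r r₀} lo {u v} {g : List ℕ → Carrier} → lo ≤ k →
      Raised k r₀ r u v → length u ≤ h → Good c h r g →
      Lowers (suc c) r₀ (columnSum c h r lo u g) (columnSum c h r lo v g)
    columnSum-raised c (suc h) {r} lo {g = g} lo≤k (here {v} hi) (s≤s len) G =
      lowers (columnSum c h (suc r) (suc l) v (λ w → g (l ∷ w)))
      (P-columnSum-high c h (suc r) (suc l) v (ℕ.n<1+n l)
        (λ w e hi′ → G .balanced (l ∷ w) (≡.cong suc e) (upper hi′)))
      (trans
        (∑-extra consecutive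
          (λ a a≢l → ▹-congˡ (≡.cong ((lo ≤ᵇ a) ∧_) (Bool-ext
            (λ t → ℕ.≤⇒≤ᵇ (s≤s⁻¹ (ℕ.≤∧≢⇒< (ℕ.≤ᵇ⇒≤ a l t) a≢l)))
            (λ t → ℕ.≤⇒≤ᵇ (ℕ.≤-trans (ℕ.≤ᵇ⇒≤ a k t) (ℕ.n≤1+n k))))))
          (▹-false (≡.trans (≡.cong ((lo ≤ᵇ l) ∧_) (>⇒≤ᵇ≡false (ℕ.n<1+n k))) (∧-zeroʳ _))))
        (trans (+-comm _ _) (+-congˡ (trans
          (▹-true (≡.cong₂ _∧_ (≤⇒≤ᵇ≡true (ℕ.≤-trans lo≤k (ℕ.n≤1+n k))) (≤⇒≤ᵇ≡true (ℕ.≤-refl {l}))))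
          (*-congʳ (+-congˡ (reflexive (≡.cong (λ m → Y (m ∸ r)) (≡.sym (ℕ.+-suc k c))))))))))
    columnSum-raised c (suc h) {r} lo {g = g} lo≤k (there {a = a} {u} {v} a<k d) (s≤s len) G =
      Lowers-∑ xs λ a′ → Lowers-▹ _ λ t →
        let a′<k = ℕ.≤-<-trans (≤ᵇ≡true⇒≤ a′ (proj₂ (∧-true t))) a<k in
        Lowers-* (P-weight r c (ℕ.<⇒≢ a′<k) (ℕ.<⇒≢ (ℕ.m<n⇒m<1+n a′<k)))
          (columnSum-raised c h (suc a′) a′<k d len (Good-∷ a′<k G))

    Good-tableauSum : ∀ h hs → Heights h hs → Good (suc (length hs)) h 1 (tableauSum hs)
    Good-tableauSum h [] _ .balanced v e ok = P-1
    Good-tableauSum h [] _ .raised e d = Lowers-refl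
    Good-tableauSum h (h′ ∷ hs) (h≤h′ ∷ H) .balanced v e ok =
      P-columnSum _ h′ 1 0 z≤n ok (≡.subst (_≤ h′) (≡.sym e) h≤h′) (Good-tableauSum h′ hs H)
    Good-tableauSum h (h′ ∷ hs) (h≤h′ ∷ H) .raised e d =
      columnSum-raised _ h′ 0 z≤n d (≡.subst (_≤ h′) (≡.sym e) h≤h′) (Good-tableauSum h′ hs H)

    P-tableauSum : ∀ {b} hs → Heights (length b) hs → Balanced k b → P (tableauSum hs b)
    P-tableauSum hs H ok = Good-tableauSum _ hs H .balanced _ ≡.refl ok

-- Polynomials acting on linear forms

-- inc a adds the unit vector e_a (1-based; the identity if a is out of range).
inc : ∀ {n} → ℕ → Vec ℕ n → Vec ℕ n
inc zero α = α
inc (suc a) [] = []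
inc (suc zero) (x ∷ α) = suc x ∷ α
inc (suc (suc a)) (x ∷ α) = x ∷ inc (suc a) α

inc-comm : ∀ {n} a b (α : Vec ℕ n) → inc a (inc b α) ≡ inc b (inc a α)
inc-comm zero b α = ≡.refl
inc-comm (suc a) zero α = ≡.refl
inc-comm (suc a) (suc b) [] = ≡.refl
inc-comm (suc zero) (suc zero) (x ∷ α) = ≡.refl
inc-comm (suc zero) (suc (suc b)) (x ∷ α) = ≡.refl
inc-comm (suc (suc a)) (suc zero) (x ∷ α) = ≡.refl
inc-comm (suc (suc a)) (suc (suc b)) (x ∷ α) = ≡.cong (x ∷_) (inc-comm (suc a) (suc b) α)

-- Swap k α β: β is α with the entries k and suc k (1-based) exchanged; in particular
-- Swap k α α says that these entries agree.
data Swap : ∀ {n} → ℕ → Vec ℕ n → Vec ℕ n → Set where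
  here : ∀ {n a b} {α : Vec ℕ n} → Swap 1 (a ∷ b ∷ α) (b ∷ a ∷ α)
  there : ∀ {n k c} {α β : Vec ℕ n} → Swap k α β → Swap (suc k) (c ∷ α) (c ∷ β)

Swap-inc : ∀ {n k a} {α β : Vec ℕ n} → a ≢ k → a ≢ suc k → Swap k α β → Swap k (inc a α) (inc a β)
Swap-inc {a = zero} _ _ s = s
Swap-inc {a = suc zero} a≢k _ here = ⊥-elim (a≢k ≡.refl)
Swap-inc {a = suc (suc zero)} _ a≢ here = ⊥-elim (a≢ ≡.refl)
Swap-inc {a = suc (suc (suc a))} _ _ here = here
Swap-inc {a = suc zero} _ _ (there s) = there s
Swap-inc {a = suc (suc a)} a≢k a≢ (there s) =
  there (Swap-inc (a≢k ∘ ≡.cong suc) (a≢ ∘ ≡.cong suc) s)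

Swap-incˡ : ∀ {n k} {α β : Vec ℕ n} → Swap k α β → Swap k (inc k α) (inc (suc k) β)
Swap-incˡ here = here
Swap-incˡ (there {k = suc k} s) = there (Swap-incˡ s)

Swap-incʳ : ∀ {n k} {α β : Vec ℕ n} → Swap k α β → Swap k (inc (suc k) α) (inc k β)
Swap-incʳ here = here
Swap-incʳ (there {k = suc k} s) = there (Swap-incʳ s)

above : ∀ {n} → ℕ → Vec ℕ n → Bool
above x [] = true
above x (y ∷ _) = y <ᵇ x

decreasing : ∀ {n} → Vec ℕ n → Bool
decreasing [] = true
decreasing (x ∷ α) = above x α ∧ decreasing α

decreasing⇒All< : ∀ {n} x (α : Vec ℕ n) → decreasing (x ∷ α) ≡ true → All (_< x) (toList α)
decreasing⇒All< x [] d = []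
decreasing⇒All< x (y ∷ α) d =
  y<x ∷ All.map (λ z<y → ℕ.<-trans z<y y<x) (decreasing⇒All< y α (proj₂ (∧-true {y <ᵇ x} d)))
  where y<x = ≤ᵇ≡true⇒≤ (suc y) (proj₁ (∧-true {y <ᵇ x} d))

module Operators (R : CommutativeRing 0ℓ 0ℓ) (n : ℕ) where
  open CommutativeRing R renaming (_+_ to _+R_; _*_ to _*R_; -_ to -R_)
  open Algebra.Properties.CommutativeSemigroup *-commutativeSemigroup using (x∙yz≈y∙xz)
  open Algebra.Properties.CommutativeSemigroup +-commutativeSemigroup using (interchange)
  open Algebra.Properties.Ring ring using (-‿distribʳ-*; -0#≈0#)
  open Algebra.Properties.AbelianGroup +-abelianGroup using (⁻¹-∙-comm)

  Functional : Set
  Functional = Vec ℕ n → Carrier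

  -- Operators are kept as expressions because arbitrary maps on functionals do not commute. For
  -- expressions, commutation reduces by induction to scalars and shifts.
  Operator : Set
  Operator = Poly (Carrier ⊎ ℕ)

  scalar : Carrier → Operator
  scalar s = var (inj₁ s)

  shift : ℕ → Operator
  shift a = var (inj₂ a)

  -- A functional ψ records the values of a linear form on the monomials x^α, and polynomials act by
  -- (p ψ)(q) = ψ(p q).
  act : Operator → Functional → Functional
  act (var (inj₁ s)) ψ α = s *R ψ α
  act (var (inj₂ a)) ψ α = ψ (inc a α)
  act 𝟘 ψ α = 0#
  act 𝟙 ψ α = ψ α
  act (p ⊕ q) ψ α = act p ψ α +R act q ψ α
  act (p ⊗ q) ψ α = act p (act q ψ) α
  act (⊖ p) ψ α = -R act p ψ α

  act-cong : ∀ p {ψ χ} → (∀ α → ψ α ≈ χ α) → ∀ α → act p ψ α ≈ act p χ α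
  act-cong (var (inj₁ s)) e α = *-congˡ (e α)
  act-cong (var (inj₂ a)) e α = e (inc a α)
  act-cong 𝟘 e α = refl
  act-cong 𝟙 e α = e α
  act-cong (p ⊕ q) e α = +-cong (act-cong p e α) (act-cong q e α)
  act-cong (p ⊗ q) e α = act-cong p (act-cong q e) α
  act-cong (⊖ p) e α = -‿cong (act-cong p e α)

  act-+ : ∀ p ψ χ α → act p (λ β → ψ β +R χ β) α ≈ act p ψ α +R act p χ α
  act-+ (var (inj₁ s)) ψ χ α = distribˡ s _ _
  act-+ (var (inj₂ a)) ψ χ α = refl
  act-+ 𝟘 ψ χ α = sym (+-identityʳ 0#)
  act-+ 𝟙 ψ χ α = refl
  act-+ (p ⊕ q) ψ χ α = trans (+-cong (act-+ p ψ χ α) (act-+ q ψ χ α)) (interchange _ _ _ _)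
  act-+ (p ⊗ q) ψ χ α = trans (act-cong p (act-+ q ψ χ) α) (act-+ p _ _ α)
  act-+ (⊖ p) ψ χ α = trans (-‿cong (act-+ p ψ χ α)) (sym (⁻¹-∙-comm _ _))

  act-* : ∀ p s ψ α → act p (λ β → s *R ψ β) α ≈ s *R act p ψ α
  act-* (var (inj₁ t)) s ψ α = x∙yz≈y∙xz _ _ _
  act-* (var (inj₂ a)) s ψ α = refl
  act-* 𝟘 s ψ α = sym (zeroʳ s)
  act-* 𝟙 s ψ α = refl
  act-* (p ⊕ q) s ψ α = trans (+-cong (act-* p s ψ α) (act-* q s ψ α)) (sym (distribˡ _ _ _))
  act-* (p ⊗ q) s ψ α = trans (act-cong p (act-* q s ψ) α) (act-* p s _ α)
  act-* (⊖ p) s ψ α = trans (-‿cong (act-* p s ψ α)) (-‿distribʳ-* _ _)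

  act-0 : ∀ p α → act p (λ _ → 0#) α ≈ 0#
  act-0 p α = trans (act-cong p (λ _ → sym (zeroˡ 0#)) α)
    (trans (act-* p 0# _ α) (zeroˡ _))

  act-neg : ∀ p ψ α → act p (λ β → -R ψ β) α ≈ -R act p ψ α
  act-neg (var (inj₁ s)) ψ α = sym (-‿distribʳ-* _ _)
  act-neg (var (inj₂ a)) ψ α = refl
  act-neg 𝟘 ψ α = sym -0#≈0#
  act-neg 𝟙 ψ α = refl
  act-neg (p ⊕ q) ψ α = trans (+-cong (act-neg p ψ α) (act-neg q ψ α)) (⁻¹-∙-comm _ _)
  act-neg (p ⊗ q) ψ α = trans (act-cong p (act-neg q ψ) α) (act-neg p _ α)
  act-neg (⊖ p) ψ α = -‿cong (act-neg p ψ α)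

  act-inc : ∀ p a ψ α → act p (λ β → ψ (inc a β)) α ≈ act p ψ (inc a α)
  act-inc (var (inj₁ s)) a ψ α = refl
  act-inc (var (inj₂ b)) a ψ α = reflexive (≡.cong ψ (inc-comm a b α))
  act-inc 𝟘 a ψ α = refl
  act-inc 𝟙 a ψ α = refl
  act-inc (p ⊕ q) a ψ α = +-cong (act-inc p a ψ α) (act-inc q a ψ α)
  act-inc (p ⊗ q) a ψ α = trans (act-cong p (act-inc q a ψ) α) (act-inc p a _ α)
  act-inc (⊖ p) a ψ α = -‿cong (act-inc p a ψ α)

  act-comm : ∀ p q ψ α → act p (act q ψ) α ≈ act q (act p ψ) α
  act-comm (var (inj₁ s)) q ψ α = sym (act-* q s ψ α)
  act-comm (var (inj₂ a)) q ψ α = sym (act-inc q a ψ α)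
  act-comm 𝟘 q ψ α = sym (act-0 q α)
  act-comm 𝟙 q ψ α = refl
  act-comm (p ⊕ p′) q ψ α =
    trans (+-cong (act-comm p q ψ α) (act-comm p′ q ψ α)) (sym (act-+ q _ _ α))
  act-comm (p ⊗ p′) q ψ α =
    trans (act-cong p (act-comm p′ q ψ) α) (act-comm p q _ α)
  act-comm (⊖ p) q ψ α = trans (-‿cong (act-comm p q ψ α)) (sym (act-neg q _ α))

  record _≈op_ (p q : Operator) : Set where
    constructor pointwise
    field at : ∀ ψ α → act p ψ α ≈ act q ψ α
  open _≈op_ public

  -- Carrier and equality stay at level 0, so this is one of the rings over which `_≈P_` quantifies.
  operatorRing : CommutativeRing 0ℓ 0ℓ
  operatorRing = record
    { Carrier = Operator
    ; _≈_ = _≈op_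
    ; _+_ = _⊕_
    ; _*_ = _⊗_
    ; -_ = ⊖_
    ; 0# = 𝟘
    ; 1# = 𝟙
    ; isCommutativeRing = record
      { isRing = record
        { +-isAbelianGroup = record
          { isGroup = record
            { isMonoid = record
              { isSemigroup = record
                { isMagma = record
                  { isEquivalence = record
                    { refl = pointwise λ ψ α → refl
                    ; sym = λ e → pointwise λ ψ α → sym (at e ψ α)
                    ; trans = λ e f → pointwise λ ψ α → trans (at e ψ α) (at f ψ α)
                    }
                  ; ∙-cong = λ e f → pointwise λ ψ α → +-cong (at e ψ α) (at f ψ α)
                  }
                ; assoc = λ p q r → pointwise λ ψ α → +-assoc _ _ _
                }
              ; identity = (λ p → pointwise λ ψ α → +-identityˡ _) , (λ p → pointwise λ ψ α → +-identityʳ _)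
              }
            ; inverse = (λ p → pointwise λ ψ α → -‿inverseˡ _) , (λ p → pointwise λ ψ α → -‿inverseʳ _)
            ; ⁻¹-cong = λ e → pointwise λ ψ α → -‿cong (at e ψ α)
            }
          ; comm = λ p q → pointwise λ ψ α → +-comm _ _
          }
        ; *-cong = λ {p} {p′} {q} {q′} e f → pointwise λ ψ α → trans (at e (act q ψ) α) (act-cong p′ (at f ψ) α)
        ; *-assoc = λ p q r → pointwise λ ψ α → refl
        ; *-identity = (λ p → pointwise λ ψ α → refl) , (λ p → pointwise λ ψ α → refl)
        ; distrib = (λ p q r → pointwise λ ψ α → act-+ p _ _ α) , (λ p q r → pointwise λ ψ α → refl)
        }
      ; *-comm = λ p q → pointwise λ ψ α → act-comm p q ψ α
      }
    }

  -- The sign rule alone gives only `ψ α + ψ α ≈ 0#` at equal exponents, which does not imply `null`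
  -- when 2 is a zero divisor in R.
  record Alternating (k : ℕ) (ψ : Functional) : Set where
    field
      anti : ∀ {α β} → Swap k α β → ψ β ≈ -R ψ α
      null : ∀ {α} → Swap k α α → ψ α ≈ 0#
  open Alternating public

  PreservesAlternating : ℕ → Operator → Set
  PreservesAlternating k p = ∀ {ψ} → Alternating k ψ → Alternating k (act p ψ)

  private
    a≈-b⇒a+b≈0 : ∀ {a b} → a ≈ -R b → a +R b ≈ 0#
    a≈-b⇒a+b≈0 e = trans (+-congʳ e) (-‿inverseˡ _)

  -- Multiplying by `x k + x l` turns a monomial with equal exponents into two monomials exchanged
  -- by the swap, whose values cancel by the sign rule. Multiplying by `x k * x l` raises both
  -- exponents and so commutes with the swap.
  preservesAlternating : ∀ k {xs} (c : ConsecutiveIn k xs) (Y : ℕ → Carrier) →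
    Symmetry.SymmetricPredicate operatorRing xs shift (scalar ∘ Y) k c (PreservesAlternating k)
  preservesAlternating k c Y = record
    { resp = λ e P A → record
        { anti = λ s → trans (sym (at e _ _)) (trans (P A .anti s) (-‿cong (at e _ _)))
        ; null = λ s → trans (sym (at e _ _)) (P A .null s) }
    ; P-0 = λ A → record { anti = λ s → sym -0#≈0# ; null = λ s → refl }
    ; P-1 = λ A → A
    ; P-+ = λ P P′ A → record
        { anti = λ s → trans (+-cong (P A .anti s) (P′ A .anti s)) (⁻¹-∙-comm _ _)
        ; null = λ s → trans (+-cong (P A .null s) (P′ A .null s)) (+-identityʳ 0#) }
    ; P-* = λ P P′ A → P (P′ A)
    ; P-neg = λ P A → record
        { anti = λ s → -‿cong (P A .anti s)
        ; null = λ s → trans (-‿cong (P A .null s)) -0#≈0# }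
    ; P-x = λ a≢k a≢l A → record
        { anti = λ s → A .anti (Swap-inc a≢k a≢l s)
        ; null = λ s → A .null (Swap-inc a≢k a≢l s) }
    ; P-Y = λ j A → record
        { anti = λ s → trans (*-congˡ (A .anti s)) (sym (-‿distribʳ-* _ _))
        ; null = λ s → trans (*-congˡ (A .null s)) (zeroʳ _) }
    ; P-x+x = λ A → record
        { anti = λ s → trans (+-cong (A .anti (Swap-incʳ s)) (A .anti (Swap-incˡ s)))
            (trans (⁻¹-∙-comm _ _) (-‿cong (+-comm _ _)))
        ; null = λ s → a≈-b⇒a+b≈0 (A .anti (Swap-incʳ s)) }
    ; P-x*x = λ {ψ} A → record
        { anti = λ {α} {β} s → trans (reflexive (≡.cong ψ (inc-comm (suc k) k β)))
                         (A .anti (Swap-incʳ (Swap-incˡ s)))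
        ; null = λ {α} s → A .null (≡.subst (Swap k _) (inc-comm k (suc k) α)
                                 (Swap-incʳ (Swap-incˡ s))) }
    }

-- Alternating linear forms

module Wedge (R : CommutativeRing 0ℓ 0ℓ) where
  open CommutativeRing R renaming (_+_ to _+R_; _*_ to _*R_; -_ to -R_)
  open RingSums R
  open Relation.Binary.Reasoning.Setoid setoid
  open Algebra.Properties.Ring ring using (-0#≈0#; -‿involutive)
  open Algebra.Properties.AbelianGroup +-abelianGroup using (⁻¹-∙-comm)
  open Algebra.Properties.CommutativeSemigroup +-commutativeSemigroup using (interchange)

  -- Contraction of an alternating form by the basis vector e_a.
  contract : ℕ → (List ℕ → Carrier) → List ℕ → Carrier
  contract a g [] = 0#
  contract a g (t ∷ ts) = ((a ≡ᵇ t) ▹ g ts) +R -R contract a (λ u → g (t ∷ u)) ts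

  contract-cong : ∀ a {f g} ts → (∀ u → f u ≈ g u) → contract a f ts ≈ contract a g ts
  contract-cong a [] e = refl
  contract-cong a (t ∷ ts) e =
    +-cong (▹-cong _ (λ _ → e ts)) (-‿cong (contract-cong a ts (λ u → e (t ∷ u))))

  contract-+ : ∀ a f g ts → contract a (λ u → f u +R g u) ts ≈ contract a f ts +R contract a g ts
  contract-+ a f g [] = sym (+-identityʳ 0#)
  contract-+ a f g (t ∷ ts) = trans
    (+-cong (▹-+ _) (trans (-‿cong (contract-+ a _ _ ts)) (sym (⁻¹-∙-comm _ _))))
    (interchange _ _ _ _)

  contract-0 : ∀ a {f} ts → (∀ u → f u ≈ 0#) → contract a f ts ≈ 0#
  contract-0 a [] e = refl
  contract-0 a (t ∷ ts) e = trans
    (+-cong (▹-0 _ (λ _ → e ts)) (trans (-‿cong (contract-0 a ts (λ u → e (t ∷ u)))) -0#≈0#))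
    (+-identityʳ 0#)

  contract-neg : ∀ a f ts → contract a (λ u → -R f u) ts ≈ -R contract a f ts
  contract-neg a f ts = begin
    N ≈⟨ +-identityʳ _ ⟨
    N +R 0# ≈⟨ +-congˡ (-‿inverseʳ C) ⟨
    N +R (C +R -R C) ≈⟨ +-assoc _ _ _ ⟨
    (N +R C) +R -R C ≈⟨ +-congʳ (contract-+ a _ f ts) ⟨
    contract a (λ u → -R f u +R f u) ts +R -R C
      ≈⟨ +-congʳ (contract-0 a ts (λ u → -‿inverseˡ (f u))) ⟩
    0# +R -R C ≈⟨ +-identityˡ _ ⟩
    -R C ∎
    where
    N = contract a (λ u → -R f u) ts
    C = contract a f ts

  contract-▹ : ∀ a b f ts → contract a (λ u → b ▹ f u) ts ≈ (b ▹ contract a f ts)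
  contract-▹ a true f ts = trans (contract-cong a ts (λ u → ▹-true ≡.refl)) (sym (▹-true ≡.refl))
  contract-▹ a false f ts = trans (contract-0 a ts (λ u → ▹-false ≡.refl)) (sym (▹-false ≡.refl))

  -- Isolates the terms in which one of the two contractions consumes t. They are visibly
  -- antisymmetric in a and b, and the rest is again a double contraction, now on the shorter list.
  contract² : ∀ a b g t ts → contract a (contract b g) (t ∷ ts) ≈
    (((a ≡ᵇ t) ▹ contract b g ts) +R -R ((b ≡ᵇ t) ▹ contract a g ts)) +R
      contract a (contract b (λ u → g (t ∷ u))) ts
  contract² a b g t ts = begin
    A +R -R contract a (λ u → ((b ≡ᵇ t) ▹ g u) +R -R contract b (λ v → g (t ∷ v)) u) ts
      ≈⟨ +-congˡ (-‿cong (contract-+ a _ _ ts)) ⟩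
    A +R -R (contract a (λ u → (b ≡ᵇ t) ▹ g u) ts +R
             contract a (λ u → -R contract b (λ v → g (t ∷ v)) u) ts)
      ≈⟨ +-congˡ (-‿cong (+-cong (contract-▹ a _ g ts) (contract-neg a _ ts))) ⟩
    A +R -R (B +R -R C) ≈⟨ +-congˡ (⁻¹-∙-comm _ _) ⟨
    A +R (-R B +R -R (-R C)) ≈⟨ +-congˡ (+-congˡ (-‿involutive C)) ⟩
    A +R (-R B +R C) ≈⟨ +-assoc _ _ _ ⟨
    (A +R -R B) +R C ∎
    where
    A = (a ≡ᵇ t) ▹ contract b g ts
    B = (b ≡ᵇ t) ▹ contract a g ts
    C = contract a (contract b (λ u → g (t ∷ u))) ts

  contract-anti : ∀ a b g ts → contract a (contract b g) ts ≈ -R contract b (contract a g) ts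
  contract-anti a b g [] = sym -0#≈0#
  contract-anti a b g (t ∷ ts) = begin
    contract a (contract b g) (t ∷ ts) ≈⟨ contract² a b g t ts ⟩
    (A +R -R B) +R contract a (contract b (λ u → g (t ∷ u))) ts
      ≈⟨ +-cong (+-comm _ _) (contract-anti a b _ ts) ⟩
    (-R B +R A) +R -R C ≈⟨ +-congʳ (+-congˡ (-‿involutive A)) ⟨
    (-R B +R -R (-R A)) +R -R C ≈⟨ +-congʳ (⁻¹-∙-comm _ _) ⟩
    -R (B +R -R A) +R -R C ≈⟨ ⁻¹-∙-comm _ _ ⟩
    -R ((B +R -R A) +R C) ≈⟨ -‿cong (contract² b a g t ts) ⟨
    -R contract b (contract a g) (t ∷ ts) ∎
    where
    A = (a ≡ᵇ t) ▹ contract b g ts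
    B = (b ≡ᵇ t) ▹ contract a g ts
    C = contract b (contract a (λ u → g (t ∷ u))) ts

  contract-self : ∀ a g ts → contract a (contract a g) ts ≈ 0#
  contract-self a g [] = refl
  contract-self a g (t ∷ ts) = trans (contract² a a g t ts)
    (trans (+-cong (-‿inverseʳ _) (contract-self a _ ts)) (+-identityʳ 0#))

  contract-absent : ∀ a g {ts} → All (a ≢_) ts → contract a g ts ≈ 0#
  contract-absent a g [] = refl
  contract-absent a g {t ∷ ts} (a≢t ∷ as) = trans
    (+-cong (▹-false (Bool-ext (λ e → a≢t (ℕ.≡ᵇ⇒≡ a t e)) λ ()))
      (trans (-‿cong (contract-absent a _ as)) -0#≈0#))
    (+-identityʳ 0#)

  contract-head : ∀ a g {ts} → All (a ≢_) ts → contract a g (a ∷ ts) ≈ g ts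
  contract-head a g {ts} as = trans
    (+-cong (▹-true (T⇒≡true (ℕ.≡⇒≡ᵇ a a ≡.refl))) (trans (-‿cong (contract-absent a _ as)) -0#≈0#))
    (+-identityʳ _)

  -- The determinant of the matrix of Kronecker deltas between α and ts.
  wedge : ∀ {n} → Vec ℕ n → List ℕ → Carrier
  wedge [] [] = 1#
  wedge [] (_ ∷ _) = 0#
  wedge (a ∷ α) = contract a (wedge α)

  wedge-anti : ∀ {n k} {α β : Vec ℕ n} → Swap k α β → ∀ ts → wedge β ts ≈ -R wedge α ts
  wedge-anti here ts = contract-anti _ _ _ ts
  wedge-anti (there {c = c} s) ts =
    trans (contract-cong c ts (wedge-anti s)) (contract-neg c _ ts)

  wedge-null : ∀ {n k} {α : Vec ℕ n} → Swap k α α → ∀ ts → wedge α ts ≈ 0#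
  wedge-null here ts = contract-self _ _ ts
  wedge-null (there {c = c} s) ts = contract-0 c ts (wedge-null s)

  wedge-absent : ∀ {n} (α : Vec ℕ n) t ts → All (t ≢_) (toList α) → wedge α (t ∷ ts) ≈ 0#
  wedge-absent [] t ts _ = refl
  wedge-absent (a ∷ α) t ts (t≢a ∷ as) = trans
    (+-cong (▹-false (Bool-ext (λ e → t≢a (≡.sym (ℕ.≡ᵇ⇒≡ a t e))) λ ()))
      (trans (-‿cong (contract-0 a ts (λ u → wedge-absent α t u as))) -0#≈0#))
    (+-identityʳ 0#)

  wedge-same : ∀ {n} (α : Vec ℕ n) → decreasing α ≡ true → wedge α (toList α) ≈ 1#
  wedge-same [] d = refl
  wedge-same (a ∷ α) d = trans (contract-head a (wedge α) (All.map ℕ.>⇒≢ (decreasing⇒All< a α d)))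
    (wedge-same α (proj₂ (∧-true {above a α} d)))

  -- If the heads differ, the larger one exceeds every entry of the other sequence, so the delta
  -- matrix has a zero row or a zero column.
  wedge-different : ∀ {n} (α β : Vec ℕ n) → decreasing α ≡ true → decreasing β ≡ true →
    α ≢ β → wedge α (toList β) ≈ 0#
  wedge-different [] [] d d′ α≢β = ⊥-elim (α≢β ≡.refl)
  wedge-different (a ∷ α) (b ∷ β) d d′ α≢β with ℕ.<-cmp a b
  ... | tri< a<b _ _ = wedge-absent (a ∷ α) b (toList β) (ℕ.>⇒≢ a<b ∷
        All.map (λ c<a → ℕ.>⇒≢ (ℕ.<-trans c<a a<b)) (decreasing⇒All< a α d))
  ... | tri≈ _ ≡.refl _ = trans (contract-head a (wedge α) (All.map ℕ.>⇒≢ (decreasing⇒All< a β d′)))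
        (wedge-different α β (proj₂ (∧-true {above a α} d)) (proj₂ (∧-true {above a β} d′))
          (α≢β ∘ ≡.cong (a ∷_)))
  ... | tri> _ _ b<a = contract-absent a (wedge α) (ℕ.>⇒≢ b<a ∷
        All.map (λ c<b → ℕ.>⇒≢ (ℕ.<-trans c<b b<a)) (decreasing⇒All< b β d′))

-- Expansion into barred tableaux

∧-interchange : ∀ p q r s → (p ∧ q) ∧ (r ∧ s) ≡ (p ∧ r) ∧ (q ∧ s)
∧-interchange false q r s = ≡.refl
∧-interchange true false false s = ≡.refl
∧-interchange true false true s = ≡.refl
∧-interchange true true r s = ≡.refl

upFrom : ℕ → ℕ → List ℕ
upFrom i zero = []
upFrom i (suc m) = i ∷ upFrom (suc i) m

map-suc-applyUpTo : ∀ f i m → (∀ j → suc (f j) ≡ i + j) → map suc (applyUpTo f m) ≡ upFrom i m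
map-suc-applyUpTo f i zero e = ≡.refl
map-suc-applyUpTo f i (suc m) e = ≡.cong₂ _∷_ (≡.trans (e 0) (ℕ.+-identityʳ i))
  (map-suc-applyUpTo (f ∘ suc) (suc i) m (λ j → ≡.trans (e (suc j)) (ℕ.+-suc i j)))

range1≡upFrom : ∀ n → range1 n ≡ upFrom 1 n
range1≡upFrom n = map-suc-applyUpTo _ 1 n (λ j → ≡.refl)

upFrom-≥ : ∀ i m → All (i ≤_) (upFrom i m)
upFrom-≥ i zero = []
upFrom-≥ i (suc m) = ℕ.≤-refl ∷ All.map (ℕ.≤-trans (ℕ.n≤1+n i)) (upFrom-≥ (suc i) m)

upFrom-consecutive : ∀ {k} i m → i ≤ k → suc k < i + m → ConsecutiveIn k (upFrom i m)
upFrom-consecutive {k} i zero i≤k k<i =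
  ⊥-elim (ℕ.<⇒≱ k<i (ℕ.≤-trans (ℕ.≤-reflexive (ℕ.+-identityʳ i)) (ℕ.≤-trans i≤k (ℕ.n≤1+n k))))
upFrom-consecutive {k} i (suc m) i≤k k< with ℕ.<-cmp i k
... | tri< i<k _ _ = there (ℕ.<⇒≢ i<k) (ℕ.<⇒≢ (ℕ.m<n⇒m<1+n i<k))
        (upFrom-consecutive (suc i) m i<k (≡.subst (suc k <_) (ℕ.+-suc i m) k<))
... | tri> _ _ k<i = ⊥-elim (ℕ.<⇒≱ k<i i≤k)
... | tri≈ _ ≡.refl _ = at-head m k<
  where
  at-head : ∀ m → suc i < i + suc m → ConsecutiveIn i (i ∷ upFrom (suc i) m)
  at-head zero lt = ⊥-elim (ℕ.<⇒≢ lt (≡.sym (ℕ.+-comm i 1)))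
  at-head (suc m) _ = here (All.map (λ a → ℕ.>⇒≢ (ℕ.<-trans (ℕ.n<1+n i) a) , ℕ.>⇒≢ a)
    (upFrom-≥ (suc (suc i)) m))

Swap-bounds : ∀ {n k} {α β : Vec ℕ n} → Swap k α β → 1 ≤ k × k < n
Swap-bounds here = s≤s z≤n , s≤s (s≤s z≤n)
Swap-bounds (there s) with Swap-bounds s
... | _ , k<n = s≤s z≤n , s≤s k<n

Swap-consecutive : ∀ {n k} {α β : Vec ℕ n} → Swap k α β → ConsecutiveIn k (range1 n)
Swap-consecutive {n} {k} s = ≡.subst (ConsecutiveIn k) (≡.sym (range1≡upFrom n))
  (upFrom-consecutive 1 n (proj₁ (Swap-bounds s)) (s≤s (proj₂ (Swap-bounds s))))

incs : ∀ {n} → List ℕ → Vec ℕ n → Vec ℕ n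
incs [] α = α
incs (a ∷ w) α = incs w (inc a α)

incs-++ : ∀ {n} u v (α : Vec ℕ n) → incs (u ++ v) α ≡ incs v (incs u α)
incs-++ [] v α = ≡.refl
incs-++ (a ∷ u) v α = incs-++ u v (inc a α)

-- With α = ν + (n, …, 1): the word w is Yamanouchi relative to the partition ν.
yamanouchiFrom : ∀ {n} → Vec ℕ n → List ℕ → Bool
yamanouchiFrom α [] = true
yamanouchiFrom α (a ∷ w) = decreasing (inc a α) ∧ yamanouchiFrom (inc a α) w

yamanouchiFrom-++ : ∀ {n} u v (α : Vec ℕ n) →
  yamanouchiFrom α (u ++ v) ≡ yamanouchiFrom α u ∧ yamanouchiFrom (incs u α) v
yamanouchiFrom-++ [] v α = ≡.refl
yamanouchiFrom-++ (a ∷ u) v α =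
  ≡.trans (≡.cong (decreasing (inc a α) ∧_) (yamanouchiFrom-++ u v (inc a α)))
    (≡.sym (∧-assoc (decreasing (inc a α)) _ _))

yamanouchiFrom⇒decreasing : ∀ {n} (α : Vec ℕ n) w → decreasing α ≡ true →
  yamanouchiFrom α w ≡ true → decreasing (incs w α) ≡ true
yamanouchiFrom⇒decreasing α [] d y = d
yamanouchiFrom⇒decreasing α (a ∷ w) d y =
  yamanouchiFrom⇒decreasing (inc a α) w (proj₁ (∧-true y)) (proj₂ (∧-true {decreasing (inc a α)} y))

decreasing-suc : ∀ {n} x (α : Vec ℕ n) → decreasing (x ∷ α) ≡ true → decreasing (suc x ∷ α) ≡ true
decreasing-suc x [] d = d
decreasing-suc x (y ∷ α) d =
  ≡.cong₂ _∧_ (≤⇒≤ᵇ≡true (ℕ.m<n⇒m<1+n (≤ᵇ≡true⇒≤ (suc y) (proj₁ (∧-true {y <ᵇ x} d)))))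
    (proj₂ (∧-true {y <ᵇ x} d))

-- Neighbouring exponents differ by at least 1, so raising one of them can at worst produce a tie
-- with its predecessor.
inc-decreasing : ∀ {n} a (α : Vec ℕ n) → decreasing α ≡ true →
  decreasing (inc a α) ≡ true ⊎ Σ ℕ λ k → a ≡ suc k × Swap k (inc a α) (inc a α)
inc-decreasing zero α d = inj₁ d
inc-decreasing (suc a) [] d = inj₁ d
inc-decreasing (suc zero) (x ∷ α) d = inj₁ (decreasing-suc x α d)
inc-decreasing (suc (suc a)) (x ∷ []) d = inj₁ d
inc-decreasing (suc (suc zero)) (x ∷ y ∷ α) d
  with ℕ.m≤n⇒m<n∨m≡n (≤ᵇ≡true⇒≤ (suc y) {x} (proj₁ (∧-true {y <ᵇ x} d)))
... | inj₂ ≡.refl = inj₂ (1 , ≡.refl , here)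
... | inj₁ 1+y<x = inj₁ (≡.cong₂ _∧_ (≤⇒≤ᵇ≡true 1+y<x)
      (decreasing-suc y α (proj₂ (∧-true {y <ᵇ x} d))))
inc-decreasing (suc (suc (suc a))) (x ∷ y ∷ α) d
  with inc-decreasing (suc (suc a)) (y ∷ α) (proj₂ (∧-true {y <ᵇ x} d))
... | inj₁ d′ = inj₁ (≡.cong₂ _∧_ (proj₁ (∧-true {y <ᵇ x} d)) d′)
... | inj₂ (k , e , s) = inj₂ (suc k , ≡.cong suc e , there s)

Swap-incs : ∀ {n k} w {α : Vec ℕ n} → All (suc k <_) w → Swap k α α → Swap k (incs w α) (incs w α)
Swap-incs [] [] s = s
Swap-incs {k = k} (a ∷ w) (l<a ∷ as) s =
  Swap-incs w as (Swap-inc (ℕ.>⇒≢ (ℕ.<-trans (ℕ.n<1+n k) l<a)) (ℕ.>⇒≢ l<a) s)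

strictFrom : ℕ → List ℕ → Bool
strictFrom lo [] = true
strictFrom lo (a ∷ v) = (lo ≤ᵇ a) ∧ strictFrom (suc a) v

strictFrom⇒All : ∀ lo v → strictFrom lo v ≡ true → All (lo ≤_) v
strictFrom⇒All lo [] s = []
strictFrom⇒All lo (a ∷ v) s = lo≤a ∷
  All.map (λ a<b → ℕ.≤-trans lo≤a (ℕ.<⇒≤ a<b)) (strictFrom⇒All (suc a) v (proj₂ (∧-true {lo ≤ᵇ a} s)))
  where lo≤a = ≤ᵇ≡true⇒≤ lo (proj₁ (∧-true s))

-- Strictness leaves no room between k and `suc k`: a k can only stand directly above, and
-- everything below `suc k` is larger.
strict⇒Balanced : ∀ {k} lo v → strictFrom lo v ≡ true → suc k ∈ v → Balanced k v
strict⇒Balanced lo (a ∷ v) s (here ≡.refl) = upper (strictFrom⇒All (suc a) v (proj₂ (∧-true {lo ≤ᵇ a} s)))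
strict⇒Balanced {k} lo (a ∷ v) s (there l∈v) with proj₂ (∧-true {lo ≤ᵇ a} s)
... | s′ with ℕ.m≤n⇒m<n∨m≡n (s≤s⁻¹ (All.lookup (strictFrom⇒All (suc a) v s′) l∈v))
...   | inj₁ a<k = low a<k (strict⇒Balanced (suc a) v s′ l∈v)
...   | inj₂ ≡.refl = next v s′ l∈v
  where
  next : ∀ v → strictFrom (suc a) v ≡ true → suc a ∈ v → Balanced a (a ∷ v)
  next (b ∷ v) s (here ≡.refl) = both (strictFrom⇒All (suc b) v (proj₂ (∧-true {suc a ≤ᵇ b} s)))
  next (b ∷ v) s (there l∈v) = ⊥-elim (ℕ.<⇒≱ (s≤s (≤ᵇ≡true⇒≤ (suc a) (proj₁ (∧-true s))))
    (All.lookup (strictFrom⇒All (suc b) v (proj₂ (∧-true {suc a ≤ᵇ b} s))) l∈v))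

vals : List Entry → List ℕ
vals = map proj₂

unbarredValues-++ : ∀ u v → unbarredValues (u ++ v) ≡ unbarredValues u ++ unbarredValues v
unbarredValues-++ [] v = ≡.refl
unbarredValues-++ ((false , a) ∷ u) v = ≡.cong (a ∷_) (unbarredValues-++ u v)
unbarredValues-++ ((true , a) ∷ u) v = unbarredValues-++ u v

unbarredValues-All : ∀ {P : ℕ → Set} u → All P (vals u) → All P (unbarredValues u)
unbarredValues-All [] [] = []
unbarredValues-All ((false , a) ∷ u) (p ∷ ps) = p ∷ unbarredValues-All u ps
unbarredValues-All ((true , a) ∷ u) (p ∷ ps) = unbarredValues-All u ps

-- The first letter suc k at which the column fails stops the exponents k and suc k from
-- changing any further, and makes them equal.
column-fails : ∀ {n} lo (α : Vec ℕ n) col → decreasing α ≡ true → strictFrom lo (vals col) ≡ true →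
  yamanouchiFrom α (unbarredValues col) ≡ false →
  Σ ℕ λ k → suc k ∈ vals col × Swap k (incs (unbarredValues col) α) (incs (unbarredValues col) α)
column-fails lo α ((true , a) ∷ col) d s y with column-fails (suc a) α col d (proj₂ (∧-true {lo ≤ᵇ a} s)) y
... | k , l∈ , sw = k , there l∈ , sw
column-fails lo α ((false , a) ∷ col) d s y with inc-decreasing a α d
... | inj₁ d′ with column-fails (suc a) (inc a α) col d′ (proj₂ (∧-true {lo ≤ᵇ a} s))
                     (≡.trans (≡.cong (_∧ yamanouchiFrom (inc a α) (unbarredValues col)) (≡.sym d′)) y)
...   | k , l∈ , sw = k , there l∈ , sw
column-fails lo α ((false , a) ∷ col) d s y | inj₂ (k , ≡.refl , sw) = k , here ≡.refl ,
  Swap-incs (unbarredValues col)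
    (unbarredValues-All col (strictFrom⇒All (suc a) (vals col) (proj₂ (∧-true {lo ≤ᵇ a} s)))) sw

leCol : List ℕ → List ℕ → Bool
leCol [] b = true
leCol (a ∷ v) b = leHead a b ∧ leCol v (drop 1 b)

-- Columns are listed from right to left, b being the column to the right of the first.
semistandardFrom : List ℕ → List (List ℕ) → Bool
semistandardFrom b [] = true
semistandardFrom b (v ∷ V) = (strictFrom 0 v ∧ leCol v b) ∧ semistandardFrom v V

∈-sequenceL⁻ : ∀ {A : Set} (xss : List (List A)) {s} → s ∈ sequenceL xss → Pointwise _∈_ s xss
∈-sequenceL⁻ [] (here ≡.refl) = []
∈-sequenceL⁻ (xs ∷ xss) s∈
  with find (∈-concatMap⁻ (λ x → map (x ∷_) (sequenceL xss)) {xs = xs} s∈)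
... | x , x∈ , p with ∈-map⁻ (x ∷_) p
...   | s , s∈′ , ≡.refl = x∈ ∷ ∈-sequenceL⁻ xss s∈′

∈-replicate⁻ : ∀ {A : Set} {xs : List A} h {s} → s ∈ sequenceL (replicate h xs) →
  length s ≡ h × All (_∈ xs) s
∈-replicate⁻ h s∈ = go h (∈-sequenceL⁻ _ s∈)
  where
  go : ∀ {A : Set} {xs : List A} h {s} → Pointwise _∈_ s (replicate h xs) → length s ≡ h × All (_∈ xs) s
  go zero [] = ≡.refl , []
  go (suc h) (p ∷ ps) with go h ps
  ... | e , a = ≡.cong suc e , p ∷ a

∈-fillings⁻ : ∀ {A : Set} {xs : List A} hs {t} → t ∈ fillings hs xs →
  map length t ≡ hs × All (All (_∈ xs)) t
∈-fillings⁻ {xs = xs} hs t∈ = go hs (∈-sequenceL⁻ _ t∈)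
  where
  go : ∀ hs {t} → Pointwise _∈_ t (map (λ k → sequenceL (replicate k xs)) hs) →
    map length t ≡ hs × All (All (_∈ xs)) t
  go [] [] = ≡.refl , []
  go (h ∷ hs) (p ∷ ps) with ∈-replicate⁻ h p | go hs ps
  ... | e , a | e′ , a′ = ≡.cong₂ _∷_ e e′ , a ∷ a′

module Expansion (R : CommutativeRing 0ℓ 0ℓ) (n : ℕ) (Y : ℕ → CommutativeRing.Carrier R) where
  open CommutativeRing R renaming (_+_ to _+R_; _*_ to _*R_; -_ to -R_)
  open RingSums R
  open Operators R n
  private module Q = RingSums operatorRing
  open ColumnSums operatorRing (range1 n) shift (scalar ∘ Y)
  open Relation.Binary.Reasoning.Setoid setoid

  barWeight : ℕ → ℕ → Entry → Carrier
  barWeight r c e = if proj₁ e then Y ((proj₂ e + c) ∸ r) else 1#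

  columnBarWeight : ℕ → ℕ → List Entry → Carrier
  columnBarWeight c r = columnProd barWeight r c

  act-∑ : ∀ {A : Set} (xs : List A) (f : A → Operator) ψ α →
    act (Q.∑ xs f) ψ α ≈ ∑ xs (λ x → act (f x) ψ α)
  act-∑ [] f ψ α = refl
  act-∑ (x ∷ xs) f ψ α = +-congˡ (act-∑ xs f ψ α)

  act-▹ : ∀ b p ψ α → act (b Q.▹ p) ψ α ≈ (b ▹ act p ψ α)
  act-▹ true p ψ α = trans (at (Q.▹-true ≡.refl) ψ α) (sym (▹-true ≡.refl))
  act-▹ false p ψ α = trans (at (Q.▹-false ≡.refl) ψ α) (sym (▹-false ≡.refl))

  ∑-barred : (f : Entry → Carrier) →
    ∑ (barredEntries n) f ≈ ∑ (range1 n) (λ a → f (false , a) +R f (true , a))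
  ∑-barred f = trans (∑-concatMap _ (range1 n) f)
    (∑-cong (range1 n) (λ a → +-congˡ (+-identityʳ _)))

  -- In each weight the x-part is an unbarred entry and moves the exponent vector, while the Y-part
  -- is a barred entry and acts as a scalar.
  act-columnSum : ∀ c h r lo b g ψ α → act (columnSum c h r lo b g) ψ α ≈
    ∑ (sequenceL (replicate h (barredEntries n))) (λ col →
      (strictFrom lo (vals col) ∧ leCol (vals col) b) ▹
        columnBarWeight c r col *R act (g (vals col)) ψ (incs (unbarredValues col) α))
  act-columnSum c zero r lo b g ψ α =
    sym (trans (+-identityʳ _) (trans (▹-true ≡.refl) (*-identityˡ _)))
  act-columnSum c (suc h) r lo b g ψ α = begin
    act (columnSum c (suc h) r lo b g) ψ α ≈⟨ act-∑ (range1 n) _ ψ α ⟩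
    ∑ (range1 n) (λ a → act (ok a Q.▹ weight r c a ⊗ next a) ψ α)
      ≈⟨ ∑-cong (range1 n) (λ a → act-▹ (ok a) _ ψ α) ⟩
    ∑ (range1 n) (λ a → ok a ▹ (act (next a) ψ (inc a α) +R Y ((a + c) ∸ r) *R act (next a) ψ α))
      ≈⟨ ∑-cong (range1 n) (λ a → ▹-cong _ (λ _ →
           +-cong (trans (IH a _) (sym (*-identityˡ _))) (*-congˡ (IH a _)))) ⟩
    ∑ (range1 n) (λ a → ok a ▹ (1# *R ∑ cols (part a (inc a α)) +R Y ((a + c) ∸ r) *R ∑ cols (part a α)))
      ≈⟨ ∑-cong (range1 n) (λ a → trans (▹-+ (ok a)) (+-cong (collect a false) (collect a true))) ⟩
    ∑ (range1 n) (λ a → ∑ cols (λ col → total ((false , a) ∷ col)) +R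
                        ∑ cols (λ col → total ((true , a) ∷ col)))
      ≈⟨ ∑-barred _ ⟨
    ∑ (barredEntries n) (λ e → ∑ cols (λ col → total (e ∷ col)))
      ≈⟨ ∑-sequenceL (barredEntries n) (replicate h (barredEntries n)) total ⟨
    ∑ (sequenceL (replicate (suc h) (barredEntries n))) total ∎
    where
    ok : ℕ → Bool
    ok a = (lo ≤ᵇ a) ∧ leHead a b
    next : ℕ → Operator
    next a = columnSum c h (suc r) (suc a) (drop 1 b) (λ v → g (a ∷ v))
    cols = sequenceL (replicate h (barredEntries n))
    part : ℕ → Vec ℕ n → List Entry → Carrier
    part a β col = (strictFrom (suc a) (vals col) ∧ leCol (vals col) (drop 1 b)) ▹
      columnBarWeight c (suc r) col *R act (g (a ∷ vals col)) ψ (incs (unbarredValues col) β)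
    total : List Entry → Carrier
    total col = (strictFrom lo (vals col) ∧ leCol (vals col) b) ▹
      columnBarWeight c r col *R act (g (vals col)) ψ (incs (unbarredValues col) α)
    IH : ∀ a β → act (next a) ψ β ≈ ∑ cols (part a β)
    IH a β = act-columnSum c h (suc r) (suc a) (drop 1 b) (λ v → g (a ∷ v)) ψ β
    reached : ∀ e → Vec ℕ n
    reached e = incs (unbarredValues (e ∷ [])) α
    total-∷ : ∀ e col → total (e ∷ col) ≈ (ok (proj₂ e) ▹ barWeight r c e *R part (proj₂ e) (reached e) col)
    total-∷ e col = begin
      total (e ∷ col)
        ≈⟨ ▹-congˡ (∧-interchange (lo ≤ᵇ proj₂ e) _ _ _) ⟩
      _ ≈⟨ ▹-∧ _ _ ⟩
      _ ≈⟨ ▹-cong _ (λ _ → ▹-cong _ (λ _ → trans (*-congˡ (reflexive (≡.cong (act (g (vals (e ∷ col))) ψ)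
            (≡.trans (≡.cong (λ u → incs u α) (unbarredValues-++ (e ∷ []) col))
              (incs-++ (unbarredValues (e ∷ [])) _ α))))) (*-assoc _ _ _))) ⟩
      _ ≈⟨ ▹-cong _ (λ _ → sym (▹-*ʳ _ _)) ⟩
      (ok (proj₂ e) ▹ barWeight r c e *R part (proj₂ e) (reached e) col) ∎
    collect : ∀ a bar → (ok a ▹ barWeight r c (bar , a) *R ∑ cols (part a (reached (bar , a)))) ≈
      ∑ cols (λ col → total ((bar , a) ∷ col))
    collect a bar = trans (▹-cong _ (λ _ → ∑-*ˡ cols _ _)) (trans (∑-▹ cols _ _)
      (∑-cong cols (λ col → sym (total-∷ (bar , a) col))))

  word : List (List Entry) → List ℕ
  word W = unbarredValues (concat W)

  -- The `Swap` argument carries the information that k and `suc k` are positions of the vector.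
  AllAlternating : Functional → Set
  AllAlternating ψ = ∀ {k} {α β : Vec ℕ n} → Swap k α β → Alternating k ψ

  tableauSum-alternating : ∀ hs {k b} → ConsecutiveIn k (range1 n) → Heights (length b) hs →
    Balanced k b → PreservesAlternating k (tableauSum hs b)
  tableauSum-alternating hs {k} cons H ok = Symmetry.P-tableauSum operatorRing (range1 n) shift (scalar ∘ Y) k
    cons (PreservesAlternating k) (preservesAlternating k cons Y) hs H ok

  -- Whole columns are processed, not single letters, because the symmetry of the remaining sum
  -- depends on the complete bounding column. A column that passes hands decreasing exponents to the
  -- next one; after a column that fails, both sides are zero.
  act-tableauSum : ∀ hs b {ψ} α → AllAlternating ψ → decreasing α ≡ true → Heights (length b) hs →
    act (tableauSum hs b) ψ α ≈
    ∑ (fillings hs (barredEntries n)) (λ W →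
      (semistandardFrom b (map vals W) ∧ yamanouchiFrom α (word W)) ▹
        readingProd barWeight W *R ψ (incs (word W) α))
  act-tableauSum [] b α alt d H = sym (trans (+-identityʳ _) (trans (▹-true ≡.refl) (*-identityˡ _)))
  act-tableauSum (h ∷ hs) b {ψ} α alt d (b≤h ∷ H) = begin
    act (tableauSum (h ∷ hs) b) ψ α ≈⟨ act-columnSum _ h 1 0 b (tableauSum hs) ψ α ⟩
    ∑ cols (λ col → good col ▹ columnBarWeight (suc (length hs)) 1 col *R
        act (tableauSum hs (vals col)) ψ (after col))
      ≈⟨ ∑-cong∈ cols (λ col col∈ → ▹-cong _ (λ g → step col col∈ g)) ⟩
    ∑ cols (λ col → good col ▹ ∑ (fillings hs E) (λ W → rest col W ▹ value (col ∷ W)))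
      ≈⟨ ∑-cong cols (λ col → trans (∑-▹ (fillings hs E) _ _) (∑-cong (fillings hs E) (λ W →
           trans (sym (▹-∧ (good col) (rest col W))) (▹-congˡ (regroup col W))))) ⟩
    ∑ cols (λ col → ∑ (fillings hs E) (λ W → total (col ∷ W)))
      ≈⟨ ∑-sequenceL cols (map (λ k → sequenceL (replicate k E)) hs) total ⟨
    ∑ (fillings (h ∷ hs) E) total ∎
    where
    E = barredEntries n
    cols = sequenceL (replicate h E)
    good : List Entry → Bool
    good col = strictFrom 0 (vals col) ∧ leCol (vals col) b
    after : List Entry → Vec ℕ n
    after col = incs (unbarredValues col) α
    value : List (List Entry) → Carrier
    value W = readingProd barWeight W *R ψ (incs (word W) α)
    total : List (List Entry) → Carrier
    total W = (semistandardFrom b (map vals W) ∧ yamanouchiFrom α (word W)) ▹ value W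
    rest : List Entry → List (List Entry) → Bool
    rest col W = semistandardFrom (vals col) (map vals W) ∧
      (yamanouchiFrom α (unbarredValues col) ∧ yamanouchiFrom (after col) (word W))
    regroup : ∀ col W → good col ∧ rest col W ≡
      semistandardFrom b (map vals (col ∷ W)) ∧ yamanouchiFrom α (word (col ∷ W))
    regroup col W = ≡.trans (≡.sym (∧-assoc (good col) _ _)) (≡.cong (semistandardFrom b (map vals (col ∷ W)) ∧_)
      (≡.sym (≡.trans (≡.cong (yamanouchiFrom α) (unbarredValues-++ col (concat W)))
        (yamanouchiFrom-++ (unbarredValues col) (word W) α))))
    step : ∀ col → col ∈ cols → good col ≡ true →
      columnBarWeight (suc (length hs)) 1 col *R act (tableauSum hs (vals col)) ψ (after col) ≈
      ∑ (fillings hs E) (λ W → rest col W ▹ value (col ∷ W))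
    step col col∈ g with yamanouchiFrom α (unbarredValues col) in y
    ... | true = begin
      cw *R act (tableauSum hs (vals col)) ψ (after col)
        ≈⟨ *-congˡ (act-tableauSum hs (vals col) (after col) alt
             (yamanouchiFrom⇒decreasing α (unbarredValues col) d y) H′) ⟩
      cw *R ∑ (fillings hs E) _ ≈⟨ ∑-*ˡ (fillings hs E) _ _ ⟩
      ∑ (fillings hs E) _
        ≈⟨ ∑-cong∈ (fillings hs E) (λ W W∈ → trans (▹-*ʳ _ _) (▹-cong _ (λ _ →
             trans (sym (*-assoc _ _ _)) (*-cong
               (*-congʳ (reflexive (≡.cong (λ m → columnBarWeight (suc m) 1 col) (lengths W W∈))))
               (reflexive (≡.cong ψ (≡.sym (≡.trans (≡.cong (λ u → incs u α) (unbarredValues-++ col (concat W)))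
                 (incs-++ (unbarredValues col) (word W) α))))))))) ⟩
      ∑ (fillings hs E) (λ W → (semistandardFrom (vals col) (map vals W) ∧ yamanouchiFrom (after col) (word W)) ▹
        value (col ∷ W)) ∎
      where
      cw = columnBarWeight (suc (length hs)) 1 col
      H′ = ≡.subst (λ m → Heights m hs) (≡.sym (≡.trans (length-map proj₂ col) (proj₁ (∈-replicate⁻ h col∈)))) H
      lengths : ∀ W → W ∈ fillings hs E → length hs ≡ length W
      lengths W W∈ = ≡.trans (≡.cong length (≡.sym (proj₁ (∈-fillings⁻ hs W∈)))) (length-map length W)
    ... | false with column-fails 0 α col d (proj₁ (∧-true g)) y
    ...   | k , l∈ , sw = trans
        (trans (*-congˡ (tableauSum-alternating hs (Swap-consecutive sw) H′
          (strict⇒Balanced 0 (vals col) (proj₁ (∧-true g)) l∈) (alt sw) .null sw)) (zeroʳ _))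
        (sym (∑-0 (fillings hs E) (λ W → ▹-false (∧-zeroʳ _))))
      where
      H′ = ≡.subst (λ m → Heights m hs) (≡.sym (≡.trans (length-map proj₂ col) (proj₁ (∈-replicate⁻ h col∈)))) H

-- Fillings by rows and by columns

-- The result for too few rows is a default value; `EmptyFrom` excludes this case.
glue : {A : Set} → List A → List (List A) → List (List A)
glue [] t = t
glue (a ∷ col) [] = []
glue (a ∷ col) (r ∷ t) = (a ∷ r) ∷ glue col t

-- Columns are listed from left to right.
rows : {A : Set} → ℕ → List (List A) → List (List A)
rows n cols = foldr glue (replicate n []) cols

-- For a partition this is the height of the first column, and `map pred` removes that column.
positives : List ℕ → ℕ
positives [] = 0
positives (zero ∷ ℓ) = 0
positives (suc _ ∷ ℓ) = suc (positives ℓ)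

-- For a partition with parts at most m this is the conjugate partition, padded with zeros to m
-- entries.
columnHeights : ℕ → List ℕ → List ℕ
columnHeights zero ℓ = []
columnHeights (suc m) ℓ = positives ℓ ∷ columnHeights m (map pred ℓ)

data Heights↓ : ℕ → List ℕ → Set where
  [] : ∀ {b} → Heights↓ b []
  _∷_ : ∀ {b h hs} → h ≤ b → Heights↓ h hs → Heights↓ b (h ∷ hs)

positives-pred : ∀ ℓ → positives (map pred ℓ) ≤ positives ℓ
positives-pred [] = z≤n
positives-pred (zero ∷ ℓ) = z≤n
positives-pred (suc zero ∷ ℓ) = z≤n
positives-pred (suc (suc k) ∷ ℓ) = s≤s (positives-pred ℓ)

positives-length : ∀ ℓ → positives ℓ ≤ length ℓ
positives-length [] = z≤n
positives-length (zero ∷ ℓ) = z≤n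
positives-length (suc k ∷ ℓ) = s≤s (positives-length ℓ)

columnHeights-↓ : ∀ {b} m ℓ → positives ℓ ≤ b → Heights↓ b (columnHeights m ℓ)
columnHeights-↓ zero ℓ p = []
columnHeights-↓ (suc m) ℓ p = p ∷ columnHeights-↓ m (map pred ℓ) (positives-pred ℓ)

columnHeights-positive : ∀ h ℓ → All (1 ≤_) (columnHeights h (h ∷ ℓ))
columnHeights-positive zero ℓ = []
columnHeights-positive (suc h) ℓ = s≤s z≤n ∷ columnHeights-positive h (map pred ℓ)

reverse-heights : ∀ {b} hs acc → Heights↓ b hs → (∀ {h} → h ≤ b → Heights h acc) → Heights 0 (hs ʳ++ acc)
reverse-heights [] acc [] H = H z≤n
reverse-heights (h ∷ hs) acc (h≤b ∷ H↓) H = reverse-heights hs (h ∷ acc) H↓ (λ k≤h → k≤h ∷ H h≤b)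

partition-pred : ∀ {ℓ} → Linked _≥_ ℓ → Linked _≥_ (map pred ℓ)
partition-pred p = Linked.map⁺ (Linked.map ℕ.pred-mono-≤ p)

partition-0 : ∀ ℓ → Linked _≥_ (0 ∷ ℓ) → map pred ℓ ≡ ℓ
partition-0 [] p = ≡.refl
partition-0 (zero ∷ ℓ) (z≤n ∷ p) = ≡.cong (0 ∷_) (partition-0 ℓ p)

partition-≤ : ∀ h ℓ → Linked _≥_ (h ∷ ℓ) → All (_≤ h) (h ∷ ℓ)
partition-≤ h ℓ p = Linked.Linked⇒All (λ x≥y y≥z → ℕ.≤-trans y≥z x≥y) ℕ.≤-refl p

-- Gluing a column of height h shifts only the first h rows. A nonempty row below would keep its
-- first box in column 1, and the columns would be mixed up.
data EmptyFrom {A : Set} : ℕ → List (List A) → Set where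
  allEmpty : ∀ {t} → All (_≡ []) t → EmptyFrom 0 t
  skipRow : ∀ {h r t} → EmptyFrom h t → EmptyFrom (suc h) (r ∷ t)

module _ {A : Set} where
  replicate-empty : ∀ n → All (_≡ []) (replicate {A = List A} n [])
  replicate-empty zero = []
  replicate-empty (suc n) = ≡.refl ∷ replicate-empty n

  empty-EmptyFrom : ∀ {h} {t : List (List A)} → h ≤ length t → All (_≡ []) t → EmptyFrom h t
  empty-EmptyFrom {zero} _ e = allEmpty e
  empty-EmptyFrom {suc h} {r ∷ t} (s≤s p) (_ ∷ e) = skipRow (empty-EmptyFrom p e)

  length-glue : ∀ (col : List A) t → EmptyFrom (length col) t → length (glue col t) ≡ length t
  length-glue [] t e = ≡.refl
  length-glue (a ∷ col) (r ∷ t) (skipRow e) = ≡.cong suc (length-glue col t e)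

  glue-EmptyFrom : ∀ {h} (col : List A) t → EmptyFrom (length col) t → length col ≤ h → h ≤ length t →
    EmptyFrom h (glue col t)
  glue-EmptyFrom [] t (allEmpty e) _ h≤ = empty-EmptyFrom h≤ e
  glue-EmptyFrom (a ∷ col) (r ∷ t) (skipRow e) (s≤s c≤h) (s≤s h≤) = skipRow (glue-EmptyFrom col t e c≤h h≤)

  rows-EmptyFrom : ∀ {n h} (cols : List (List A)) → h ≤ n → Heights↓ h (map length cols) →
    EmptyFrom h (rows n cols) × length (rows n cols) ≡ n
  rows-EmptyFrom {n} [] h≤n H = empty-EmptyFrom (≡.subst (_ ≤_) (≡.sym (length-replicate n)) h≤n) (replicate-empty n) , length-replicate n
  rows-EmptyFrom {n} {h} (col ∷ cols) h≤n (c≤h ∷ H) with rows-EmptyFrom cols (ℕ.≤-trans c≤h h≤n) H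
  ... | e , l = glue-EmptyFrom col _ e c≤h (≡.subst (h ≤_) (≡.sym l) h≤n) ,
        ≡.trans (length-glue col _ e) l

  concat-empty : ∀ {t : List (List A)} → All (_≡ []) t → concat t ≡ []
  concat-empty [] = ≡.refl
  concat-empty (≡.refl ∷ e) = concat-empty e

  concat-glue : ∀ (col : List A) t → EmptyFrom (length col) t → concat (glue col t) ↭ col ++ concat t
  concat-glue [] t e = ↭-refl
  concat-glue (a ∷ col) (r ∷ t) (skipRow e) = ↭.prep a
    (↭-trans (↭.++⁺ˡ r (concat-glue col t e)) (↭.shifts r col))

  concat-rows : ∀ {n h} (cols : List (List A)) → h ≤ n → Heights↓ h (map length cols) →
    concat (rows n cols) ↭ concat (reverse cols)
  concat-rows {n} [] h≤n H = ≡.subst (_↭ []) (≡.sym (concat-empty (replicate-empty n))) ↭-refl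
  concat-rows {n} {h} (col ∷ cols) h≤n (c≤h ∷ H) = begin
    concat (glue col (rows n cols)) ↭⟨ concat-glue col _ (proj₁ (rows-EmptyFrom cols (ℕ.≤-trans c≤h h≤n) H)) ⟩
    col ++ concat (rows n cols) ↭⟨ ↭.++⁺ˡ col (concat-rows cols (ℕ.≤-trans c≤h h≤n) H) ⟩
    col ++ concat (reverse cols) ↭⟨ ↭.++-comm col _ ⟩
    concat (reverse cols) ++ col ≡⟨ ≡.cong (concat (reverse cols) ++_) (++-identityʳ col) ⟨
    concat (reverse cols) ++ concat [ col ] ≡⟨ concat-++ (reverse cols) [ col ] ⟩
    concat (reverse cols ++ [ col ]) ≡⟨ ≡.cong concat (unfold-reverse col cols) ⟨
    concat (reverse (col ∷ cols)) ∎
    where open PermutationReasoning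

  column-empty : ∀ c {t : List (List A)} → All (_≡ []) t → column c t ≡ []
  column-empty c [] = ≡.refl
  column-empty zero (≡.refl ∷ e) = column-empty zero e
  column-empty (suc c) (≡.refl ∷ e) = column-empty (suc c) e

  column-zero-glue : ∀ (col : List A) t → EmptyFrom (length col) t → column 0 (glue col t) ≡ col
  column-zero-glue [] t (allEmpty e) = column-empty 0 e
  column-zero-glue (a ∷ col) (r ∷ t) (skipRow e) = ≡.cong (a ∷_) (column-zero-glue col t e)

  column-suc-glue : ∀ c (col : List A) t → EmptyFrom (length col) t →
    column (suc c) (glue col t) ≡ column c t
  column-suc-glue c [] t (allEmpty e) = ≡.trans (column-empty (suc c) e) (≡.sym (column-empty c e))
  column-suc-glue c (a ∷ col) (r ∷ t) (skipRow e) = ≡.cong (take 1 (drop c r) ++_) (column-suc-glue c col t e)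

readColumns : {A : Set} → ℕ → List (List A) → List A
readColumns w t = concatMap (λ c → column c t) (reverse (upTo w))

readColumns-glue : {A : Set} (w : ℕ) (col : List A) (t : List (List A)) → EmptyFrom (length col) t →
  readColumns (suc w) (glue col t) ≡ readColumns w t ++ col
readColumns-glue w col t e = begin
  concatMap f (reverse (upTo (suc w))) ≡⟨ ≡.cong (concatMap f) (reverse-upTo (suc w)) ⟩
  concatMap f (downFrom (suc w)) ≡⟨ ≡.cong (concatMap f) (downFrom-∷ʳ w) ⟨
  concatMap f (applyDownFrom suc w ++ [ 0 ]) ≡⟨ concatMap-++ f (applyDownFrom suc w) [ 0 ] ⟩
  concatMap f (applyDownFrom suc w) ++ (f 0 ++ []) ≡⟨ ≡.cong₂ _++_ init last ⟩
  concatMap (λ c → column c t) (reverse (upTo w)) ++ col ∎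
  where
  open ≡.≡-Reasoning
  f = λ c → column c (glue col t)
  last : f 0 ++ [] ≡ col
  last = ≡.trans (++-identityʳ _) (column-zero-glue col t e)
  init : concatMap f (applyDownFrom suc w) ≡ concatMap (λ c → column c t) (reverse (upTo w))
  init = begin
    concatMap f (applyDownFrom suc w) ≡⟨ ≡.cong (concatMap f) (map-downFrom suc w) ⟨
    concatMap f (map suc (downFrom w)) ≡⟨ ≡.cong concat (map-∘ (downFrom w)) ⟨
    concatMap (λ c → f (suc c)) (downFrom w) ≡⟨ concatMap-cong (λ c → column-suc-glue c col t e) (downFrom w) ⟩
    concatMap (λ c → column c t) (downFrom w) ≡⟨ ≡.cong (concatMap (λ c → column c t)) (reverse-upTo w) ⟨
    concatMap (λ c → column c t) (reverse (upTo w)) ∎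

readColumns-rows : {A : Set} {n h : ℕ} (cols : List (List A)) → h ≤ n → Heights↓ h (map length cols) →
  readColumns (length cols) (rows n cols) ≡ concat (reverse cols)
readColumns-rows [] h≤n H = ≡.refl
readColumns-rows {n = n} (col ∷ cols) h≤n (c≤h ∷ H) = begin
  readColumns (suc (length cols)) (glue col (rows n cols))
    ≡⟨ readColumns-glue (length cols) col _ (proj₁ (rows-EmptyFrom cols (ℕ.≤-trans c≤h h≤n) H)) ⟩
  readColumns (length cols) (rows n cols) ++ col ≡⟨ ≡.cong (_++ col) (readColumns-rows cols (ℕ.≤-trans c≤h h≤n) H) ⟩
  concat (reverse cols) ++ col ≡⟨ ≡.cong (concat (reverse cols) ++_) (++-identityʳ col) ⟨
  concat (reverse cols) ++ concat [ col ] ≡⟨ concat-++ (reverse cols) [ col ] ⟩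
  concat (reverse cols ++ [ col ]) ≡⟨ ≡.cong concat (unfold-reverse col cols) ⟨
  concat (reverse (col ∷ cols)) ∎
  where open ≡.≡-Reasoning

-- `width` looks at the first row only, so it counts the columns when each of them reaches that row.
width-rows : {A : Set} {n h : ℕ} (cols : List (List A)) → h ≤ suc n → Heights↓ h (map length cols) →
  All (1 ≤_) (map length cols) → width (rows (suc n) cols) ≡ length cols
width-rows [] h≤ H p = ≡.refl
width-rows {n = n} ((a ∷ col) ∷ cols) h≤ (c≤h ∷ H) (_ ∷ p)
  with rows (suc n) cols | proj₁ (rows-EmptyFrom cols (ℕ.≤-trans c≤h h≤) H)
     | width-rows cols (ℕ.≤-trans c≤h h≤) H p
... | r ∷ t | _ | IH = ≡.cong suc IH

leRows : List ℕ → List (List ℕ) → Bool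
leRows [] t = true
leRows (a ∷ col) [] = true
leRows (a ∷ col) (r ∷ t) = leHead a r ∧ leRows col t

strictBelow-[] : ∀ r → strictBelow r [] ≡ true
strictBelow-[] [] = ≡.refl
strictBelow-[] (_ ∷ _) = ≡.refl

weakRow-∷ : ∀ a r → weakRow (a ∷ r) ≡ leHead a r ∧ weakRow r
weakRow-∷ a [] = ≡.refl
weakRow-∷ a (b ∷ r) = ≡.refl

isSemistandard-glue : ∀ col t → EmptyFrom (length col) t →
  isSemistandard (glue col t) ≡ strictFrom 0 col ∧ (leRows col t ∧ isSemistandard t)
isSemistandard-glue [] t e = ≡.refl
isSemistandard-glue (a ∷ []) (r ∷ []) (skipRow e) =
  ≡.trans (weakRow-∷ a r) (≡.cong (_∧ weakRow r) (≡.sym (∧-identityʳ _)))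
-- The column ends in this row and the next row is empty, so the strict comparison with it is
-- vacuous both before and after gluing.
isSemistandard-glue (a ∷ []) (r ∷ .[] ∷ t) (skipRow (allEmpty (≡.refl ∷ e))) = ≡.trans
  (≡.cong (_∧ isSemistandard ([] ∷ t)) (weakRow-∷ a r))
  (≡.trans (solve 3 (λ p q s → (p :* q) :* s := (p :* con true) :* (q :* s)) ≡.refl (leHead a r) (weakRow r) _)
    (≡.cong (λ z → (leHead a r ∧ true) ∧ weakRow r ∧ z ∧ isSemistandard ([] ∷ t)) (≡.sym (strictBelow-[] r))))
  where open ∨-∧-Solver
isSemistandard-glue (a ∷ b ∷ col) (r ∷ l ∷ t) (skipRow e) = ≡.trans
  (≡.cong₂ (λ z z′ → z ∧ ((a <ᵇ b) ∧ strictBelow r l) ∧ z′) (weakRow-∷ a r) (isSemistandard-glue (b ∷ col) (l ∷ t) e))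
  (solve 8 (λ p wr q sb s p′ lr i →
      (p :* wr) :* ((q :* sb) :* (s :* ((p′ :* lr) :* i))) :=
      (q :* s) :* ((p :* (p′ :* lr)) :* (wr :* (sb :* i)))) ≡.refl
    (leHead a r) (weakRow r) (a <ᵇ b) (strictBelow r l) (strictFrom (suc b) col) (leHead b l) (leRows col t) _)
  where open ∨-∧-Solver

headColumn : {A : Set} → List (List A) → List A
headColumn [] = []
headColumn (col ∷ _) = col

leRows-empty : ∀ col {t} → All (_≡ []) t → leRows col t ≡ true
leRows-empty [] e = ≡.refl
leRows-empty (a ∷ col) [] = ≡.refl
leRows-empty (a ∷ col) (≡.refl ∷ e) = leRows-empty col e

leCol-[] : ∀ col → leCol col [] ≡ true
leCol-[] [] = ≡.refl
leCol-[] (a ∷ col) = leCol-[] col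

leRows-glue : ∀ col b t → EmptyFrom (length b) t → leRows col (glue b t) ≡ leCol col b
leRows-glue [] b t e = ≡.refl
leRows-glue (a ∷ col) [] t (allEmpty e) = ≡.trans (leRows-empty (a ∷ col) e) (≡.sym (leCol-[] col))
leRows-glue (a ∷ col) (b ∷ bs) (r ∷ t) (skipRow e) = ≡.cong ((a ≤ᵇ b) ∧_) (leRows-glue col bs t e)

leRows-rows : ∀ {n h} col cols → h ≤ n → Heights↓ h (map length cols) →
  leRows col (rows n cols) ≡ leCol col (headColumn cols)
leRows-rows {n} col [] h≤n H = ≡.trans (leRows-empty col (replicate-empty n)) (≡.sym (leCol-[] col))
leRows-rows col (b ∷ cols) h≤n (b≤h ∷ H) =
  leRows-glue col b _ (proj₁ (rows-EmptyFrom cols (ℕ.≤-trans b≤h h≤n) H))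

isSemistandard-empty : ∀ n → isSemistandard (replicate n []) ≡ true
isSemistandard-empty zero = ≡.refl
isSemistandard-empty (suc zero) = ≡.refl
isSemistandard-empty (suc (suc n)) = isSemistandard-empty (suc n)

Heights↓-weaken : ∀ {b b′ hs} → b ≤ b′ → Heights↓ b hs → Heights↓ b′ hs
Heights↓-weaken p [] = []
Heights↓-weaken p (q ∷ H) = ℕ.≤-trans q p ∷ H

Heights↓-suffix : ∀ {A : Set} {b} (W cs : List (List A)) → Heights↓ b (map length (W ʳ++ cs)) →
  Heights↓ b (map length cs)
Heights↓-suffix [] cs H = H
Heights↓-suffix (col ∷ W) cs H with Heights↓-suffix W (col ∷ cs) H
... | p ∷ H′ = Heights↓-weaken p H′

-- The accumulator cs holds the columns to the right of W, so its head is the column that bounds the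
-- first one of W.
isSemistandard-rows : ∀ {n} W cs → Heights↓ n (map length (W ʳ++ cs)) →
  isSemistandard (rows n (W ʳ++ cs)) ≡ semistandardFrom (headColumn cs) W ∧ isSemistandard (rows n cs)
isSemistandard-rows [] cs H = ≡.refl
isSemistandard-rows {n} (col ∷ W) cs H with Heights↓-suffix W (col ∷ cs) H
... | c≤n ∷ H′ = ≡.trans
  (isSemistandard-rows W (col ∷ cs) H)
  (≡.trans (≡.cong (semistandardFrom col W ∧_) step)
    (solve 4 (λ p q r s → p :* (q :* (r :* s)) := ((q :* r) :* p) :* s) ≡.refl
      (semistandardFrom col W) (strictFrom 0 col) (leCol col (headColumn cs)) _))
  where
  open ∨-∧-Solver
  step : isSemistandard (rows n (col ∷ cs)) ≡
    strictFrom 0 col ∧ (leCol col (headColumn cs) ∧ isSemistandard (rows n cs))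
  step = ≡.trans (isSemistandard-glue col _ (proj₁ (rows-EmptyFrom cs c≤n H′)))
    (≡.cong (λ z → strictFrom 0 col ∧ (z ∧ isSemistandard (rows n cs))) (leRows-rows col cs c≤n H′))

isSemistandard-reverse : ∀ {n} W → Heights↓ n (map length (reverse W)) →
  isSemistandard (rows n (reverse W)) ≡ semistandardFrom [] W
isSemistandard-reverse {n} W H = ≡.trans (isSemistandard-rows W [] H)
  (≡.trans (≡.cong (semistandardFrom [] W ∧_) (isSemistandard-empty n)) (∧-identityʳ _))

glue-map : ∀ {A B : Set} (f : A → B) col t → map (map f) (glue col t) ≡ glue (map f col) (map (map f) t)
glue-map f [] t = ≡.refl
glue-map f (a ∷ col) [] = ≡.refl
glue-map f (a ∷ col) (r ∷ t) = ≡.cong (_ ∷_) (glue-map f col t)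

rows-map : ∀ {A B : Set} (f : A → B) n cols → map (map f) (rows n cols) ≡ rows n (map (map f) cols)
rows-map f n [] = map-replicate (map f) n []
rows-map f n (col ∷ cols) = ≡.trans (glue-map f col (rows n cols)) (≡.cong (glue (map f col)) (rows-map f n cols))

unglue : ∀ {A : Set} ℓ (t : List (List A)) → Linked _≥_ ℓ → map length t ≡ ℓ →
  Σ (List A) λ col → Σ (List (List A)) λ t′ →
    t ≡ glue col t′ × length col ≡ positives ℓ × map length t′ ≡ map pred ℓ
unglue [] [] p ≡.refl = [] , [] , ≡.refl , ≡.refl , ≡.refl
unglue (zero ∷ ℓ) t p e = [] , t , ≡.refl , ≡.refl , ≡.trans e (≡.cong (0 ∷_) (≡.sym (partition-0 ℓ p)))
unglue (suc k ∷ ℓ) ((a ∷ r) ∷ t) p e with ∷-injective e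
... | e₁ , e₂ with unglue ℓ t (Linked.tail p) e₂
...   | col , t′ , ≡.refl , l , l′ =
        a ∷ col , r ∷ t′ , ≡.refl , ≡.cong suc l , ≡.cong₂ _∷_ (ℕ.suc-injective e₁) l′

lengths-0 : ∀ {A : Set} ℓ (t : List (List A)) → All (_≤ 0) ℓ → map length t ≡ ℓ → t ≡ replicate (length ℓ) []
lengths-0 [] [] _ e = ≡.refl
lengths-0 (.0 ∷ ℓ) ([] ∷ t) (z≤n ∷ a) e = ≡.cong ([] ∷_) (lengths-0 ℓ t a (proj₂ (∷-injective e)))
lengths-0 (.0 ∷ ℓ) ((x ∷ r) ∷ t) (z≤n ∷ a) e with ∷-injective e
... | () , _

pred-≤ : ∀ {m ℓ} → All (_≤ suc m) ℓ → All (_≤ m) (map pred ℓ)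
pred-≤ [] = []
pred-≤ (p ∷ a) = ℕ.pred-mono-≤ p ∷ pred-≤ a

-- Re-indexing sums does not suffice for the content of a tableau, which is read by rows: it has to
-- be compared with the column word for each single filling.
columnsOf : ∀ {A : Set} m ℓ (t : List (List A)) → Linked _≥_ ℓ → All (_≤ m) ℓ → map length t ≡ ℓ →
  Σ (List (List A)) λ cols → t ≡ rows (length ℓ) cols × map length cols ≡ columnHeights m ℓ
columnsOf zero ℓ t p a e = [] , lengths-0 ℓ t a e , ≡.refl
columnsOf (suc m) ℓ t p a e with unglue ℓ t p e
... | col , t′ , ≡.refl , l , l′ with columnsOf m (map pred ℓ) t′ (partition-pred p) (pred-≤ a) l′
...   | cols , ≡.refl , l″ = col ∷ cols ,
        ≡.cong (λ z → glue col (rows z cols)) (length-map pred ℓ) , ≡.cong₂ _∷_ l l″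

columnWord-rows : ∀ {n} (cols : List (List Entry)) → Heights↓ (suc n) (map length cols) →
  All (1 ≤_) (map length cols) → columnWord (rows (suc n) cols) ≡ concat (reverse cols)
columnWord-rows {n} cols H p = ≡.trans
  (≡.cong (λ w → readColumns w (rows (suc n) cols)) (width-rows cols ℕ.≤-refl H p))
  (readColumns-rows cols ℕ.≤-refl H)

columnWord-↭ : ∀ h ℓ (t : List (List Entry)) → Linked _≥_ (h ∷ ℓ) → map length t ≡ h ∷ ℓ →
  concat t ↭ columnWord t
columnWord-↭ h ℓ t p e with columnsOf h (h ∷ ℓ) t p (partition-≤ h ℓ p) e
... | cols , ≡.refl , l = ≡.subst (concat t ↭_) (≡.sym (columnWord-rows cols H P))
  (concat-rows cols ℕ.≤-refl H)
  where
  H = ≡.subst (Heights↓ _) (≡.sym l) (columnHeights-↓ h (h ∷ ℓ) (positives-length (h ∷ ℓ)))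
  P = ≡.subst (All (1 ≤_)) (≡.sym l) (columnHeights-positive h ℓ)

unbarredValues-↭ : ∀ {u v} → u ↭ v → unbarredValues u ↭ unbarredValues v
unbarredValues-↭ p = ↭.map⁺ proj₂ (↭.filter-↭ (λ e → T? (not (proj₁ e))) p)

incs-↭ : ∀ {n u v} (α : Vec ℕ n) → u ↭ v → incs u α ≡ incs v α
incs-↭ α ↭.refl = ≡.refl
incs-↭ α (↭.prep a p) = incs-↭ (inc a α) p
incs-↭ {v = _ ∷ _ ∷ v} α (↭.swap a b p) = ≡.trans (incs-↭ _ p) (≡.cong (incs v) (inc-comm b a α))
incs-↭ α (↭.trans p q) = ≡.trans (incs-↭ α p) (incs-↭ α q)

readingHeights : List ℕ → List ℕ
readingHeights [] = []
readingHeights (h ∷ ℓ) = reverse (columnHeights h (h ∷ ℓ))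

-- Sums and products over fillings, re-indexed by columns

module Transfer (R : CommutativeRing 0ℓ 0ℓ) where
  open CommutativeRing R renaming (_+_ to _+R_; _*_ to _*R_; -_ to -R_)
  open RingSums R
  open Relation.Binary.Reasoning.Setoid setoid
  open Algebra.Properties.CommutativeSemigroup *-commutativeSemigroup using (x∙yz≈y∙xz; interchange)

  -- By induction on the rows, the first entry of each row joins the column after the sums are
  -- exchanged. At a zero part of a partition all further parts are zero too, and `map pred` changes
  -- nothing.
  ∑-fillings-glue : ∀ {A : Set} ℓ (xs : List A) (f : List (List A) → Carrier) → Linked _≥_ ℓ →
    ∑ (fillings ℓ xs) f ≈ ∑ (sequenceL (replicate (positives ℓ) xs)) (λ col →
      ∑ (fillings (map pred ℓ) xs) (λ t → f (glue col t)))
  ∑-fillings-glue [] xs f p = sym (+-identityʳ _)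
  ∑-fillings-glue (zero ∷ ℓ) xs f p = sym (trans (+-identityʳ _)
    (reflexive (≡.cong (λ ℓ′ → ∑ (fillings (0 ∷ ℓ′) xs) f) (partition-0 ℓ p))))
  ∑-fillings-glue {A} (suc k ∷ ℓ) xs f p = begin
    ∑ (fillings (suc k ∷ ℓ) xs) f ≈⟨ ∑-sequenceL (sequenceL (replicate (suc k) xs)) (map (λ k → sequenceL (replicate k xs)) ℓ) f ⟩
    ∑ (sequenceL (replicate (suc k) xs)) (λ r → ∑ (fillings ℓ xs) (λ t → f (r ∷ t)))
      ≈⟨ ∑-sequenceL xs (replicate k xs) _ ⟩
    ∑ xs (λ a → ∑ rowsK (λ r → ∑ (fillings ℓ xs) (λ t → f ((a ∷ r) ∷ t))))
      ≈⟨ ∑-cong xs (λ a → ∑-cong rowsK (λ r → ∑-fillings-glue ℓ xs _ (Linked.tail p))) ⟩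
    ∑ xs (λ a → ∑ rowsK (λ r → ∑ cols (λ col → ∑ ts (λ t → f ((a ∷ r) ∷ glue col t)))))
      ≈⟨ ∑-cong xs (λ a → ∑-swap rowsK cols _) ⟩
    ∑ xs (λ a → ∑ cols (λ col → ∑ rowsK (λ r → ∑ ts (λ t → f ((a ∷ r) ∷ glue col t)))))
      ≈⟨ ∑-cong xs (λ a → ∑-cong cols (λ col → sym (∑-sequenceL rowsK (map (λ k → sequenceL (replicate k xs)) (map pred ℓ)) _))) ⟩
    ∑ xs (λ a → ∑ cols (λ col → ∑ (fillings (k ∷ map pred ℓ) xs) (λ t → f (glue (a ∷ col) t))))
      ≈⟨ ∑-sequenceL xs (replicate (positives ℓ) xs) _ ⟨
    ∑ (sequenceL (replicate (suc (positives ℓ)) xs)) (λ col →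
      ∑ (fillings (k ∷ map pred ℓ) xs) (λ t → f (glue col t))) ∎
    where
    rowsK cols ts : List _
    rowsK = sequenceL (replicate k xs)
    cols = sequenceL (replicate (positives ℓ) xs)
    ts = fillings (map pred ℓ) xs

  ∑-fillings-0 : ∀ {A : Set} ℓ (xs : List A) (f : List (List A) → Carrier) → All (_≤ 0) ℓ →
    ∑ (fillings ℓ xs) f ≈ f (replicate (length ℓ) [])
  ∑-fillings-0 [] xs f [] = +-identityʳ _
  ∑-fillings-0 (.0 ∷ ℓ) xs f (z≤n ∷ p) =
    trans (∑-sequenceL ([] ∷ []) (map (λ k → sequenceL (replicate k xs)) ℓ) f)
      (trans (+-identityʳ _) (∑-fillings-0 ℓ xs (λ t → f ([] ∷ t)) p))

  ∑-fillings-columns : ∀ {A : Set} m ℓ (xs : List A) (f : List (List A) → Carrier) →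
    Linked _≥_ ℓ → All (_≤ m) ℓ →
    ∑ (fillings ℓ xs) f ≈ ∑ (fillings (columnHeights m ℓ) xs) (λ cols → f (rows (length ℓ) cols))
  ∑-fillings-columns zero ℓ xs f p a = trans (∑-fillings-0 ℓ xs f a) (sym (+-identityʳ _))
  ∑-fillings-columns (suc m) ℓ xs f p a = begin
    ∑ (fillings ℓ xs) f ≈⟨ ∑-fillings-glue ℓ xs f p ⟩
    ∑ cols (λ col → ∑ (fillings (map pred ℓ) xs) (λ t → f (glue col t)))
      ≈⟨ ∑-cong cols (λ col → ∑-fillings-columns m (map pred ℓ) xs _ (partition-pred p) (pred-≤ a)) ⟩
    ∑ cols (λ col → ∑ rest (λ cs → f (glue col (rows (length (map pred ℓ)) cs))))
      ≈⟨ ∑-cong cols (λ col → ∑-cong rest (λ cs → reflexive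
           (≡.cong (λ n → f (glue col (rows n cs))) (length-map pred ℓ)))) ⟩
    ∑ cols (λ col → ∑ rest (λ cs → f (rows (length ℓ) (col ∷ cs))))
      ≈⟨ ∑-sequenceL cols (map (λ k → sequenceL (replicate k xs)) (columnHeights m (map pred ℓ))) _ ⟨
    ∑ (fillings (columnHeights (suc m) ℓ) xs) (λ cs → f (rows (length ℓ) cs)) ∎
    where
    cols rest : List _
    cols = sequenceL (replicate (positives ℓ) xs)
    rest = fillings (columnHeights m (map pred ℓ)) xs

  ∑-fillings-reading : ∀ {A : Set} h ℓ (xs : List A) (f : List (List A) → Carrier) →
    Linked _≥_ (h ∷ ℓ) →
    ∑ (fillings (h ∷ ℓ) xs) f ≈
    ∑ (fillings (readingHeights (h ∷ ℓ)) xs) (λ W → f (rows (suc (length ℓ)) (reverse W)))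
  ∑-fillings-reading h ℓ xs f p = begin
    ∑ (fillings (h ∷ ℓ) xs) f ≈⟨ ∑-fillings-columns h (h ∷ ℓ) xs f p (partition-≤ h ℓ p) ⟩
    ∑ (sequenceL (map F hs)) g ≈⟨ reflexive (≡.cong (λ xss → ∑ (sequenceL xss) g) eq) ⟩
    ∑ (sequenceL (map F (reverse hs) ʳ++ [])) g ≈⟨ ∑-sequenceL-ʳ++ (map F (reverse hs)) [] g ⟩
    ∑ (sequenceL (map F (reverse hs))) (λ s → g (s ʳ++ []) +R 0#)
      ≈⟨ ∑-cong (sequenceL (map F (reverse hs))) (λ s → +-identityʳ _) ⟩
    ∑ (sequenceL (map F (reverse hs))) (λ s → g (reverse s)) ∎
    where
    F = λ k → sequenceL (replicate k xs)
    hs = columnHeights h (h ∷ ℓ)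
    g = λ cols → f (rows (suc (length ℓ)) cols)
    eq : map F hs ≡ reverse (map F (reverse hs))
    eq = ≡.sym (≡.trans (≡.sym (reverse-map F (reverse hs))) (≡.cong (map F) (reverse-involutive hs)))

  rowProd : {A : Set} → (ℕ → ℕ → A → Carrier) → ℕ → ℕ → List A → Carrier
  rowProd g r c [] = 1#
  rowProd g r c (a ∷ w) = g r c a *R rowProd g r (suc c) w

  boxProd : {A : Set} → (ℕ → ℕ → A → Carrier) → ℕ → ℕ → List (List A) → Carrier
  boxProd g r c [] = 1#
  boxProd g r c (w ∷ t) = rowProd g r c w *R boxProd g (suc r) c t

  leftProd : {A : Set} → (ℕ → ℕ → A → Carrier) → ℕ → List (List A) → Carrier
  leftProd g c [] = 1#
  leftProd g c (col ∷ cols) = columnProd g 1 c col *R leftProd g (suc c) cols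

  boxProd-empty : ∀ {A : Set} (g : ℕ → ℕ → A → Carrier) r c {t} → All (_≡ []) t → boxProd g r c t ≈ 1#
  boxProd-empty g r c [] = refl
  boxProd-empty g r c (≡.refl ∷ e) = trans (*-identityˡ _) (boxProd-empty g (suc r) c e)

  boxProd-glue : ∀ {A : Set} (g : ℕ → ℕ → A → Carrier) r c col t → EmptyFrom (length col) t →
    boxProd g r c (glue col t) ≈ columnProd g r c col *R boxProd g r (suc c) t
  boxProd-glue g r c [] t (allEmpty e) =
    trans (boxProd-empty g r c e) (sym (trans (*-identityˡ _) (boxProd-empty g r (suc c) e)))
  boxProd-glue g r c (a ∷ col) (w ∷ t) (skipRow e) =
    trans (*-congˡ (boxProd-glue g (suc r) c col t e)) (interchange _ _ _ _)

  boxProd-rows : ∀ {A : Set} (g : ℕ → ℕ → A → Carrier) {n h} c cols → h ≤ n → Heights↓ h (map length cols) →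
    boxProd g 1 c (rows n cols) ≈ leftProd g c cols
  boxProd-rows g {n} c [] h≤n H = boxProd-empty g 1 c (replicate-empty n)
  boxProd-rows g c (col ∷ cols) h≤n (c≤h ∷ H) = trans
    (boxProd-glue g 1 c col _ (proj₁ (rows-EmptyFrom cols (ℕ.≤-trans c≤h h≤n) H)))
    (*-congˡ (boxProd-rows g (suc c) cols (ℕ.≤-trans c≤h h≤n) H))

  -- `leftProd` counts columns from the left, while `readingProd` derives the column number from how
  -- many columns are still to be read; the two numberings agree.
  leftProd-ʳ++ : ∀ {A : Set} (g : ℕ → ℕ → A → Carrier) W cs →
    leftProd g 1 (W ʳ++ cs) ≈ readingProd g W *R leftProd g (suc (length W)) cs
  leftProd-ʳ++ g [] cs = sym (*-identityˡ _)
  leftProd-ʳ++ g (col ∷ W) cs = trans (leftProd-ʳ++ g W (col ∷ cs))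
    (trans (x∙yz≈y∙xz _ _ _) (sym (*-assoc _ _ _)))

  boxProd-reverse : ∀ {A : Set} (g : ℕ → ℕ → A → Carrier) {n} W → Heights↓ n (map length (reverse W)) →
    boxProd g 1 1 (rows n (reverse W)) ≈ readingProd g W
  boxProd-reverse g W H = trans (boxProd-rows g 1 (reverse W) ℕ.≤-refl H)
    (trans (leftProd-ʳ++ g W []) (*-identityʳ _))

  module _ {V : Set} (ρ : V → Carrier) where
    eval-ΣP : ∀ {A : Set} (xs : List A) (f : A → Poly V) →
      ⟦ R ⟧ (ΣP (map f xs)) ρ ≈ ∑ xs (λ x → ⟦ R ⟧ (f x) ρ)
    eval-ΣP [] f = refl
    eval-ΣP (x ∷ xs) f = +-congˡ (eval-ΣP xs f)

    module _ {A : Set} (f : ℕ → ℕ → A → Poly V) (g : ℕ → ℕ → A → Carrier)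
        (e : ∀ r c a → ⟦ R ⟧ (f r c a) ρ ≈ g r c a) where
      eval-prodRow : ∀ r c w → ⟦ R ⟧ (prodRow f r c w) ρ ≈ rowProd g r c w
      eval-prodRow r c [] = refl
      eval-prodRow r c (a ∷ w) = *-cong (e r c a) (eval-prodRow r (suc c) w)

      eval-prodBoxes′ : ∀ r t → ⟦ R ⟧ (prodBoxes' f r t) ρ ≈ boxProd g r 1 t
      eval-prodBoxes′ r [] = refl
      eval-prodBoxes′ r (w ∷ t) = *-cong (eval-prodRow r 1 w) (eval-prodBoxes′ (suc r) t)

      eval-prodBoxes : ∀ t → ⟦ R ⟧ (prodBoxes f t) ρ ≈ boxProd g 1 1 t
      eval-prodBoxes = eval-prodBoxes′ 1

module _ {A : Set} {xs : List A} (h : ℕ) (ℓ : List ℕ) {W : List (List A)}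
    (W∈ : W ∈ fillings (readingHeights (h ∷ ℓ)) xs) where
  reading-lengths : map length (reverse W) ≡ columnHeights h (h ∷ ℓ)
  reading-lengths = ≡.trans (reverse-map length W) (≡.trans
    (≡.cong reverse (proj₁ (∈-fillings⁻ (readingHeights (h ∷ ℓ)) W∈)))
    (reverse-involutive (columnHeights h (h ∷ ℓ))))

  reading-↓ : Heights↓ (suc (length ℓ)) (map length (reverse W))
  reading-↓ = ≡.subst (Heights↓ _) (≡.sym reading-lengths)
    (columnHeights-↓ h (h ∷ ℓ) (positives-length (h ∷ ℓ)))

  reading-positive : All (1 ≤_) (map length (reverse W))
  reading-positive = ≡.subst (All (1 ≤_)) (≡.sym reading-lengths) (columnHeights-positive h ℓ)

readingHeights-↑ : ∀ ℓ → Heights 0 (readingHeights ℓ)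
readingHeights-↑ [] = []
readingHeights-↑ (h ∷ ℓ) = reverse-heights (columnHeights h (h ∷ ℓ)) []
  (columnHeights-↓ h (h ∷ ℓ) (positives-length (h ∷ ℓ))) (λ _ → [])

module TableauExpansion (Q : CommutativeRing 0ℓ 0ℓ) (xs : List ℕ)
    (x Y : ℕ → CommutativeRing.Carrier Q) where
  open CommutativeRing Q renaming (_+_ to _+q_; _*_ to _*q_; -_ to -q_)
  open RingSums Q
  open Transfer Q
  open ColumnSums Q xs x Y
  open Relation.Binary.Reasoning.Setoid setoid

  columnSum-expand : ∀ c h r lo b g → columnSum c h r lo b g ≈
    ∑ (sequenceL (replicate h xs)) (λ col → (strictFrom lo col ∧ leCol col b) ▹
      columnProd weight r c col *q g col)
  columnSum-expand c zero r lo b g = sym (trans (+-identityʳ _) (trans (▹-true ≡.refl) (*-identityˡ _)))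
  columnSum-expand c (suc h) r lo b g = begin
    columnSum c (suc h) r lo b g
      ≈⟨ ∑-cong xs (λ a → ▹-cong _ (λ _ → *-congˡ (columnSum-expand c h (suc r) (suc a) (drop 1 b) (λ v → g (a ∷ v))))) ⟩
    ∑ xs (λ a → ((lo ≤ᵇ a) ∧ leHead a b) ▹ weight r c a *q ∑ cols (part a))
      ≈⟨ ∑-cong xs (λ a → trans (▹-cong _ (λ _ → ∑-*ˡ cols _ _)) (trans (∑-▹ cols _ _)
           (∑-cong cols (λ col → sym (total-∷ a col))))) ⟩
    ∑ xs (λ a → ∑ cols (λ col → total (a ∷ col))) ≈⟨ ∑-sequenceL xs (replicate h xs) total ⟨
    ∑ (sequenceL (replicate (suc h) xs)) total ∎
    where
    cols = sequenceL (replicate h xs)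
    part : ℕ → List ℕ → Carrier
    part a col = (strictFrom (suc a) col ∧ leCol col (drop 1 b)) ▹ columnProd weight (suc r) c col *q g (a ∷ col)
    total : List ℕ → Carrier
    total col = (strictFrom lo col ∧ leCol col b) ▹ columnProd weight r c col *q g col
    total-∷ : ∀ a col → total (a ∷ col) ≈ (((lo ≤ᵇ a) ∧ leHead a b) ▹ weight r c a *q part a col)
    total-∷ a col = begin
      total (a ∷ col) ≈⟨ ▹-congˡ (∧-interchange (lo ≤ᵇ a) _ _ _) ⟩
      _ ≈⟨ ▹-∧ _ _ ⟩
      _ ≈⟨ ▹-cong _ (λ _ → trans (▹-cong _ (λ _ → *-assoc _ _ _)) (sym (▹-*ʳ _ _))) ⟩
      _ ∎

  tableauSum-expand : ∀ hs b → tableauSum hs b ≈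
    ∑ (fillings hs xs) (λ W → semistandardFrom b W ▹ readingProd weight W)
  tableauSum-expand [] b = sym (trans (+-identityʳ _) (▹-true ≡.refl))
  tableauSum-expand (h ∷ hs) b = begin
    tableauSum (h ∷ hs) b ≈⟨ columnSum-expand _ h 1 0 b (tableauSum hs) ⟩
    ∑ cols (λ col → good col ▹ columnProd weight 1 (suc (length hs)) col *q tableauSum hs col)
      ≈⟨ ∑-cong cols (λ col → ▹-cong _ (λ _ → trans (*-congˡ (tableauSum-expand hs col)) (∑-*ˡ (fillings hs xs) _ _))) ⟩
    ∑ cols (λ col → good col ▹ ∑ (fillings hs xs) (λ W →
        columnProd weight 1 (suc (length hs)) col *q (semistandardFrom col W ▹ readingProd weight W)))
      ≈⟨ ∑-cong cols (λ col → ▹-cong _ (λ _ → ∑-cong∈ (fillings hs xs) (λ W W∈ → trans (▹-*ʳ _ _)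
           (▹-cong _ (λ _ → *-congʳ (reflexive (≡.cong (λ m → columnProd weight 1 (suc m) col) (lengths W W∈)))))))) ⟩
    ∑ cols (λ col → good col ▹ ∑ (fillings hs xs) (λ W → semistandardFrom col W ▹ readingProd weight (col ∷ W)))
      ≈⟨ ∑-cong cols (λ col → trans (∑-▹ (fillings hs xs) _ _)
           (∑-cong (fillings hs xs) (λ W → sym (▹-∧ (good col) (semistandardFrom col W))))) ⟩
    ∑ cols (λ col → ∑ (fillings hs xs) (λ W → total (col ∷ W)))
      ≈⟨ ∑-sequenceL cols (map (λ k → sequenceL (replicate k xs)) hs) total ⟨
    ∑ (fillings (h ∷ hs) xs) total ∎
    where
    cols = sequenceL (replicate h xs)
    good : List ℕ → Bool
    good col = strictFrom 0 col ∧ leCol col b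
    total : List (List ℕ) → Carrier
    total W = semistandardFrom b W ▹ readingProd weight W
    lengths : ∀ W → W ∈ fillings hs xs → length hs ≡ length W
    lengths W W∈ = ≡.trans (≡.cong length (≡.sym (proj₁ (∈-fillings⁻ hs W∈)))) (length-map length W)

  module _ {V : Set} (ρ : V → Carrier) (f : ℕ → ℕ → ℕ → Poly V)
      (e : ∀ r c a → ⟦ Q ⟧ (f r c a) ρ ≈ weight r c a) where
    eval-semistandard : ∀ h ℓ → Linked _≥_ (h ∷ ℓ) →
      ∑ (fillings (h ∷ ℓ) xs) (λ t → isSemistandard t ▹ ⟦ Q ⟧ (prodBoxes f t) ρ) ≈
      tableauSum (readingHeights (h ∷ ℓ)) []
    eval-semistandard h ℓ p = begin
      ∑ (fillings (h ∷ ℓ) xs) (λ t → isSemistandard t ▹ ⟦ Q ⟧ (prodBoxes f t) ρ)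
        ≈⟨ ∑-fillings-reading h ℓ xs _ p ⟩
      ∑ Ws (λ W → isSemistandard (rows n (reverse W)) ▹ ⟦ Q ⟧ (prodBoxes f (rows n (reverse W))) ρ)
        ≈⟨ ∑-cong∈ Ws (λ W W∈ → trans (▹-congˡ (isSemistandard-reverse W (reading-↓ h ℓ W∈)))
             (▹-cong _ (λ _ → trans (eval-prodBoxes ρ f weight e (rows n (reverse W)))
               (boxProd-reverse weight W (reading-↓ h ℓ W∈))))) ⟩
      ∑ Ws (λ W → semistandardFrom [] W ▹ readingProd weight W)
        ≈⟨ tableauSum-expand (readingHeights (h ∷ ℓ)) [] ⟨
      tableauSum (readingHeights (h ∷ ℓ)) [] ∎
      where
      n = suc (length ℓ)
      Ws = fillings (readingHeights (h ∷ ℓ)) xs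

-- Products of factorial Schur functions

module Diagrams (R : CommutativeRing 0ℓ 0ℓ) (m : ℕ) (ρ : YVar → CommutativeRing.Carrier R) where
  n : ℕ
  n = suc m

  open CommutativeRing R renaming (_+_ to _+R_; _*_ to _*R_; -_ to -R_)
  open RingSums R
  open Operators R n
  open Relation.Binary.Reasoning.Setoid setoid
  module RT = Transfer R
  module QT = Transfer operatorRing
  module Q = CommutativeRing operatorRing

  ρQ : Var → Operator
  ρQ (xv a) = shift a
  ρQ (yv i j) = scalar (ρ (i , j))

  evalQ : Poly Var → Operator
  evalQ p = ⟦ operatorRing ⟧ p ρQ

  module _ (i : ℕ) where
    open Expansion R n (λ j → ρ (i , j)) public
    open ColumnSums operatorRing (range1 n) shift (λ j → scalar (ρ (i , j))) public

  E : List Entry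
  E = barredEntries n

  barPoly : ℕ → List (List Entry) → Poly YVar
  barPoly i = prodBoxes (λ r c e → if proj₁ e then var (i , (proj₂ e + c) ∸ r) else 𝟙)

  eval-factorialSchur : ∀ i (λ' : Vec ℕ n) → IsPartition λ' →
    evalQ (factorialSchur i λ') Q.≈ tableauSum i (readingHeights (toList λ')) []
  eval-factorialSchur i (h ∷ v) p = Q.trans
    (QT.eval-ΣP ρQ (SSYT (h ∷ v)) _)
    (Q.trans (QS.∑-filter isSemistandard (fillings (h ∷ toList v) (range1 n)) _)
      (TableauExpansion.eval-semistandard operatorRing (range1 n) shift (λ j → scalar (ρ (i , j))) ρQ _
        (λ r c a → Q.refl) h (toList v) p))
    where module QS = RingSums operatorRing

  -- Nothing bounds the rightmost column of a full diagram, and the empty bound is balanced for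
  -- every k.
  factorialSchur-alternating : ∀ i (λ' : Vec ℕ n) → IsPartition λ' → ∀ {k} → ConsecutiveIn k (range1 n) →
    PreservesAlternating k (evalQ (factorialSchur i λ'))
  factorialSchur-alternating i λ' p {k} c = Symmetry.SymmetricPredicate.resp
    (preservesAlternating k c (λ j → ρ (i , j)))
    (Q.sym (eval-factorialSchur i λ' p))
    (tableauSum-alternating i (readingHeights (toList λ')) c (readingHeights-↑ (toList λ')) (high []))

  act-factorialSchur : ∀ i (λ' : Vec ℕ n) → IsPartition λ' → ∀ {ψ} α → AllAlternating i ψ →
    decreasing α ≡ true → act (evalQ (factorialSchur i λ')) ψ α ≈
    ∑ (fillings (toList λ') E) (λ t →
      (isSemistandard (values t) ∧ yamanouchiFrom α (unbarredValues (columnWord t))) ▹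
        ⟦ R ⟧ (barPoly i t) ρ *R ψ (incs (unbarredValues (columnWord t)) α))
  act-factorialSchur i (h ∷ v) p {ψ} α alt d = begin
    act (evalQ (factorialSchur i (h ∷ v))) ψ α ≈⟨ at (eval-factorialSchur i (h ∷ v) p) ψ α ⟩
    act (tableauSum i hs []) ψ α ≈⟨ act-tableauSum i hs [] α alt d (readingHeights-↑ (h ∷ ℓ)) ⟩
    ∑ (fillings hs E) (λ W → (semistandardFrom [] (map vals W) ∧ yamanouchiFrom α (word i W)) ▹
        readingProd (barWeight i) W *R ψ (incs (word i W) α))
      ≈⟨ ∑-cong∈ (fillings hs E) (λ W W∈ → same W W∈) ⟩
    ∑ (fillings hs E) (λ W → total (rows (suc (length ℓ)) (reverse W)))
      ≈⟨ RT.∑-fillings-reading h ℓ E total p ⟨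
    ∑ (fillings (h ∷ ℓ) E) total ∎
    where
    ℓ = toList v
    hs = readingHeights (h ∷ ℓ)
    total : List (List Entry) → Carrier
    total t = (isSemistandard (values t) ∧ yamanouchiFrom α (unbarredValues (columnWord t))) ▹
        ⟦ R ⟧ (barPoly i t) ρ *R ψ (incs (unbarredValues (columnWord t)) α)
    same : ∀ W → W ∈ fillings hs E →
      ((semistandardFrom [] (map vals W) ∧ yamanouchiFrom α (word i W)) ▹
        readingProd (barWeight i) W *R ψ (incs (word i W) α)) ≈ total (rows (suc (length ℓ)) (reverse W))
    same W W∈ = trans (▹-congˡ (≡.cong₂ _∧_ (≡.sym semi) (≡.cong (yamanouchiFrom α) (≡.sym w))))
      (▹-cong _ (λ _ → *-cong (sym weights) (reflexive (≡.cong (λ u → ψ (incs u α)) (≡.sym w)))))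
      where
      t = rows (suc (length ℓ)) (reverse W)
      H = reading-↓ h ℓ W∈
      w : unbarredValues (columnWord t) ≡ word i W
      w = ≡.cong unbarredValues (≡.trans (columnWord-rows (reverse W) H (reading-positive h ℓ W∈))
        (≡.cong concat (reverse-involutive W)))
      lens : map length (reverse (map vals W)) ≡ map length (reverse W)
      lens = ≡.trans (≡.cong (map length) (≡.sym (reverse-map vals W))) (map-lengths (reverse W))
        where
        map-lengths : ∀ cols → map length (map vals cols) ≡ map length cols
        map-lengths [] = ≡.refl
        map-lengths (col ∷ cols) = ≡.cong₂ _∷_ (length-map proj₂ col) (map-lengths cols)
      semi : isSemistandard (values t) ≡ semistandardFrom [] (map vals W)
      semi = ≡.trans (≡.cong isSemistandard (≡.trans (rows-map proj₂ _ (reverse W))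
          (≡.cong (rows _) (reverse-map vals W))))
        (isSemistandard-reverse (map vals W) (≡.subst (Heights↓ _) (≡.sym lens) H))
      weights : ⟦ R ⟧ (barPoly i t) ρ ≈ readingProd (barWeight i) W
      weights = trans (RT.eval-prodBoxes ρ _ (barWeight i) weight-eq t) (RT.boxProd-reverse (barWeight i) W H)
        where
        weight-eq : ∀ r c e → ⟦ R ⟧ (if proj₁ e then var (i , (proj₂ e + c) ∸ r) else 𝟙) ρ ≈ barWeight i r c e
        weight-eq r c (true , a) = refl
        weight-eq r c (false , a) = refl

  indexedFrom : {A : Set} → ℕ → List A → List (ℕ × A)
  indexedFrom i xs = zip (upFrom i (length xs)) xs

  productFrom : ℕ → List (Vec ℕ n) → Poly Var
  productFrom i Λ = ΠP (map (λ iλ → factorialSchur (proj₁ iλ) (proj₂ iλ)) (indexedFrom i Λ))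

  barProductFrom : ℕ → List (List (List Entry)) → Poly YVar
  barProductFrom i T = ΠP (map (λ it → barPoly (proj₁ it) (proj₂ it)) (indexedFrom i T))

  product-alternating : ∀ i Λ → All IsPartition Λ → ∀ {k} → ConsecutiveIn k (range1 n) →
    PreservesAlternating k (evalQ (productFrom i Λ))
  product-alternating i [] [] c A = A
  product-alternating i (λ' ∷ Λ) (p ∷ ps) c A =
    factorialSchur-alternating i λ' p c (product-alternating (suc i) Λ ps c A)

  allSemistandard : List (List (List Entry)) → Bool
  allSemistandard = all (λ t → isSemistandard (values t))

  -- The first factor is expanded first, in agreement with the order of the column word. It meets ψ
  -- as already transformed by the remaining factors, which is still alternating by their symmetry;
  -- the exponents it leaves behind are decreasing, as the next factor requires.
  act-product : ∀ i Λ → All IsPartition Λ → ∀ {ψ} α → AllAlternating 0 ψ → decreasing α ≡ true →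
    act (evalQ (productFrom i Λ)) ψ α ≈
    ∑ (sequenceL (map (λ λ' → fillings (toList λ') E) Λ)) (λ T →
      (allSemistandard T ∧ yamanouchiFrom α (unbarredColumnWord T)) ▹
        ⟦ R ⟧ (barProductFrom i T) ρ *R ψ (incs (unbarredColumnWord T) α))
  act-product i [] [] α alt d = sym (trans (+-identityʳ _) (trans (▹-true ≡.refl) (*-identityˡ _)))
  act-product i (λ' ∷ Λ) (p ∷ ps) {ψ} α alt d = begin
    act (evalQ (factorialSchur i λ')) (act (evalQ (productFrom (suc i) Λ)) ψ) α
      ≈⟨ act-factorialSchur i λ' p α
           (λ s → product-alternating (suc i) Λ ps (Swap-consecutive s) (alt s)) d ⟩
    ∑ (fillings (toList λ') E) (λ t → good t ▹ ⟦ R ⟧ (barPoly i t) ρ *R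
        act (evalQ (productFrom (suc i) Λ)) ψ (after t))
      ≈⟨ ∑-cong (fillings (toList λ') E) (λ t → ▹-cong _ (λ g → *-congˡ
           (act-product (suc i) Λ ps (after t) alt
             (yamanouchiFrom⇒decreasing α (letters t) d (proj₂ (∧-true {isSemistandard (values t)} g)))))) ⟩
    ∑ (fillings (toList λ') E) (λ t → good t ▹ ⟦ R ⟧ (barPoly i t) ρ *R ∑ Ts (part t))
      ≈⟨ ∑-cong (fillings (toList λ') E) (λ t → trans (▹-cong _ (λ _ → ∑-*ˡ Ts _ _))
           (trans (∑-▹ Ts _ _) (∑-cong Ts (λ T → join t T)))) ⟩
    ∑ (fillings (toList λ') E) (λ t → ∑ Ts (λ T → total (t ∷ T)))
      ≈⟨ ∑-sequenceL (fillings (toList λ') E) (map (λ λ' → fillings (toList λ') E) Λ) total ⟨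
    ∑ (sequenceL (map (λ λ' → fillings (toList λ') E) (λ' ∷ Λ))) total ∎
    where
    Ts = sequenceL (map (λ λ' → fillings (toList λ') E) Λ)
    letters : List (List Entry) → List ℕ
    letters t = unbarredValues (columnWord t)
    good : List (List Entry) → Bool
    good t = isSemistandard (values t) ∧ yamanouchiFrom α (letters t)
    after : List (List Entry) → Vec ℕ n
    after t = incs (letters t) α
    rest : List (List Entry) → List (List (List Entry)) → Bool
    rest t T = allSemistandard T ∧ yamanouchiFrom (after t) (unbarredColumnWord T)
    part : List (List Entry) → List (List (List Entry)) → Carrier
    part t T = rest t T ▹ ⟦ R ⟧ (barProductFrom (suc i) T) ρ *R ψ (incs (unbarredColumnWord T) (after t))
    total : List (List (List Entry)) → Carrier
    total T = (allSemistandard T ∧ yamanouchiFrom α (unbarredColumnWord T)) ▹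
        ⟦ R ⟧ (barProductFrom i T) ρ *R ψ (incs (unbarredColumnWord T) α)
    join : ∀ t T → (good t ▹ ⟦ R ⟧ (barPoly i t) ρ *R part t T) ≈ total (t ∷ T)
    join t T = begin
      (good t ▹ ⟦ R ⟧ (barPoly i t) ρ *R part t T) ≈⟨ ▹-cong _ (λ _ → ▹-*ʳ _ _) ⟩
      _ ≈⟨ ▹-∧ _ _ ⟨
      _ ≈⟨ ▹-congˡ (≡.trans (∧-interchange (isSemistandard (values t)) _ _ _)
             (≡.cong (allSemistandard (t ∷ T) ∧_) (≡.sym
               (≡.trans (≡.cong (yamanouchiFrom α) split) (yamanouchiFrom-++ (letters t) _ α))))) ⟩
      _ ≈⟨ ▹-cong _ (λ _ → trans (sym (*-assoc _ _ _)) (*-congˡ (reflexive (≡.cong ψ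
             (≡.sym (≡.trans (≡.cong (λ u → incs u α) split) (incs-++ (letters t) _ α))))))) ⟩
      total (t ∷ T) ∎
      where
      split : unbarredColumnWord (t ∷ T) ≡ letters t ++ unbarredColumnWord T
      split = unbarredValues-++ (columnWord t) _

-- The Yamanouchi condition in terms of exponents

staircase : ∀ n → Vec ℕ n
staircase zero = []
staircase (suc n) = suc n ∷ staircase n

decreasing-staircase+ : ∀ {n} (μ : Vec ℕ n) → IsPartition μ → decreasing (zipWith _+_ (staircase n) μ) ≡ true
decreasing-staircase+ [] p = ≡.refl
decreasing-staircase+ (x ∷ []) p = ≡.refl
decreasing-staircase+ {suc (suc n)} (x ∷ y ∷ μ) (x≥y ∷ p) = ≡.cong₂ _∧_
  (≤⇒≤ᵇ≡true (s≤s (s≤s (ℕ.+-monoʳ-≤ n x≥y)))) (decreasing-staircase+ (y ∷ μ) p)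

decreasing-staircase : ∀ n → decreasing (staircase n) ≡ true
decreasing-staircase zero = ≡.refl
decreasing-staircase (suc zero) = ≡.refl
decreasing-staircase (suc (suc n)) = ≡.cong₂ _∧_ (≤⇒≤ᵇ≡true (ℕ.≤-refl {suc (suc n)})) (decreasing-staircase (suc n))

zipWith-+-cancelˡ : ∀ {n} (α μ ν : Vec ℕ n) → zipWith _+_ α μ ≡ zipWith _+_ α ν → μ ≡ ν
zipWith-+-cancelˡ [] [] [] e = ≡.refl
zipWith-+-cancelˡ (a ∷ α) (x ∷ μ) (y ∷ ν) e with Vec.∷-injective e
... | e₁ , e₂ = ≡.cong₂ _∷_ (ℕ.+-cancelˡ-≡ a x y e₁) (zipWith-+-cancelˡ α μ ν e₂)

count-hit : ∀ k w → count k (k ∷ w) ≡ suc (count k w)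
count-hit k w rewrite T⇒≡true (ℕ.≡⇒≡ᵇ k k ≡.refl) = ≡.refl

count-miss : ∀ {a k} w → a ≢ k → count k (a ∷ w) ≡ count k w
count-miss {a} {k} w a≢k with a ≡ᵇ k in e
... | true = ⊥-elim (a≢k (ℕ.≡ᵇ⇒≡ a k (≡true⇒T e)))
... | false = ≡.refl

count-absent : ∀ {k} w → All (_< k) w → count k w ≡ 0
count-absent [] [] = ≡.refl
count-absent (a ∷ w) (a<k ∷ as) = ≡.trans (count-miss w (ℕ.<⇒≢ a<k)) (count-absent w as)

counts : ℕ → (n : ℕ) → List ℕ → Vec ℕ n
counts i zero w = []
counts i (suc n) w = count i w ∷ counts (suc i) n w

counts-skip : ∀ {a} i n w → a < i → counts i n (a ∷ w) ≡ counts i n w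
counts-skip i zero w a<i = ≡.refl
counts-skip i (suc n) w a<i =
  ≡.cong₂ _∷_ (count-miss w (ℕ.<⇒≢ a<i)) (counts-skip (suc i) n w (ℕ.m<n⇒m<1+n a<i))

counts-inc : ∀ j i {n} (α : Vec ℕ n) w →
  zipWith _+_ (inc (suc j) α) (counts i n w) ≡ zipWith _+_ α (counts i n ((i + j) ∷ w))
counts-inc j i [] w = ≡.refl
counts-inc zero i {suc n} (x ∷ α) w rewrite ℕ.+-identityʳ i = ≡.cong₂ _∷_
  (≡.trans (≡.sym (ℕ.+-suc x _)) (≡.cong (x +_) (≡.sym (count-hit i w))))
  (≡.cong (zipWith _+_ α) (≡.sym (counts-skip (suc i) n w (ℕ.n<1+n i))))
counts-inc (suc j) i {suc n} (x ∷ α) w rewrite ℕ.+-suc i j = ≡.cong₂ _∷_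
  (≡.cong (x +_) (≡.sym (count-miss w (ℕ.>⇒≢ (s≤s (ℕ.m≤m+n i j))))))
  (counts-inc j (suc i) α w)

counts-[] : ∀ i n (α : Vec ℕ n) → zipWith _+_ α (counts i n []) ≡ α
counts-[] i zero [] = ≡.refl
counts-[] i (suc n) (x ∷ α) = ≡.cong₂ _∷_ (ℕ.+-identityʳ x) (counts-[] (suc i) n α)

incs-counts : ∀ {n} w (α : Vec ℕ n) → incs w α ≡ zipWith _+_ α (counts 1 n w)
incs-counts {n} [] α = ≡.sym (counts-[] 1 n α)
incs-counts {n} (zero ∷ w) α = ≡.trans (incs-counts w α)
  (≡.cong (zipWith _+_ α) (≡.sym (counts-skip 1 n w (s≤s z≤n))))
incs-counts (suc a ∷ w) α = ≡.trans (incs-counts w (inc (suc a) α)) (counts-inc a 1 α w)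

counts-↭ : ∀ {u v} i n → u ↭ v → counts i n u ≡ counts i n v
counts-↭ i zero p = ≡.refl
counts-↭ i (suc n) p = ≡.cong₂ _∷_ (↭.↭-length (↭.filter-↭ (λ a → T? (a ≡ᵇ i)) p)) (counts-↭ (suc i) n p)

toList-counts : ∀ i n w → toList (counts i n w) ≡ map (λ k → count k w) (upFrom i n)
toList-counts i zero w = ≡.refl
toList-counts i (suc n) w = ≡.cong (count i w ∷_) (toList-counts (suc i) n w)

eqListℕ⇒≡ : ∀ u v → eqListℕ u v ≡ true → u ≡ v
eqListℕ⇒≡ [] [] e = ≡.refl
eqListℕ⇒≡ (a ∷ u) (b ∷ v) e = ≡.cong₂ _∷_ (ℕ.≡ᵇ⇒≡ a b (≡true⇒T (proj₁ (∧-true e))))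
  (eqListℕ⇒≡ u v (proj₂ (∧-true {a ≡ᵇ b} e)))

eqListℕ-refl : ∀ u → eqListℕ u u ≡ true
eqListℕ-refl [] = ≡.refl
eqListℕ-refl (a ∷ u) = ≡.cong₂ _∧_ (T⇒≡true (ℕ.≡⇒≡ᵇ a a ≡.refl)) (eqListℕ-refl u)

-- The counts of 1, …, n determine those of all letters ≤ n, so the last comparison, with
-- the letter n + 1, always holds.
decreasing-counts : ∀ i n w → All (_< i + n) w →
  all (λ k → count (suc k) w ≤ᵇ count k w) (upFrom i n) ≡ decreasing (zipWith _+_ (staircase n) (counts i n w))
decreasing-counts i zero w a = ≡.refl
decreasing-counts i (suc zero) w a rewrite count-absent w (≡.subst (λ m → All (_< m) w) (ℕ.+-comm i 1) a) = ≡.refl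
decreasing-counts i (suc (suc n)) w a = ≡.cong₂ _∧_
  (Bool-ext
    (λ t → ℕ.≤⇒≤ᵇ (s≤s (s≤s (ℕ.+-monoʳ-≤ n (ℕ.≤ᵇ⇒≤ (count (suc i) w) _ t)))))
    (λ t → ℕ.≤⇒≤ᵇ (ℕ.+-cancelˡ-≤ n _ _ (s≤s⁻¹ (s≤s⁻¹ (ℕ.≤ᵇ⇒≤ (suc (suc n) + count (suc i) w) _ t))))))
  (decreasing-counts (suc i) (suc n) w (≡.subst (λ m → All (_< m) w) (ℕ.+-suc i (suc n)) a))

-- The empty prefix accounts for `decreasing α`, which `yamanouchiFrom` does not test.
all-inits : ∀ {n m} (Q : List ℕ → Bool) (α : Vec ℕ n) w → All (_≤ m) w →
  (∀ p → All (_≤ m) p → Q p ≡ decreasing (incs p α)) →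
  all Q (inits w) ≡ decreasing α ∧ yamanouchiFrom α w
all-inits Q α [] a e = ≡.cong (_∧ true) (e [] [])
all-inits Q α (b ∷ w) (b≤m ∷ a) e = ≡.cong₂ _∧_ (e [] [])
  (≡.trans (≡.cong and (≡.sym (map-∘ (inits w))))
    (all-inits (λ p → Q (b ∷ p)) (inc b α) w a (λ p a′ → e (b ∷ p) (b≤m ∷ a′))))

isYamanouchi≡yamanouchiFrom : ∀ n w → All (_≤ n) w → isYamanouchi n w ≡ yamanouchiFrom (staircase n) w
isYamanouchi≡yamanouchiFrom n w a = ≡.trans
  (all-inits _ (staircase n) w a (λ p a′ → ≡.trans
    (≡.cong (all (λ k → count (suc k) p ≤ᵇ count k p)) (range1≡upFrom n))
    (≡.trans (decreasing-counts 1 n p (All.map s≤s a′))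
      (≡.cong decreasing (≡.sym (incs-counts p (staircase n)))))))
  (≡.cong (_∧ yamanouchiFrom (staircase n) w) (decreasing-staircase n))

-- Schur functions

-- After the first i entries the steps down are exactly 1. Hence raising a later entry is harmless
-- at the first position of this stretch and produces a tie at any other.
data StairFrom : ∀ {n} → ℕ → Vec ℕ n → Set where
  [] : ∀ {i} → StairFrom i []
  skip : ∀ {n i x} {α : Vec ℕ n} → StairFrom i α → StairFrom (suc i) (x ∷ α)
  [-] : ∀ {x} → StairFrom 0 (x ∷ [])
  step : ∀ {n y} {α : Vec ℕ n} → StairFrom 0 (y ∷ α) → StairFrom 0 (suc y ∷ y ∷ α)

staircase-StairFrom : ∀ n → StairFrom 0 (staircase n)
staircase-StairFrom zero = []
staircase-StairFrom (suc zero) = [-]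
staircase-StairFrom (suc (suc n)) = step (staircase-StairFrom (suc n))

StairFrom-inc-before : ∀ {n i m} {α : Vec ℕ n} → i < m → StairFrom m α → StairFrom m (inc (suc i) α)
StairFrom-inc-before i<m [] = []
StairFrom-inc-before {i = zero} i<m (skip f) = skip f
StairFrom-inc-before {i = suc i} (s≤s i<m) (skip f) = skip (StairFrom-inc-before i<m f)

StairFrom-inc-at : ∀ {n i} {α : Vec ℕ n} → StairFrom i α → StairFrom (suc i) (inc (suc i) α)
StairFrom-inc-at [] = []
StairFrom-inc-at (skip f) = skip (StairFrom-inc-at f)
StairFrom-inc-at [-] = skip []
StairFrom-inc-at (step f) = skip f

StairFrom-inc-after : ∀ {n i k} {α : Vec ℕ n} → StairFrom i α → i < k → k < n →
  Swap k (inc (suc k) α) (inc (suc k) α)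
StairFrom-inc-after (skip f) (s≤s i<k) (s≤s k<n) = there (StairFrom-inc-after f i<k k<n)
StairFrom-inc-after {k = suc zero} (step f) _ _ = here
StairFrom-inc-after {k = suc (suc k)} (step f) _ (s≤s k<n) = there (StairFrom-inc-after f (s≤s z≤n) k<n)
StairFrom-inc-after {k = suc k} [-] _ (s≤s ())

StairFrom-≡ : ∀ {n i j} {α : Vec ℕ n} → i ≡ j → StairFrom i α → StairFrom j α
StairFrom-≡ ≡.refl f = f

-- The first m letters act before the stretch of unit steps; each further letter hits its first
-- position and shortens it by one.
StairFrom-incs : ∀ {n} h i m {α : Vec ℕ n} → m ≤ h → StairFrom (i + m) α →
  StairFrom (i + h) (incs (upFrom (suc i) h) α)
StairFrom-incs zero i .0 z≤n f = f
StairFrom-incs (suc h) i zero m≤h f = StairFrom-≡ (≡.sym (ℕ.+-suc i h))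
  (StairFrom-incs h (suc i) 0 z≤n (StairFrom-≡ (≡.sym (ℕ.+-identityʳ (suc i)))
    (StairFrom-inc-at (StairFrom-≡ (ℕ.+-identityʳ i) f))))
StairFrom-incs (suc h) i (suc m) (s≤s m≤h) f = StairFrom-≡ (≡.sym (ℕ.+-suc i h))
  (StairFrom-incs h (suc i) m m≤h (StairFrom-≡ (ℕ.+-suc i m)
    (StairFrom-inc-before (ℕ.m<m+n i (s≤s z≤n)) f)))

incColumns : ∀ {n} → List ℕ → Vec ℕ n → Vec ℕ n
incColumns [] α = α
incColumns (h ∷ hs) α = incColumns hs (incs (upFrom 1 h) α)

incs-comm : ∀ {n} u v (α : Vec ℕ n) → incs u (incs v α) ≡ incs v (incs u α)
incs-comm u v α = ≡.trans (≡.sym (incs-++ v u α)) (≡.trans (incs-↭ α (↭.++-comm v u)) (incs-++ u v α))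

incColumns-incs : ∀ {n} hs u (α : Vec ℕ n) → incColumns hs (incs u α) ≡ incs u (incColumns hs α)
incColumns-incs [] u α = ≡.refl
incColumns-incs (h ∷ hs) u α =
  ≡.trans (≡.cong (incColumns hs) (incs-comm (upFrom 1 h) u α)) (incColumns-incs hs u _)

incColumns-ʳ++ : ∀ {n} hs acc (α : Vec ℕ n) → incColumns (hs ʳ++ acc) α ≡ incColumns acc (incColumns hs α)
incColumns-ʳ++ [] acc α = ≡.refl
incColumns-ʳ++ (h ∷ hs) acc α = ≡.trans (incColumns-ʳ++ hs (h ∷ acc) α)
  (≡.cong (incColumns acc) (≡.sym (incColumns-incs hs (upFrom 1 h) α)))

incs-upFrom-∷ : ∀ {n} j p x (α : Vec ℕ n) → incs (upFrom (suc (suc j)) p) (x ∷ α) ≡ x ∷ incs (upFrom (suc j) p) α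
incs-upFrom-∷ j zero x α = ≡.refl
incs-upFrom-∷ j (suc p) x α = incs-upFrom-∷ (suc j) p x (inc (suc j) α)

toList-injective : ∀ {n} (μ ν : Vec ℕ n) → toList μ ≡ toList ν → μ ≡ ν
toList-injective μ ν e = ≡.trans (≡.sym (Vec.cast-is-id ≡.refl μ)) (Vec.toList-injective ≡.refl μ ν e)

zipWith-pred : ∀ {n} (α ν : Vec ℕ n) → IsPartition ν →
  zipWith _+_ (incs (upFrom 1 (positives (toList ν))) α) (Vec.map pred ν) ≡ zipWith _+_ α ν
zipWith-pred [] [] p = ≡.refl
zipWith-pred (x ∷ α) (zero ∷ ν) p = ≡.cong (zipWith _+_ (x ∷ α))
  (≡.cong (0 ∷_) (toList-injective _ _ (≡.trans (Vec.toList-map pred ν) (partition-0 (toList ν) p))))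
zipWith-pred (x ∷ α) (suc k ∷ ν) p
  rewrite incs-upFrom-∷ 0 (positives (toList ν)) (suc x) α =
  ≡.cong₂ _∷_ (≡.sym (ℕ.+-suc x k)) (zipWith-pred α ν (Linked.tail p))

zipWith-0 : ∀ {n} (α ν : Vec ℕ n) → All (_≤ 0) (toList ν) → zipWith _+_ α ν ≡ α
zipWith-0 [] [] [] = ≡.refl
zipWith-0 (x ∷ α) (.0 ∷ ν) (z≤n ∷ a) = ≡.cong₂ _∷_ (ℕ.+-identityʳ x) (zipWith-0 α ν a)

incColumns-columnHeights : ∀ {n} m (ν α : Vec ℕ n) → IsPartition ν → All (_≤ m) (toList ν) →
  incColumns (columnHeights m (toList ν)) α ≡ zipWith _+_ α ν
incColumns-columnHeights zero ν α p a = ≡.sym (zipWith-0 α ν a)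
incColumns-columnHeights (suc m) ν α p a = ≡.trans
  (≡.trans (≡.cong (λ ℓ → incColumns (columnHeights m ℓ) α′) (≡.sym (Vec.toList-map pred ν)))
    (incColumns-columnHeights m (Vec.map pred ν) α′
      (≡.subst (Linked _≥_) (≡.sym (Vec.toList-map pred ν)) (partition-pred p))
      (≡.subst (All (_≤ m)) (≡.sym (Vec.toList-map pred ν)) (pred-≤ a))))
  (zipWith-pred α ν p)
  where α′ = incs (upFrom 1 (positives (toList ν))) α

incColumns-readingHeights : ∀ {n} (ν α : Vec ℕ n) → IsPartition ν →
  incColumns (readingHeights (toList ν)) α ≡ zipWith _+_ α ν
incColumns-readingHeights [] [] p = ≡.refl
incColumns-readingHeights (h ∷ ν) α p = ≡.trans (incColumns-ʳ++ (columnHeights h (h ∷ toList ν)) [] α)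
  (incColumns-columnHeights h (h ∷ ν) α p (partition-≤ h (toList ν) p))

Heights↓⇒≤ : ∀ {b hs} → Heights↓ b hs → All (_≤ b) hs
Heights↓⇒≤ [] = []
Heights↓⇒≤ (p ∷ H) = p ∷ All.map (λ q → ℕ.≤-trans q p) (Heights↓⇒≤ H)

reverse-≤ : ∀ {b} hs acc → All (_≤ b) hs → All (_≤ b) acc → All (_≤ b) (hs ʳ++ acc)
reverse-≤ [] acc a a′ = a′
reverse-≤ (h ∷ hs) acc (p ∷ a) a′ = reverse-≤ hs (h ∷ acc) a (p ∷ a′)

readingHeights-≤ : ∀ ℓ → All (_≤ length ℓ) (readingHeights ℓ)
readingHeights-≤ [] = []
readingHeights-≤ (h ∷ ℓ) = reverse-≤ (columnHeights h (h ∷ ℓ)) []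
  (Heights↓⇒≤ (columnHeights-↓ h (h ∷ ℓ) (positives-length (h ∷ ℓ)))) []

module UpFromSum (R : CommutativeRing 0ℓ 0ℓ) where
  open CommutativeRing R using (Carrier; _≈_; 0#; refl; trans; +-cong; +-congˡ; +-identityˡ; +-identityʳ)
  open RingSums R

  ∑-upFrom-0 : ∀ i m {f : ℕ → Carrier} → (∀ a → i ≤ a → a < i + m → f a ≈ 0#) → ∑ (upFrom i m) f ≈ 0#
  ∑-upFrom-0 i zero e = refl
  ∑-upFrom-0 i (suc m) e = trans
    (+-cong (e i ℕ.≤-refl (ℕ.m<m+n i (s≤s z≤n)))
      (∑-upFrom-0 (suc i) m (λ a i<a a< → e a (ℕ.<⇒≤ i<a) (≡.subst (a <_) (≡.sym (ℕ.+-suc i m)) a<))))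
    (+-identityʳ 0#)

  ∑-upFrom-single : ∀ i m {f : ℕ → Carrier} a → i ≤ a → a < i + m →
    (∀ b → i ≤ b → b < i + m → b ≢ a → f b ≈ 0#) → ∑ (upFrom i m) f ≈ f a
  ∑-upFrom-single i zero a i≤a a<i e = ⊥-elim (ℕ.<⇒≱ a<i (≡.subst (_≤ a) (≡.sym (ℕ.+-identityʳ i)) i≤a))
  ∑-upFrom-single i (suc m) {f} a i≤a a< e with ℕ.m≤n⇒m<n∨m≡n i≤a
  ... | inj₁ i<a = trans
        (+-cong (e i ℕ.≤-refl (ℕ.m<m+n i (s≤s z≤n)) (ℕ.<⇒≢ i<a))
          (∑-upFrom-single (suc i) m a i<a (≡.subst (a <_) (ℕ.+-suc i m) a<)
            (λ b i<b b< → e b (ℕ.<⇒≤ i<b) (≡.subst (b <_) (≡.sym (ℕ.+-suc i m)) b<))))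
        (+-identityˡ _)
  ... | inj₂ ≡.refl = trans
        (+-congˡ (∑-upFrom-0 (suc i) m (λ b i<b b< →
          e b (ℕ.<⇒≤ i<b) (≡.subst (b <_) (≡.sym (ℕ.+-suc i m)) b<) (ℕ.>⇒≢ i<b))))
        (+-identityʳ _)

module Schur (R : CommutativeRing 0ℓ 0ℓ) (m : ℕ) where
  n : ℕ
  n = suc m

  open CommutativeRing R renaming (_+_ to _+R_; _*_ to _*R_; -_ to -R_)
  open RingSums R
  open UpFromSum R
  open Operators R n
  open Relation.Binary.Reasoning.Setoid setoid
  Y : ℕ → Carrier
  Y j = 0#
  open Expansion R n Y
  open ColumnSums operatorRing (range1 n) shift (λ j → scalar (Y j))
  private module QS = RingSums operatorRing
  module Q = CommutativeRing operatorRing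

  -- Without bars and starting from a staircase, the column 1, 2, …, h is the only one whose
  -- letters keep the exponents distinct.
  act-columnSum-unique : ∀ c h r i lo w g {ψ} α → w ≤ h → lo ≤ suc i → (∀ a → 1 ≤ a → lo ≤ a → i < a) →
    StairFrom (i + w) α → i + h ≤ n → AllAlternating ψ →
    (∀ {k} col → i < k → ConsecutiveIn k (range1 n) → length col ≡ h → Balanced k col →
      PreservesAlternating k (g col)) →
    act (columnSum c h r lo (upFrom (suc i) w) g) ψ α ≈ act (g (upFrom (suc i) h)) ψ (incs (upFrom (suc i) h) α)
  act-columnSum-unique c zero r i lo w g α w≤h lo≤ lo> f h≤n alt G = refl
  act-columnSum-unique c (suc h) r i lo w g {ψ} α w≤h lo≤ lo> f h≤n alt G = begin
    act (columnSum c (suc h) r lo (upFrom (suc i) w) g) ψ α ≈⟨ act-∑ (range1 n) _ ψ α ⟩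
    ∑ (range1 n) (λ a → act (ok a QS.▹ weight r c a ⊗ next a) ψ α)
      ≈⟨ ∑-cong (range1 n) (λ a → trans (act-▹ (ok a) _ ψ α)
           (▹-cong (ok a) (λ _ → trans (+-congˡ (zeroˡ _)) (+-identityʳ _)))) ⟩
    ∑ (range1 n) term ≈⟨ reflexive (≡.cong (λ xs → ∑ xs term) (range1≡upFrom n)) ⟩
    ∑ (upFrom 1 n) term ≈⟨ ∑-upFrom-single 1 n (suc i) (s≤s z≤n) (s≤s (ℕ.≤-trans i<i+h h≤n)) others ⟩
    term (suc i) ≈⟨ ▹-true (≡.cong₂ _∧_ (≤⇒≤ᵇ≡true lo≤) (head-ok w)) ⟩
    act (next (suc i)) ψ (inc (suc i) α)
      ≈⟨ tail w w≤h f ⟩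
    act (g (upFrom (suc i) (suc h))) ψ (incs (upFrom (suc i) (suc h)) α) ∎
    where
    ok : ℕ → Bool
    ok a = (lo ≤ᵇ a) ∧ leHead a (upFrom (suc i) w)
    next : ℕ → Operator
    next a = columnSum c h (suc r) (suc a) (drop 1 (upFrom (suc i) w)) (λ v → g (a ∷ v))
    term : ℕ → Carrier
    term a = ok a ▹ act (next a) ψ (inc a α)
    i<i+h : i < i + suc h
    i<i+h = ℕ.m<m+n i (s≤s z≤n)
    head-ok : ∀ w → leHead (suc i) (upFrom (suc i) w) ≡ true
    head-ok zero = ≡.refl
    head-ok (suc w) = ≤⇒≤ᵇ≡true (ℕ.≤-refl {suc i})
    h≤n′ : suc i + h ≤ n
    h≤n′ = ≡.subst (_≤ n) (ℕ.+-suc i h) h≤n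
    G′ : ∀ {k} col → suc i < k → ConsecutiveIn k (range1 n) → length col ≡ h → Balanced k col →
      PreservesAlternating k (g (suc i ∷ col))
    G′ col i<k cons e b = G (suc i ∷ col) (ℕ.<-trans (ℕ.n<1+n i) i<k) cons (≡.cong suc e) (low i<k b)
    tail : ∀ w → w ≤ suc h → StairFrom (i + w) α →
      act (columnSum c h (suc r) (suc (suc i)) (drop 1 (upFrom (suc i) w)) (λ v → g (suc i ∷ v))) ψ (inc (suc i) α)
        ≈ act (g (upFrom (suc i) (suc h))) ψ (incs (upFrom (suc i) (suc h)) α)
    tail zero _ f = act-columnSum-unique c h (suc r) (suc i) (suc (suc i)) 0 (λ v → g (suc i ∷ v)) (inc (suc i) α)
      z≤n ℕ.≤-refl (λ a _ p → p)
      (StairFrom-≡ (≡.sym (ℕ.+-identityʳ (suc i)))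
        (StairFrom-inc-at (StairFrom-≡ (ℕ.+-identityʳ i) f)))
      h≤n′ alt G′
    tail (suc w) (s≤s w≤h) f = act-columnSum-unique c h (suc r) (suc i) (suc (suc i)) w (λ v → g (suc i ∷ v)) (inc (suc i) α)
      w≤h ℕ.≤-refl (λ a _ p → p)
      (StairFrom-≡ (ℕ.+-suc i w)
        (StairFrom-inc-before (ℕ.m<m+n i (s≤s z≤n)) f))
      h≤n′ alt G′
    others : ∀ a → 1 ≤ a → a < 1 + n → a ≢ suc i → term a ≈ 0#
    others a 1≤a a≤n a≢ = ▹-0 (ok a) (λ t → vanish a a≤n
      (ℕ.≤∧≢⇒< (lo> a 1≤a (≤ᵇ≡true⇒≤ lo (proj₁ (∧-true t)))) (λ e → a≢ (≡.sym e)))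
      w f (proj₂ (∧-true {lo ≤ᵇ a} t)))
      where
      vanish : ∀ a → a < 1 + n → suc i < a → ∀ w → StairFrom (i + w) α → leHead a (upFrom (suc i) w) ≡ true →
        act (columnSum c h (suc r) (suc a) (drop 1 (upFrom (suc i) w)) (λ v → g (a ∷ v))) ψ (inc a α) ≈ 0#
      vanish a _ i<a (suc w) _ t = ⊥-elim (ℕ.<⇒≱ i<a (≤ᵇ≡true⇒≤ a t))
      -- Without a bound, a letter `suc k` beyond `suc i` ties the exponents k and `suc k`. The
      -- column now contains `suc k` and only larger letters follow, so the rest acts by an operator
      -- that preserves alternation, and the value is zero.
      vanish (suc k) (s≤s k<n) (s≤s i<k) zero f _ =
        Symmetry.P-columnSum-high operatorRing (range1 n) shift (λ j → scalar (Y j)) k cons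
          (PreservesAlternating k) (preservesAlternating k cons Y) c h (suc r) (suc (suc k)) []
          {λ v → g (suc k ∷ v)} (ℕ.n<1+n (suc k))
          (λ v e hi → G (suc k ∷ v) i<k cons (≡.cong suc e) (upper hi))
          (alt sw) .null sw
        where
        sw : Swap k (inc (suc k) α) (inc (suc k) α)
        sw = StairFrom-inc-after (StairFrom-≡ (ℕ.+-identityʳ i) f) i<k k<n
        cons = Swap-consecutive sw

  -- The surviving tableau has i in every box of row i. The index w of `StairFrom` is the height of
  -- the previous column: within that height the bound rules out larger letters, below it a tie
  -- does.
  act-tableauSum-unique : ∀ hs w {ψ} α → Heights w hs → All (_≤ n) hs → StairFrom w α → AllAlternating ψ →
    act (tableauSum hs (upFrom 1 w)) ψ α ≈ ψ (incColumns hs α)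
  act-tableauSum-unique [] w α H a f alt = refl
  act-tableauSum-unique (h ∷ hs) w α (w≤h ∷ H) (h≤n ∷ a) f alt = trans
    -- The lower bound of a fresh column is 0 while letters start at 1, so positivity of the letter
    -- has to come from the range.
    (act-columnSum-unique _ h 1 0 0 w (tableauSum hs) α w≤h z≤n (λ a p _ → p) f h≤n alt
      (λ col _ cons e b → tableauSum-alternating hs cons (≡.subst (λ m → Heights m hs) (≡.sym e) H) b))
    (act-tableauSum-unique hs h (incs (upFrom 1 h) α) H a (StairFrom-incs h 0 w w≤h f) alt)

  -- With all Y equal to zero the factorial weights become the variables, so the symmetry of tableau
  -- sums covers ordinary Schur functions as well.
  act-schur : (ρQ : Var → Operator) → (∀ a → ρQ (xv a) ≡ shift a) → (ν : Vec ℕ n) → IsPartition ν →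
    ∀ {ψ} → AllAlternating ψ →
    act (⟦ operatorRing ⟧ (schur ν) ρQ) ψ (staircase n) ≈ ψ (zipWith _+_ (staircase n) ν)
  act-schur ρQ e (h ∷ v) p {ψ} alt = begin
    act (⟦ operatorRing ⟧ (schur (h ∷ v)) ρQ) ψ (staircase n) ≈⟨ at eval ψ (staircase n) ⟩
    act (tableauSum hs []) ψ (staircase n)
      ≈⟨ act-tableauSum-unique hs 0 (staircase n) (readingHeights-↑ (h ∷ toList v))
           (≡.subst (λ z → All (_≤ z) hs) (Vec.length-toList (h ∷ v)) (readingHeights-≤ (h ∷ toList v)))
           (staircase-StairFrom n) alt ⟩
    ψ (incColumns hs (staircase n)) ≈⟨ reflexive (≡.cong ψ (incColumns-readingHeights (h ∷ v) (staircase n) p)) ⟩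
    ψ (zipWith _+_ (staircase n) (h ∷ v)) ∎
    where
    hs = readingHeights (h ∷ toList v)
    module QT = Transfer operatorRing
    weight-eq : ∀ r c a → ⟦ operatorRing ⟧ (var (xv a)) ρQ Q.≈ weight r c a
    weight-eq r c a = pointwise λ χ α → trans (reflexive (≡.cong (λ q → act q χ α) (e a)))
      (sym (trans (+-congˡ (zeroˡ _)) (+-identityʳ _)))
    eval : ⟦ operatorRing ⟧ (schur (h ∷ v)) ρQ Q.≈ tableauSum hs []
    eval = Q.trans (QT.eval-ΣP ρQ (SSYT (h ∷ v)) _)
      (Q.trans (QS.∑-filter isSemistandard (fillings (h ∷ toList v) (range1 n)) _)
        (TableauExpansion.eval-semistandard operatorRing (range1 n) shift (λ j → scalar (Y j)) ρQ
          (λ r c a → var (xv a)) weight-eq h (toList v) p))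

-- Extraction of coefficients

applyUpTo≡upFrom : ∀ f i m → (∀ j → f j ≡ i + j) → Data.List.applyUpTo f m ≡ upFrom i m
applyUpTo≡upFrom f i zero e = ≡.refl
applyUpTo≡upFrom f i (suc m) e = ≡.cong₂ _∷_ (≡.trans (e 0) (ℕ.+-identityʳ i))
  (applyUpTo≡upFrom (f ∘ suc) (suc i) m (λ j → ≡.trans (e (suc j)) (ℕ.+-suc i j)))

upFrom-< : ∀ i m → All (_< i + m) (upFrom i m)
upFrom-< i zero = []
upFrom-< i (suc m) = ℕ.m<m+n i (s≤s z≤n) ∷
  ≡.subst (λ z → All (_< z) (upFrom (suc i) m)) (≡.sym (ℕ.+-suc i m)) (upFrom-< (suc i) m)

barredEntries-≤ : ∀ {n e} → e ∈ barredEntries n → proj₂ e ≤ n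
barredEntries-≤ {n} e∈ with find (∈-concatMap⁻ (λ j → (false , j) ∷ (true , j) ∷ []) {xs = range1 n} e∈)
... | j , j∈ , here ≡.refl = s≤s⁻¹ (All.lookup (upFrom-< 1 n) (≡.subst (j ∈_) (range1≡upFrom n) j∈))
... | j , j∈ , there (here ≡.refl) = s≤s⁻¹ (All.lookup (upFrom-< 1 n) (≡.subst (j ∈_) (range1≡upFrom n) j∈))

module _ {n : ℕ} where
  private
    E : List Entry
    E = barredEntries (suc n)

  concat-columnWord-↭ : (Λ : List (Vec ℕ (suc n))) → All IsPartition Λ → ∀ {T} →
    Pointwise _∈_ T (map (λ λ' → fillings (toList λ') E) Λ) →
    concat (concat T) ↭ concatMap columnWord T × All (λ e → proj₂ e ≤ suc n) (concat (concat T))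
  concat-columnWord-↭ [] [] [] = ↭-refl , []
  concat-columnWord-↭ ((h ∷ v) ∷ Λ) (p ∷ ps) {t ∷ T} (t∈ ∷ T∈) with concat-columnWord-↭ Λ ps T∈ | ∈-fillings⁻ (h ∷ toList v) t∈
  ... | perm , bound | lens , entries =
    ≡.subst (_↭ concatMap columnWord (t ∷ T)) (concat-++ t (concat T))
      (↭.++⁺ (columnWord-↭ h (toList v) t p lens) perm) ,
    ≡.subst (All (λ e → proj₂ e ≤ suc n)) (concat-++ t (concat T))
      (All.++⁺ (All.concat⁺ (All.map (All.map barredEntries-≤) entries)) bound)

  letters-≤ : ∀ T → concat (concat T) ↭ concatMap columnWord T →
    All (λ e → proj₂ e ≤ suc n) (concat (concat T)) → All (_≤ suc n) (unbarredColumnWord T)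
  letters-≤ T perm bound = unbarredValues-All (concatMap columnWord T) (All.map⁺ (↭.All-resp-↭ perm bound))

sum-≤ : ∀ {n} (μ : Vec ℕ n) {N} → size μ ≤ N → All (_< suc N) (toList μ)
sum-≤ [] s = []
sum-≤ (x ∷ μ) s = s≤s (ℕ.≤-trans (ℕ.m≤m+n x _) s) ∷ sum-≤ μ (ℕ.≤-trans (ℕ.m≤n+m _ x) s)

module Extraction (R : CommutativeRing 0ℓ 0ℓ) (m : ℕ) (ρ : YVar → CommutativeRing.Carrier R)
    (μ : Vec ℕ (suc m)) (μ-partition : IsPartition μ) where
  open CommutativeRing R renaming (_+_ to _+R_; _*_ to _*R_; -_ to -R_)
  open RingSums R
  open UpFromSum R
  open Transfer R using (eval-ΣP)
  open Wedge R
  open Diagrams R m ρ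
  open Operators R n
  open Relation.Binary.Reasoning.Setoid setoid

  stair : Vec ℕ n
  stair = staircase n

  -- The form φ, with (n, …, 1) in the role of ρ.
  coefficient : Functional
  coefficient α = wedge α (toList (zipWith _+_ stair μ))

  coefficient-alternating : ∀ k → Alternating k coefficient
  coefficient-alternating k .anti s = wedge-anti s _
  coefficient-alternating k .null s = wedge-null s _

  coefficient-same : coefficient (zipWith _+_ stair μ) ≈ 1#
  coefficient-same = wedge-same (zipWith _+_ stair μ) (decreasing-staircase+ μ μ-partition)

  coefficient-different : ∀ {α} → decreasing α ≡ true → α ≢ zipWith _+_ stair μ → coefficient α ≈ 0#
  coefficient-different d = wedge-different _ _ d (decreasing-staircase+ μ μ-partition)

  act-embedY : ∀ p ψ α → act (evalQ (embedY p)) ψ α ≈ ⟦ R ⟧ p ρ *R ψ α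
  act-embedY (var v) ψ α = refl
  act-embedY 𝟘 ψ α = sym (zeroˡ _)
  act-embedY 𝟙 ψ α = sym (*-identityˡ _)
  act-embedY (p ⊕ q) ψ α = trans (+-cong (act-embedY p ψ α) (act-embedY q ψ α)) (sym (distribʳ _ _ _))
  act-embedY (p ⊗ q) ψ α = trans (act-embedY p _ α) (trans (*-congˡ (act-embedY q ψ α)) (sym (*-assoc _ _ _)))
  act-embedY (⊖ p) ψ α = trans (-‿cong (act-embedY p ψ α)) (-‿distribˡ-* _ _)
    where open Algebra.Properties.Ring ring using (-‿distribˡ-*)

  ∑-allVecs-single : ∀ {l} M (f : Vec ℕ l → Carrier) ν → All (_< M) (toList ν) →
    (∀ κ → κ ≢ ν → f κ ≈ 0#) → ∑ (allVecs l (upTo M)) f ≈ f ν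
  ∑-allVecs-single M f [] a e = +-identityʳ _
  ∑-allVecs-single {suc l} M f (x ∷ ν) (x<M ∷ a) e = begin
    ∑ (allVecs (suc l) (upTo M)) f ≈⟨ ∑-concatMap _ (upTo M) f ⟩
    ∑ (upTo M) (λ y → ∑ (map (y ∷_) (allVecs l (upTo M))) f) ≈⟨ ∑-cong (upTo M) (λ y → ∑-map (y ∷_) (allVecs l (upTo M)) f) ⟩
    ∑ (upTo M) (λ y → ∑ (allVecs l (upTo M)) (λ κ → f (y ∷ κ)))
      ≈⟨ reflexive (≡.cong (λ ys → ∑ ys (λ y → ∑ (allVecs l (upTo M)) (λ κ → f (y ∷ κ)))) (applyUpTo≡upFrom id 0 M (λ j → ≡.refl))) ⟩
    ∑ (upFrom 0 M) (λ y → ∑ (allVecs l (upTo M)) (λ κ → f (y ∷ κ)))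
      ≈⟨ ∑-upFrom-single 0 M x z≤n x<M (λ y _ _ y≢x → ∑-0 (allVecs l (upTo M)) (λ κ → e (y ∷ κ) (y≢x ∘ Vec.∷-injectiveˡ))) ⟩
    ∑ (allVecs l (upTo M)) (λ κ → f (x ∷ κ))
      ≈⟨ ∑-allVecs-single M (λ κ → f (x ∷ κ)) ν a (λ κ κ≢ν → e (x ∷ κ) (κ≢ν ∘ Vec.∷-injectiveʳ)) ⟩
    f (x ∷ ν) ∎

  extract-schur : (c : Vec ℕ n → Poly YVar) (N : ℕ) → (∀ ν → IsPartition ν → N < size ν → c ν ≈P 𝟘) →
    act (evalQ (ΣP (map (λ ν → embedY (c ν) ⊗ schur ν) (partitionsUpTo n N)))) coefficient stair ≈ ⟦ R ⟧ (c μ) ρ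
  extract-schur c N zero-beyond = begin
    act (evalQ (ΣP (map (λ ν → embedY (c ν) ⊗ schur ν) (partitionsUpTo n N)))) coefficient stair
      ≈⟨ at (QT.eval-ΣP ρQ (partitionsUpTo n N) _) coefficient stair ⟩
    act (QS.∑ (partitionsUpTo n N) (λ ν → evalQ (embedY (c ν)) ⊗ evalQ (schur ν))) coefficient stair
      ≈⟨ act-∑ 0 (partitionsUpTo n N) _ coefficient stair ⟩
    ∑ (partitionsUpTo n N) (λ ν → act (evalQ (embedY (c ν))) (act (evalQ (schur ν)) coefficient) stair)
      ≈⟨ ∑-filter keep (allVecs n (upTo (suc N))) _ ⟩
    ∑ (allVecs n (upTo (suc N))) (λ ν → keep ν ▹ act (evalQ (embedY (c ν))) (act (evalQ (schur ν)) coefficient) stair)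
      ≈⟨ ∑-cong (allVecs n (upTo (suc N))) (λ ν → ▹-cong (keep ν) (λ k → trans (act-embedY (c ν) _ stair)
           (*-congˡ (act-schur ρQ (λ a → ≡.refl) ν (kept⇒partition ν k) (λ {k} _ → coefficient-alternating k))))) ⟩
    ∑ (allVecs n (upTo (suc N))) term ≈⟨ pick ⟩
    ⟦ R ⟧ (c μ) ρ ∎
    where
    module QS = RingSums operatorRing
    open Schur R m using (act-schur)
    keep : Vec ℕ n → Bool
    keep ν = isYes (linked? _≥?_ (toList ν)) ∧ (size ν ≤ᵇ N)
    kept⇒partition : ∀ ν → keep ν ≡ true → IsPartition ν
    kept⇒partition ν k = toWitness {a? = linked? _≥?_ (toList ν)} (≡true⇒T (proj₁ (∧-true {isYes (linked? _≥?_ (toList ν))} k)))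
    term : Vec ℕ n → Carrier
    term ν = keep ν ▹ ⟦ R ⟧ (c ν) ρ *R coefficient (zipWith _+_ stair ν)
    others : ∀ ν → ν ≢ μ → term ν ≈ 0#
    others ν ν≢μ = ▹-0 (keep ν) (λ k → trans (*-congˡ (coefficient-different
      (decreasing-staircase+ ν (kept⇒partition ν k)) (ν≢μ ∘ zipWith-+-cancelˡ stair ν μ))) (zeroʳ _))
    pick : ∑ (allVecs n (upTo (suc N))) term ≈ ⟦ R ⟧ (c μ) ρ
    pick with size μ ≤? N
    ... | yes small = trans (∑-allVecs-single (suc N) term μ (sum-≤ μ small) others)
          (trans (▹-true (≡.cong₂ _∧_ (T⇒≡true (fromWitness {a? = linked? _≥?_ (toList μ)} μ-partition)) (≤⇒≤ᵇ≡true small)))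
            (trans (*-congˡ coefficient-same) (*-identityʳ _)))
    -- The truncated expansion does not contain μ, so the extracted value is zero, and so is `c μ`
    -- by the hypothesis on large sizes.
    ... | no large = trans (∑-0 (allVecs n (upTo (suc N))) all-zero)
          (sym (zero-beyond μ μ-partition (ℕ.≰⇒> large) R ρ))
      where
      all-zero : ∀ ν → term ν ≈ 0#
      all-zero ν with Vec.≡-dec ℕ._≟_ ν μ
      ... | no ν≢μ = others ν ν≢μ
      ... | yes ≡.refl = ▹-0 (keep ν) (λ k → ⊥-elim (large (≤ᵇ≡true⇒≤ (size ν) (proj₂ (∧-true {isYes (linked? _≥?_ (toList ν))} k)))))

  -- A Yamanouchi tableau reaches the decreasing exponent `stair` plus its unbarred content. The
  -- form is 1 there if the content is μ and 0 otherwise, so the tableaux counted by `LR` remain.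
  extract-LR : ∀ {r} (λs : Vec (Vec ℕ n) r) → All IsPartition (toList λs) →
    act (evalQ (prodFactorialSchur λs)) coefficient stair ≈ ⟦ R ⟧ (ΣP (map cT (LR λs μ))) ρ
  extract-LR λs ps = begin
    act (evalQ (prodFactorialSchur λs)) coefficient stair
      ≈⟨ reflexive (≡.cong (λ is → act (evalQ (ΠP (map (λ iλ → factorialSchur (proj₁ iλ) (proj₂ iλ)) (zip is Λ)))) coefficient stair)
           (range1≡upFrom (length Λ))) ⟩
    act (evalQ (productFrom 1 Λ)) coefficient stair
      ≈⟨ act-product 1 Λ ps stair (λ {k} _ → coefficient-alternating k) (decreasing-staircase n) ⟩
    ∑ Ts (λ T → (allSemistandard T ∧ yamanouchiFrom stair (unbarredColumnWord T)) ▹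
      ⟦ R ⟧ (barProductFrom 1 T) ρ *R coefficient (incs (unbarredColumnWord T) stair))
      ≈⟨ ∑-cong∈ Ts (λ T T∈ → trans (▹-∧ _ _) (▹-cong _ (λ _ → same T T∈))) ⟩
    ∑ Ts (λ T → allSemistandard T ▹ chosen T ▹ ⟦ R ⟧ (cT T) ρ)
      ≈⟨ ∑-filter allSemistandard Ts _ ⟨
    ∑ (barredSkewTableaux λs) (λ T → chosen T ▹ ⟦ R ⟧ (cT T) ρ)
      ≈⟨ ∑-filter chosen (barredSkewTableaux λs) _ ⟨
    ∑ (LR λs μ) (λ T → ⟦ R ⟧ (cT T) ρ) ≈⟨ eval-ΣP ρ (LR λs μ) cT ⟨
    ⟦ R ⟧ (ΣP (map cT (LR λs μ))) ρ ∎
    where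
    Λ = toList λs
    Ts = sequenceL (map (λ λ' → fillings (toList λ') E) Λ)
    chosen : List (List (List Entry)) → Bool
    chosen T = hasUnbarredContent T μ ∧ isYamanouchi n (unbarredColumnWord T)
    same : ∀ T → T ∈ Ts →
      (yamanouchiFrom stair (unbarredColumnWord T) ▹
        ⟦ R ⟧ (barProductFrom 1 T) ρ *R coefficient (incs (unbarredColumnWord T) stair)) ≈
      (chosen T ▹ ⟦ R ⟧ (cT T) ρ)
    same T T∈ = begin
      (yam ▹ ⟦ R ⟧ (barProductFrom 1 T) ρ *R coefficient (incs w stair))
        ≈⟨ ▹-cong yam (λ y → trans (*-cong weights (value y)) (trans (▹-*ʳ content 1#→c) (▹-cong content (λ _ → *-identityʳ _)))) ⟩
      (yam ▹ content ▹ ⟦ R ⟧ (cT T) ρ) ≈⟨ ▹-∧ yam content ⟨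
      ((yam ∧ content) ▹ ⟦ R ⟧ (cT T) ρ)
        ≈⟨ ▹-congˡ (≡.trans (∧-comm yam content)
             (≡.cong (content ∧_) (≡.sym (isYamanouchi≡yamanouchiFrom n w (letters-≤ T perm bound))))) ⟩
      (chosen T ▹ ⟦ R ⟧ (cT T) ρ) ∎
      where
      w = unbarredColumnWord T
      yam = yamanouchiFrom stair w
      content = hasUnbarredContent T μ
      1#→c = ⟦ R ⟧ (cT T) ρ
      facts = concat-columnWord-↭ Λ ps (∈-sequenceL⁻ _ T∈)
      perm = proj₁ facts
      bound = proj₂ facts
      weights : ⟦ R ⟧ (barProductFrom 1 T) ρ ≈ ⟦ R ⟧ (cT T) ρ
      weights = reflexive (≡.cong (λ is → ⟦ R ⟧ (ΠP (map (λ it → barPoly (proj₁ it) (proj₂ it)) (zip is T))) ρ)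
        (≡.sym (range1≡upFrom (length T))))
      -- The content is defined through the row reading; counts are invariant under the permutation
      -- that leads to the column word.
      content≡ : content ≡ eqListℕ (toList (counts 1 n w)) (toList μ)
      content≡ = ≡.cong (λ u → eqListℕ u (toList μ)) (≡.trans
        (≡.cong (map (λ k → count k (unbarredValues (concat (concat T))))) (range1≡upFrom n))
        (≡.trans (≡.sym (toList-counts 1 n (unbarredValues (concat (concat T)))))
          (≡.cong toList (counts-↭ 1 n (unbarredValues-↭ perm)))))
      value : yam ≡ true → coefficient (incs w stair) ≈ (content ▹ 1#)
      value y with content in e
      ... | true = trans (reflexive (≡.cong coefficient (≡.trans (incs-counts w stair)
              (≡.cong (zipWith _+_ stair) (toList-injective _ μ
                (eqListℕ⇒≡ _ _ (≡.trans (≡.sym content≡) e)))))))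
            (trans coefficient-same (sym (▹-true ≡.refl)))
      ... | false = trans (coefficient-different (yamanouchiFrom⇒decreasing stair w (decreasing-staircase n) y)
              (λ eq → absurd (≡.trans (≡.sym e) (≡.trans content≡ (≡.trans
                (≡.cong (λ κ → eqListℕ (toList κ) (toList μ))
                  (zipWith-+-cancelˡ stair _ μ (≡.trans (≡.sym (incs-counts w stair)) eq)))
                (eqListℕ-refl (toList μ)))))))
            (sym (▹-false ≡.refl))
        where
        absurd : false ≡ true → ⊥
        absurd ()

theorem2p2 : (n r : ℕ) → 1 ≤ n → 1 ≤ r →
    (λs : Vec (Vec ℕ n) r) → All IsPartition (Data.Vec.toList λs) →
    (c : Vec ℕ n → Poly YVar) (N : ℕ) →
    (∀ μ → IsPartition μ → N < size μ → c μ ≈P 𝟘) →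
    prodFactorialSchur λs ≈P ΣP (map (λ μ → embedY (c μ) ⊗ schur μ) (partitionsUpTo n N)) →
    ∀ μ → IsPartition μ → c μ ≈P ΣP (map cT (LR λs μ))
theorem2p2 (suc m) r (s≤s _) _ λs ps c N zero-beyond expansion μ p R ρ =
  trans (sym (extract-schur c N zero-beyond))
    (trans (sym (at (expansion operatorRing ρQ) coefficient stair)) (extract-LR λs ps))
  where
  open CommutativeRing R using (trans; sym)
  open Extraction R m ρ μ p
  open Diagrams R m ρ using (ρQ; n)
  open Operators R (suc m) using (operatorRing; at)
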